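{- Let $n\ge2$. The Haglund–Loehr zeta map of type $B_n$, $\zeta_B:\operatorname{Vert}(B_n)\to\operatorname{Diag}(B_n)$, $(\pi,v)\mapsto(\zeta_B(\pi),d_B(\pi,v))$, is a (well-defined) bijection.
   Context: $\mathcal L_{n,n}$: words in $\{N,E\}$ with $n$ of each letter; $\mathcal B_{2n}$: words of length $2n$ whose prefixes have at least as many $N$'s as $E$'s. Rise $i$: the $i$-th North step is immediately followed by a North step. Valley $(i,j)$: the $i$-th East step is immediately followed by the $j$-th North step; also $(i,j+1)$ if a ballot path with $i$ East and $j$ North steps ends with an East step. $\mathfrak S_n^B$: bijections $w$ of $\{\pm1,\dots,\pm n\}$ with $w(-i)=-w(i)$; set $w(0)=0$. $\operatorname{Vert}(B_n)$: pairs $(\pi,v)$, $\pi\in\mathcal L_{n,n}$, $v\in\mathfrak S_n^B$, with $v(i)<v(i+1)$ for every rise $i$ and $v(1)>0$ if $\pi$ begins with a North step. $\operatorname{Diag}(B_n)$: pairs $(\beta,w)$, $\beta\in\mathcal B_{2n}$, $w\in\mathfrak S_n^B$, with $w(n+1-i)>w(n+1-j)$ for every valley $(i,j)$ of $\beta$. For $\pi$: $\pi_i$ = number of East steps before the $i$-th North step; $\lambda_i=\pi_i$ ($i<n$), $\lambda_n=2\pi_n-\pi_{n-1}$ if $\pi_1+\dots+\pi_{n-2}$ even, $2n+1-2\pi_n+\pi_{n-1}$ if odd; area vector $\mu_i=\lambda_i-i$ ($i<n$), $\mu_n=\lambda_n-n$ if $n\equiv0,3\pmod4$, $\mu_n=n+1-\lambda_n$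 if $n\equiv1,2\pmod4$. For $a\in\mathbb Z^n$, $j\ge0$: $\overrightarrow{S}^+_j(a)$ reads $a$ left to right writing $N$ for entries $j$, $E$ for entries $j+1$; $\overleftarrow{S}^+_j(a)$ reads right to left; $\overrightarrow{S}^-_j,\overleftarrow{S}^-_j$ likewise with $N$ for $-j$, $E$ for $-j-1$. $\zeta_B(\pi)=\overleftarrow{S}^-_{2n}(\mu)\overrightarrow{S}^+_{2n}(\mu)\cdots\overleftarrow{S}^-_1(\mu)\overrightarrow{S}^+_1(\mu)\overleftarrow{S}^-_0(\mu)(N\overrightarrow{S}^+_0(\mu))^\circ$, $(\cdot)^\circ$ deleting the last letter. $d_B(\pi,v)$: for $i=0,1,2,\dots$ write $v(j)$ for rows $j$ with $\mu_j=-i$ in increasing $j$, then $-v(j)$ for rows $j$ with $\mu_j=i+1$ in decreasing $j$; then, if $\mu_{n-1}+\mu_n$ is even, change the sign of the entry coming from row $n$; the result is the window of $d_B(\pi,v)$. -}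

module Defs where

open import Data.Bool using (Bool; true; false; if_then_else_; _∧_; _∨_)
open import Data.Nat as ℕ using (ℕ; zero; suc; _≡ᵇ_; _⊔_; _∸_)
open import Data.Nat.DivMod using (_%_)
open import Data.Nat.ListAction using (sum)
open import Data.Integer as ℤ using (ℤ; +_; -[1+_]; ∣_∣)
open import Data.List using (List; []; _∷_; _++_; length; map; take; upTo; reverse; concatMap; zip; foldr)
open import Data.Product using (Σ; _×_; _,_)
open import Relation.Binary.PropositionalEquality using (_≡_)
open import Relation.Nullary.Decidable using (⌊_⌋)
open import Data.List.Relation.Binary.Permutation.Propositional using (_↭_)

data Step : Set where
  N E : Step

countN : List Step → ℕ
countN [] = 0
countN (N ∷ xs) = suc (countN xs)
countN (E ∷ xs) = countN xs

countE : List Step → ℕ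
countE [] = 0
countE (N ∷ xs) = countE xs
countE (E ∷ xs) = suc (countE xs)

InL : ℕ → List Step → Set
InL n π = countN π ≡ n × countE π ≡ n

IsBallot : ℕ → List Step → Set
IsBallot n β = length β ≡ 2 ℕ.* n × (∀ k → countE (take k β) ℕ.≤ countN (take k β))

data Rise (π : List Step) (i : ℕ) : Set where
  rise : (u w : List Step) → π ≡ u ++ N ∷ N ∷ w → suc (countN u) ≡ i → Rise π i

data Valley (β : List Step) (i j : ℕ) : Set where
  inner : (u w : List Step) → β ≡ u ++ E ∷ N ∷ w →
          suc (countE u) ≡ i → suc (countN u) ≡ j → Valley β i j
  final : (u : List Step) → β ≡ u ++ E ∷ [] →
          countE β ≡ i → suc (countN β) ≡ j → Valley β i j

-- Signed permutations, represented by their window (w(1),…,w(n))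

nthℤ : List ℤ → ℕ → ℤ
nthℤ [] k = + 0
nthℤ (x ∷ xs) zero = x
nthℤ (x ∷ xs) (suc k) = nthℤ xs k

ev : List ℤ → ℤ → ℤ
ev w (+ zero) = + 0
ev w (+ suc k) = nthℤ w k
ev w -[1+ k ] = ℤ.- nthℤ w k

IsSignedPerm : ℕ → List ℤ → Set
IsSignedPerm n w = length w ≡ n × map ∣_∣ w ↭ map suc (upTo n)

InVert : ℕ → List Step → List ℤ → Set
InVert n π v =
  InL n π × IsSignedPerm n v ×
  (∀ i → Rise π i → ev v (+ i) ℤ.< ev v (+ suc i)) ×
  (∀ rest → π ≡ N ∷ rest → + 0 ℤ.< ev v (+ 1))

InDiag : ℕ → List Step → List ℤ → Set
InDiag n β w =
  IsBallot n β × IsSignedPerm n w ×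
  (∀ i j → Valley β i j → ev w (+ suc n ℤ.- + i) ℤ.> ev w (+ suc n ℤ.- + j))

piSeqFrom : ℕ → List Step → List ℕ
piSeqFrom c [] = []
piSeqFrom c (N ∷ xs) = c ∷ piSeqFrom c xs
piSeqFrom c (E ∷ xs) = piSeqFrom (suc c) xs

piSeq : List Step → List ℕ
piSeq = piSeqFrom 0

nthℕ : List ℕ → ℕ → ℕ
nthℕ [] k = 0
nthℕ (x ∷ xs) zero = x
nthℕ (x ∷ xs) (suc k) = nthℕ xs k

-- π_i (1-based)
piAt : List Step → ℕ → ℕ
piAt π i = nthℕ (piSeq π) (i ∸ 1)

evenᵇ : ℕ → Bool
evenᵇ m = (m % 2) ≡ᵇ 0

lambdaN : ℕ → List Step → ℤ
lambdaN n π =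
  if evenᵇ (sum (take (n ∸ 2) (piSeq π)))
  then + (2 ℕ.* piAt π n) ℤ.- + piAt π (n ∸ 1)
  else (+ suc (2 ℕ.* n) ℤ.- + (2 ℕ.* piAt π n)) ℤ.+ + piAt π (n ∸ 1)

muN : ℕ → List Step → ℤ
muN n π =
  if ((n % 4) ≡ᵇ 0) ∨ ((n % 4) ≡ᵇ 3)
  then lambdaN n π ℤ.- + n
  else + suc n ℤ.- lambdaN n π

muList : ℕ → List Step → List ℤ
muList n π =
  map (λ i → + piAt π i ℤ.- + i) (map suc (upTo (n ∸ 1))) ++ muN n π ∷ []

readPlus : ℕ → ℤ → List Step
readPlus j x =
  if ⌊ x ℤ.≟ + j ⌋ then N ∷ []
  else if ⌊ x ℤ.≟ + suc j ⌋ then E ∷ [] else []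

readMinus : ℕ → ℤ → List Step
readMinus j x =
  if ⌊ x ℤ.≟ ℤ.- (+ j) ⌋ then N ∷ []
  else if ⌊ x ℤ.≟ ℤ.- (+ suc j) ⌋ then E ∷ [] else []

S→⁺ S←⁺ S→⁻ S←⁻ : ℕ → List ℤ → List Step
S→⁺ j a = concatMap (readPlus j) a
S←⁺ j a = concatMap (readPlus j) (reverse a)
S→⁻ j a = concatMap (readMinus j) a
S←⁻ j a = concatMap (readMinus j) (reverse a)

dropLast : List Step → List Step
dropLast [] = []
dropLast (x ∷ []) = []
dropLast (x ∷ y ∷ xs) = x ∷ dropLast (y ∷ xs)

zetaB : ℕ → List Step → List Step
zetaB n π =
  concatMap (λ j → S←⁻ j μ ++ S→⁺ j μ) (reverse (map suc (upTo (2 ℕ.* n))))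
  ++ S←⁻ 0 μ ++ dropLast (N ∷ S→⁺ 0 μ)
  where μ = muList n π

dB : ℕ → List Step → List ℤ → List ℤ
dB n π v = map fix raw
  where
  μ : List ℤ
  μ = muList n π
  rows : List (ℕ × ℤ)
  rows = zip (map suc (upTo n)) μ
  block : ℕ → List (ℕ × ℤ)
  block i =
    concatMap (λ { (j , m) → if ⌊ m ℤ.≟ ℤ.- (+ i) ⌋ then (j , ev v (+ j)) ∷ [] else [] }) rows
    ++ concatMap (λ { (j , m) → if ⌊ m ℤ.≟ + suc i ⌋ then (j , ℤ.- ev v (+ j)) ∷ [] else [] }) (reverse rows)
  -- i ranges over 0,1,…,M where M = max_j |μ_j|; larger i contribute nothing
  M : ℕ
  M = foldr _⊔_ 0 (map ∣_∣ μ)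
  raw : List (ℕ × ℤ)
  raw = concatMap block (upTo (suc M))
  flipRowN : Bool
  flipRowN = evenᵇ ∣ nthℤ μ (n ∸ 2) ℤ.+ nthℤ μ (n ∸ 1) ∣
  fix : ℕ × ℤ → ℤ
  fix (j , x) = if flipRowN ∧ (j ≡ᵇ n) then ℤ.- x else x

{-# OPTIONS --safe #-}
-- Read π as a walk from 0 to 0, with E going up and N going down; row i is the height
-- π_i - i at which the i-th N ends. Moving the last N of π (see Fold) replaces μ by the rows
-- of a walk π′ whose last row is nonpositive, without affecting ζ_B or, up to the sign of the
-- last label, d_B: the positions x and 1 - x of row n are read at the same place, with
-- opposite signs, and the parity in the definition of d_B cancels the difference.
--
-- The excursions of π′ below and above 0 are depth-first codes of plane forests, whose roots
-- are the rows of height 0. With an extra root labelled 0 for "row 0", and the roots of the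
-- upper part repeated with opposite labels on its other side, they form one forest of 2m + 1
-- trees, and ζ_B(π) N read backwards is its breadth-first code: N E^k for each node with k
-- children. The labels in breadth-first order are -w(m), …, -w(1), 0, w(1), …, w(n) with
-- w = d_B(π,v). So the map is a change from depth-first to breadth-first encoding, hence
-- bijective; rises of π and valleys of ζ_B(π) both correspond to pairs of a node and its
-- first child, and both conditions say that the child has the larger label.
module Submission where

open import Defs
open import Data.Bool using (Bool; true; false; if_then_else_; _∧_; _∨_)
open import Data.Bool.Properties using (∧-zeroʳ; ∧-identityʳ)
open import Data.Empty using (⊥; ⊥-elim)
open import Data.Fin using (#_)
open import Data.Integer as ℤ using (ℤ; +_; -[1+_]; ∣_∣)
open import Data.Integer.Properties as ℤₚ using (neg-involutive; neg-mono-<; neg-cancel-<; ∣-i∣≡∣i∣)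
open import Data.Integer.Solver using (module +-*-Solver)
open import Data.List hiding (sum)
open import Data.List.Properties
open import Data.List.Relation.Binary.Permutation.Propositional using (_↭_; prep; ↭-refl; ↭-sym; ↭-trans; ↭-reflexive)
open import Data.List.Relation.Binary.Permutation.Propositional.Properties
  using (++-comm; ++⁺ˡ; ++⁺ʳ; ++⁺; ↭-length; shifts; drop-∷; map⁺; ++-commutativeMonoid)
open import Data.Maybe using (Maybe; just; nothing)
open import Data.Nat as ℕ using (ℕ; zero; suc; _+_; _∸_; _≤_; _<_; z≤n; s≤s; _⊔_; _≡ᵇ_; _%_)
open import Data.Nat.ListAction using (sum)
open import Data.Nat.Properties
open import Data.Nat.Solver using () renaming (module +-*-Solver to ℕ-Solver)
open import Data.Product using (Σ; ∃; _×_; _,_; proj₁; proj₂)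
open import Data.Sum using (_⊎_; inj₁; inj₂)
open import Data.Unit using (⊤; tt)
open import Data.Vec using () renaming ([] to []ᵥ; _∷_ to _∷ᵥ_)
open import Function using (_∘_; id)
open import Relation.Binary.PropositionalEquality
  using (_≡_; _≢_; refl; sym; trans; cong; cong₂; subst; subst₂; module ≡-Reasoning)
open import Relation.Nullary using (yes; no)
open import Relation.Nullary.Decidable using (⌊_⌋)
open import Algebra.Solver.CommutativeMonoid (++-commutativeMonoid {A = ℕ}) using (prove; var; _⊕_)

-- Two groupings of one sequence meet here. ζ_B read backwards takes the upper rows of height `j`
-- and then the lower rows of height `-j`, whereas a block of d_B takes height `-i` and then height
-- `i + 1`. Both run through the same alternating list of upper and lower halves, cut at places half
-- a level apart; `levels-regroup` moves the cuts. This also accounts for x and 1 - x: one of them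
-- is some `-d`, the other is `d + 1`, and row n, being the last row, is read at the very end of the
-- half `-d` or at the very beginning of the next half `d + 1`.
--
-- For the inverse, the shape has to be recovered from (β , w) alone. The surplus of N over E in a
-- breadth-first word is the number 2m + 1 of trees, which gives m. The labels after 0 begin with
-- the roots to its right, so the first m entries of w, negated, are the roots to its left. Once the
-- walk is known, the parity of the number of E's between its last two N's tells which case of
-- `Fold` produced it.

-- Plane forests and their breadth-first words

data Tree : Set where
  node : ℤ → List Tree → Tree

Forest : Set
Forest = List Tree

label : Tree → ℤ
label (node a _) = a

children : Tree → Forest
children (node _ ch) = ch

roots : Forest → List ℤ
roots = map label

kids : Forest → Forest
kids = concatMap children

preorder : Forest → List ℤ
preorder [] = []
preorder (node a ch ∷ f) = a ∷ preorder ch ++ preorder f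

preorder-++ : ∀ f g → preorder (f ++ g) ≡ preorder f ++ preorder g
preorder-++ [] g = refl
preorder-++ (node a ch ∷ f) g = cong (a ∷_)
  (trans (cong (preorder ch ++_) (preorder-++ f g)) (sym (++-assoc (preorder ch) _ _)))

countN-++ : ∀ xs ys → countN (xs ++ ys) ≡ countN xs + countN ys
countN-++ [] ys = refl
countN-++ (N ∷ xs) ys = cong suc (countN-++ xs ys)
countN-++ (E ∷ xs) ys = countN-++ xs ys

countE-++ : ∀ xs ys → countE (xs ++ ys) ≡ countE xs + countE ys
countE-++ [] ys = refl
countE-++ (N ∷ xs) ys = countE-++ xs ys
countE-++ (E ∷ xs) ys = cong suc (countE-++ xs ys)

countN-E^ : ∀ c xs → countN (replicate c E ++ xs) ≡ countN xs
countN-E^ zero xs = refl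
countN-E^ (suc c) xs = countN-E^ c xs

countE-E^ : ∀ c xs → countE (replicate c E ++ xs) ≡ c + countE xs
countE-E^ zero xs = refl
countE-E^ (suc c) xs = cong suc (countE-E^ c xs)

++-injective : {A : Set} (xs ys : List A) {us vs : List A} → length xs ≡ length ys →
               xs ++ us ≡ ys ++ vs → xs ≡ ys × us ≡ vs
++-injective [] [] _ eq = refl , eq
++-injective (x ∷ xs) (y ∷ ys) len eq with ∷-injective eq
... | refl , eq′ with ++-injective xs ys (suc-injective len) eq′
... | refl , eq″ = refl , eq″

-- Breadth-first search with the forest as its queue; the word has one E per child.
data BFS : Forest → List Step → List ℤ → Set where
  done  : BFS [] [] []
  visit : ∀ {a ch f γ ls} → BFS (f ++ ch) γ ls →
          BFS (node a ch ∷ f) (N ∷ replicate (length ch) E ++ γ) (a ∷ ls)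

bfs-countN : ∀ {f γ ls} → BFS f γ ls → countN γ ≡ length ls
bfs-countN done = refl
bfs-countN (visit {ch = ch} {γ = γ} b) = cong suc (trans (countN-E^ (length ch) γ) (bfs-countN b))

-- Each node writes one N and, unless it is in the initial queue, is announced by exactly one E of
-- its parent. This surplus is what recovers the number of trees from a word.
bfs-balance : ∀ {f γ ls} → BFS f γ ls → countN γ ≡ length f + countE γ
bfs-balance done = refl
bfs-balance (visit {ch = ch} {f = f} {γ = γ} b) = cong suc (begin
  countN (replicate (length ch) E ++ γ)   ≡⟨ countN-E^ (length ch) γ ⟩
  countN γ                                ≡⟨ bfs-balance b ⟩
  length (f ++ ch) + countE γ             ≡⟨ cong (_+ countE γ) (length-++ f) ⟩
  (length f + length ch) + countE γ       ≡⟨ +-assoc (length f) _ _ ⟩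
  length f + (length ch + countE γ)       ≡⟨ cong (λ k → length f + k) (sym (countE-E^ (length ch) γ)) ⟩
  length f + countE (replicate (length ch) E ++ γ) ∎)
  where open ≡-Reasoning

bfs-roots : ∀ {f γ ls} → BFS f γ ls → ∃ λ rest → ls ≡ roots f ++ rest
bfs-roots done = [] , refl
bfs-roots (visit {a} {ch} {f} b) with bfs-roots b
... | rest , refl = roots ch ++ rest ,
  cong (a ∷_) (trans (cong (_++ rest) (map-++ label f ch)) (++-assoc (roots f) _ _))

bfs-preorder : ∀ {f γ ls} → BFS f γ ls → ls ↭ preorder f
bfs-preorder done = ↭-refl
bfs-preorder (visit {a} {ch} {f} b) = prep a (↭-trans (bfs-preorder b)
  (↭-trans (↭-reflexive (preorder-++ f ch)) (++-comm (preorder f) (preorder ch))))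

-- The run of E's behind an N has a well-defined length only if the remainder does not continue it.
NotE : List Step → Set
NotE [] = ⊤
NotE (N ∷ _) = ⊤
NotE (E ∷ _) = ⊥

bfs-NotE : ∀ {f γ ls} → BFS f γ ls → NotE γ
bfs-NotE done = tt
bfs-NotE (visit b) = tt

E^-injective : ∀ c d {γ δ} → NotE γ → NotE δ → replicate c E ++ γ ≡ replicate d E ++ δ → c ≡ d × γ ≡ δ
E^-injective zero zero _ _ eq = refl , eq
E^-injective zero (suc d) p q refl = ⊥-elim p
E^-injective (suc c) zero p q refl = ⊥-elim q
E^-injective (suc c) (suc d) p q eq with E^-injective c d p q (∷-injectiveʳ eq)
... | refl , eq′ = refl , eq′

-- The induction yields the queue after a visit, `f ++ ch`, in which the border between waiting
-- trees and new children is invisible; `bfs-balance` supplies the length of `f` and so the place to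
-- cut.
bfs-injective : ∀ {f g γ δ ls ms} → BFS f γ ls → BFS g δ ms → γ ≡ δ → ls ≡ ms → f ≡ g
bfs-injective done done _ _ = refl
bfs-injective b@(visit {a} {ch} {f} b₁) c@(visit {a′} {ch′} {g} c₁) γ≡δ ls≡ms
  with E^-injective (length ch) (length ch′) (bfs-NotE b₁) (bfs-NotE c₁) (∷-injectiveʳ γ≡δ) | ∷-injective ls≡ms
... | len , refl | refl , refl
  with ++-injective f g (suc-injective (+-cancelʳ-≡ _ _ _ lengths)) (bfs-injective b₁ c₁ refl refl)
  where
  lengths : suc (length f) + countE (N ∷ replicate (length ch) E ++ _) ≡ suc (length g) + countE (N ∷ replicate (length ch) E ++ _)
  lengths = trans (sym (bfs-balance b)) (trans (cong countN γ≡δ) (trans (bfs-balance c) (cong (λ e → suc (length g) + countE e) (sym γ≡δ))))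
... | refl , refl = refl

-- The ballot condition as seen in the reversed word.
SuffixBallot : List Step → Set
SuffixBallot [] = ⊤
SuffixBallot (x ∷ γ) = countE (x ∷ γ) ≤ countN (x ∷ γ) × SuffixBallot γ

ballot-head : ∀ γ → SuffixBallot γ → countE γ ≤ countN γ
ballot-head [] _ = z≤n
ballot-head (x ∷ γ) (p , _) = p

E^-ballot : ∀ c γ → c + countE γ ≤ countN γ → SuffixBallot γ → SuffixBallot (replicate c E ++ γ)
E^-ballot zero γ _ s = s
E^-ballot (suc c) γ le s =
  subst₂ _≤_ (cong suc (sym (countE-E^ c γ))) (sym (countN-E^ c γ)) le , E^-ballot c γ (≤-trans (n≤1+n _) le) s

-- Inside a run of E's, the children still to be announced are already among the trees of the next
-- queue, whose length is the surplus of N over E in the rest of the word.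
bfs-ballot : ∀ {f γ ls} → BFS f γ ls → SuffixBallot γ
bfs-ballot done = tt
bfs-ballot b@(visit {ch = ch} {f = f} {γ = γ} b₁) =
  subst (countE (replicate (length ch) E ++ γ) ≤_) (sym (bfs-balance b)) (m≤n+m _ (suc (length f))) ,
  E^-ballot (length ch) γ (subst (length ch + countE γ ≤_) (sym (bfs-balance b₁))
    (+-monoˡ-≤ (countE γ) (subst (length ch ≤_) (sym (length-++ f)) (m≤n+m _ _)))) (bfs-ballot b₁)

-- The word is processed from its right end. `c` counts the E's met since the last N, that is,
-- children whose parent has not appeared yet; the ballot condition guarantees that the queue holds
-- enough trees for them.
bfs-decode : ∀ γ ls → length ls ≡ countN γ → SuffixBallot γ →
             ∃ λ c → ∃ λ f → ∃ λ δ → γ ≡ replicate c E ++ δ × BFS f δ ls × c ≤ length f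
bfs-decode [] [] _ _ = 0 , [] , [] , refl , done , z≤n
bfs-decode (E ∷ γ) ls len (h , s) with bfs-decode γ ls len s
... | c , f , δ , refl , b , _ = suc c , f , δ , refl , b , +-cancelʳ-≤ (countE δ) _ _
  (subst₂ _≤_ (cong suc (countE-E^ c δ)) (trans (countN-E^ c δ) (bfs-balance b)) h)
bfs-decode (N ∷ γ) (a ∷ ls) len (h , s) with bfs-decode γ ls (suc-injective len) s
... | c , f , δ , refl , b , c≤ = 0 , node a ch ∷ g , _ , refl ,
  subst (λ k → BFS (node a ch ∷ g) (N ∷ replicate k E ++ δ) (a ∷ ls)) lench
    (visit (subst (λ h → BFS h δ ls) (sym (take++drop≡id (length f ∸ c) f)) b)) , z≤n
  where
  -- A visit appends the children at the back of the queue, so undoing it takes the last `c` trees.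
  g ch : Forest
  g = take (length f ∸ c) f
  ch = drop (length f ∸ c) f
  lench : length ch ≡ c
  lench = trans (length-drop (length f ∸ c) f) (m∸[m∸n]≡n c≤)

-- First-child inequalities in the breadth-first word

HeadAbove : ℤ → Forest → Set
HeadAbove a [] = ⊤
HeadAbove a (t ∷ _) = a ℤ.< label t

Increasing : Forest → Set
Increasing [] = ⊤
Increasing (node a ch ∷ f) = HeadAbove a ch × Increasing ch × Increasing f

increasing-++⁺ : ∀ f g → Increasing f → Increasing g → Increasing (f ++ g)
increasing-++⁺ [] g _ q = q
increasing-++⁺ (node a ch ∷ f) g (h , p , p′) q = h , p , increasing-++⁺ f g p′ q

increasing-++⁻ : ∀ f g → Increasing (f ++ g) → Increasing f × Increasing g
increasing-++⁻ [] g q = tt , q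
increasing-++⁻ (node a ch ∷ f) g (h , p , q) with increasing-++⁻ f g q
... | q₁ , q₂ = (h , p , q₁) , q₂

-- ρ k is the label of the (k+1)-st N, and of the (k+1)-st E, counted from the right end.
NEIncreasing : (ℕ → ℤ) → List Step → Set
NEIncreasing ρ [] = ⊤
NEIncreasing ρ (E ∷ γ) = NEIncreasing ρ γ
NEIncreasing ρ (N ∷ []) = ⊤
NEIncreasing ρ (N ∷ N ∷ γ) = NEIncreasing ρ (N ∷ γ)
NEIncreasing ρ (N ∷ E ∷ γ) = ρ (countN γ) ℤ.< ρ (countE γ) × NEIncreasing ρ γ

Indexes : (ℕ → ℤ) → List ℤ → Set
Indexes ρ [] = ⊤
Indexes ρ (x ∷ xs) = ρ (length xs) ≡ x × Indexes ρ xs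

indexes-++⁻ : ∀ ρ xs {ys} → Indexes ρ (xs ++ ys) → Indexes ρ ys
indexes-++⁻ ρ [] i = i
indexes-++⁻ ρ (x ∷ xs) (_ , i) = indexes-++⁻ ρ xs i

NE-E^ : ∀ ρ c γ → NEIncreasing ρ (replicate c E ++ γ) ≡ NEIncreasing ρ γ
NE-E^ ρ zero γ = refl
NE-E^ ρ (suc c) γ = NE-E^ ρ c γ

NE-N : ∀ ρ γ → NotE γ → NEIncreasing ρ (N ∷ γ) ≡ NEIncreasing ρ γ
NE-N ρ [] _ = refl
NE-N ρ (N ∷ γ) _ = refl

module _ (ρ : ℕ → ℤ) where
  private
    -- To the right of the E announcing `t` there is one E for each later sibling and one for each
    -- node outside the new queue. The same siblings and nodes follow `label t` in `ls`, so both
    -- have the same index from the right.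
    firstChild : ∀ {a ch t f γ ls} → BFS (f ++ t ∷ ch) γ ls → Indexes ρ (a ∷ ls) →
                 ρ (countN (replicate (length ch) E ++ γ)) ≡ a ×
                 ρ (countE (replicate (length ch) E ++ γ)) ≡ label t
    firstChild {a} {ch} {t} {f} {γ} {ls} b (i , is) with bfs-roots b
    ... | rest , refl = trans (cong ρ (trans (countN-E^ (length ch) γ) (bfs-countN b))) i ,
      trans (cong ρ eq) (proj₁ (indexes-++⁻ ρ (roots f) (subst (Indexes ρ) split is)))
      where
      split : roots (f ++ t ∷ ch) ++ rest ≡ roots f ++ label t ∷ roots ch ++ rest
      split = trans (cong (_++ rest) (map-++ label f (t ∷ ch))) (++-assoc (roots f) _ _)
      rest-length : length rest ≡ countE γ
      rest-length = +-cancelˡ-≡ (length (f ++ t ∷ ch)) _ _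
        (trans (cong (_+ length rest) (sym (length-map label (f ++ t ∷ ch))))
          (trans (sym (length-++ (roots (f ++ t ∷ ch)))) (trans (sym (bfs-countN b)) (bfs-balance b))))
      eq : countE (replicate (length ch) E ++ γ) ≡ length (roots ch ++ rest)
      eq = trans (countE-E^ (length ch) γ) (sym (trans (length-++ (roots ch)) (cong₂ _+_ (length-map label ch) rest-length)))

  bfs-increasing⁺ : ∀ {f γ ls} → BFS f γ ls → Indexes ρ ls → Increasing f → NEIncreasing ρ γ
  bfs-increasing⁺ done _ _ = tt
  bfs-increasing⁺ (visit {ch = []} {f = f} {γ = γ} b) (_ , is) (_ , _ , q) = subst (λ A → A) (sym (NE-N ρ γ (bfs-NotE b)))
    (bfs-increasing⁺ b is (increasing-++⁺ f [] q tt))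
  bfs-increasing⁺ (visit {ch = t ∷ ch} {f = f} {γ = γ} b) is (h , p , q) with firstChild b is
  ... | eN , eE = subst₂ ℤ._<_ (sym eN) (sym eE) h ,
    subst (λ A → A) (sym (NE-E^ ρ (length ch) γ)) (bfs-increasing⁺ b (proj₂ is) (increasing-++⁺ f (t ∷ ch) q p))

  bfs-increasing⁻ : ∀ {f γ ls} → BFS f γ ls → Indexes ρ ls → NEIncreasing ρ γ → Increasing f
  bfs-increasing⁻ done _ _ = tt
  bfs-increasing⁻ (visit {ch = []} {f = f} {γ = γ} b) (_ , is) p =
    tt , tt , proj₁ (increasing-++⁻ f [] (bfs-increasing⁻ b is (subst (λ A → A) (NE-N ρ γ (bfs-NotE b)) p)))
  bfs-increasing⁻ (visit {ch = t ∷ ch} {f = f} {γ = γ} b) is (h , p) with firstChild b is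
    | increasing-++⁻ f (t ∷ ch) (bfs-increasing⁻ b (proj₂ is) (subst (λ A → A) (NE-E^ ρ (length ch) γ) p))
  ... | eN , eE | q₁ , q₂ = subst₂ ℤ._<_ eN eE h , q₂ , q₁

-- Breadth-first order by generations

generation : ℕ → Forest → Forest
generation zero f = f
generation (suc j) f = generation j (kids f)

kids-++ : ∀ f g → kids (f ++ g) ≡ kids f ++ kids g
kids-++ = concatMap-++ children

generation-++ : ∀ j f g → generation j (f ++ g) ≡ generation j f ++ generation j g
generation-++ zero f g = refl
generation-++ (suc j) f g = trans (cong (generation j) (kids-++ f g)) (generation-++ j (kids f) (kids g))

sprout : Forest → List Step
sprout = concatMap (λ t → N ∷ replicate (length (children t)) E)

sprout-++ : ∀ f g → sprout (f ++ g) ≡ sprout f ++ sprout g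
sprout-++ = concatMap-++ (λ t → N ∷ replicate (length (children t)) E)

levels : {A : Set} → (ℕ → List A) → ℕ → List A
levels g k = concat (applyUpTo g k)

levels-cong : {A : Set} {g h : ℕ → List A} (k : ℕ) → (∀ j → j < k → g j ≡ h j) → levels g k ≡ levels h k
levels-cong zero eq = refl
levels-cong (suc k) eq = cong₂ _++_ (eq 0 (s≤s z≤n)) (levels-cong k (λ j j<k → eq (suc j) (s≤s j<k)))

levels-[] : {A : Set} {g : ℕ → List A} (k : ℕ) → (∀ j → g j ≡ []) → levels g k ≡ []
levels-[] zero eq = refl
levels-[] (suc k) eq = cong₂ _++_ (eq 0) (levels-[] k (eq ∘ suc))

levels-stable : {A : Set} {g : ℕ → List A} (k l : ℕ) → (∀ j → k ≤ j → g j ≡ []) → levels g (k + l) ≡ levels g k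
levels-stable zero l eq = levels-[] l (λ j → eq j z≤n)
levels-stable {g = g} (suc k) l eq = cong (g 0 ++_) (levels-stable k l (λ j k≤j → eq (suc j) (s≤s k≤j)))

levels-agree : {A : Set} {g : ℕ → List A} (k l : ℕ) → (∀ j → k ≤ j → g j ≡ []) → (∀ j → l ≤ j → g j ≡ []) →
               levels g k ≡ levels g l
levels-agree {g = g} k l p q = trans (sym (levels-stable k l p))
  (trans (cong (levels g) (+-comm k l)) (levels-stable l k q))

-- Used twice: for labels it turns generations into the blocks of d_B, and for words it brings
-- together the two places where the last row may be read.
levels-regroup : {A : Set} (a b : ℕ → List A) (k : ℕ) →
  levels (λ j → a j ++ b j) k ++ a k ≡ a 0 ++ levels (λ j → b j ++ a (suc j)) k
levels-regroup a b zero = sym (++-identityʳ (a 0))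
levels-regroup a b (suc k) = begin
  ((a 0 ++ b 0) ++ levels (λ j → a (suc j) ++ b (suc j)) k) ++ a (suc k)
    ≡⟨ ++-assoc (a 0 ++ b 0) _ _ ⟩
  (a 0 ++ b 0) ++ levels (λ j → a (suc j) ++ b (suc j)) k ++ a (suc k)
    ≡⟨ cong ((a 0 ++ b 0) ++_) (levels-regroup (a ∘ suc) (b ∘ suc) k) ⟩
  (a 0 ++ b 0) ++ a 1 ++ levels (λ j → b (suc j) ++ a (suc (suc j))) k
    ≡⟨ ++-assoc (a 0) _ _ ⟩
  a 0 ++ b 0 ++ a 1 ++ levels (λ j → b (suc j) ++ a (suc (suc j))) k
    ≡⟨ cong (a 0 ++_) (sym (++-assoc (b 0) _ _)) ⟩
  a 0 ++ (b 0 ++ a 1) ++ levels (λ j → b (suc j) ++ a (suc (suc j))) k ∎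
  where open ≡-Reasoning

bfs-forest : ∀ {f g γ ls} → f ≡ g → BFS f γ ls → BFS g γ ls
bfs-forest refl b = b

-- While a generation is being visited, the queue consists of its remainder `f` followed by the part
-- `g` of the next generation produced so far.
bfs-generation : ∀ f g {γ ls} → BFS (g ++ kids f) γ ls → BFS (f ++ g) (sprout f ++ γ) (roots f ++ ls)
bfs-generation [] g b = bfs-forest (++-identityʳ g) b
bfs-generation (node a ch ∷ f) g {γ} {ls} b =
  subst (λ δ → BFS (node a ch ∷ f ++ g) (N ∷ δ) (a ∷ roots f ++ ls))
    (sym (++-assoc (replicate (length ch) E) (sprout f) γ))
    (visit (bfs-forest (sym (++-assoc f g ch))
      (bfs-generation f (g ++ ch) (bfs-forest (sym (++-assoc g ch (kids f))) b))))

bfs-levels : ∀ k f → generation k f ≡ [] →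
  BFS f (levels (λ j → sprout (generation j f)) k) (levels (λ j → roots (generation j f)) k)
bfs-levels zero .[] refl = done
bfs-levels (suc k) f eq = bfs-forest (++-identityʳ f) (bfs-generation f [] (bfs-levels k (kids f) eq))

preorder-kids : ∀ f → preorder f ↭ roots f ++ preorder (kids f)
preorder-kids [] = ↭-refl
preorder-kids (node a ch ∷ f) = prep a (↭-trans (++⁺ˡ (preorder ch) (preorder-kids f))
  (↭-trans (shifts (preorder ch) (roots f))
    (↭-reflexive (cong (roots f ++_) (sym (preorder-++ ch (kids f)))))))

generation-[] : ∀ j → generation j [] ≡ []
generation-[] zero = refl
generation-[] (suc j) = generation-[] j

-- Passing to the children of a nonempty forest discards at least one root, so the size bounds the
-- number of generations.
generation-empty : ∀ k f → length (preorder f) ≤ k → generation k f ≡ []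
generation-empty k [] _ = generation-[] k
generation-empty (suc k) f@(node a ch ∷ f′) le = generation-empty k (kids f)
  (≤-trans (≤-trans (m≤n+m _ (length (roots f′))) (≤-reflexive (sym (length-++ (roots f′)))))
    (≤-pred (≤-trans (≤-reflexive (sym (↭-length (preorder-kids f)))) le)))

-- Reading generations off the depth-first order

depths : ℕ → Forest → List (ℕ × ℤ)
depths d [] = []
depths d (node a ch ∷ f) = (d , a) ∷ depths (suc d) ch ++ depths d f

depths-++ : ∀ d f g → depths d (f ++ g) ≡ depths d f ++ depths d g
depths-++ d [] g = refl
depths-++ d (node a ch ∷ f) g = cong ((d , a) ∷_)
  (trans (cong (depths (suc d) ch ++_) (depths-++ d f g)) (sym (++-assoc (depths (suc d) ch) _ _)))

depths-preorder : ∀ d f → map proj₂ (depths d f) ≡ preorder f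
depths-preorder d [] = refl
depths-preorder d (node a ch ∷ f) = cong (a ∷_) (trans (map-++ proj₂ (depths (suc d) ch) (depths d f))
  (cong₂ _++_ (depths-preorder (suc d) ch) (depths-preorder d f)))

stepAt : ℕ → ℕ × ℤ → List Step
stepAt j (d , _) = if d ≡ᵇ j then N ∷ [] else if d ≡ᵇ suc j then E ∷ [] else []

labelAt : ℕ → ℕ × ℤ → List ℤ
labelAt j (d , a) = if d ≡ᵇ j then a ∷ [] else []

≡ᵇ-true : ∀ m → (m ≡ᵇ m) ≡ true
≡ᵇ-true zero = refl
≡ᵇ-true (suc m) = ≡ᵇ-true m

≡ᵇ-false : ∀ m n → m ≢ n → (m ≡ᵇ n) ≡ false
≡ᵇ-false zero zero p = ⊥-elim (p refl)
≡ᵇ-false zero (suc n) p = refl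
≡ᵇ-false (suc m) zero p = refl
≡ᵇ-false (suc m) (suc n) p = ≡ᵇ-false m n (p ∘ cong suc)

labelAt-above : ∀ j k f → j < k → concatMap (labelAt j) (depths k f) ≡ []
labelAt-above j k [] _ = refl
labelAt-above j k (node a ch ∷ f) j<k rewrite ≡ᵇ-false k j (>⇒≢ j<k)
  | concatMap-++ (labelAt j) (depths (suc k) ch) (depths k f)
  | labelAt-above j (suc k) ch (m<n⇒m<1+n j<k) = labelAt-above j k f j<k

labelAt-depths : ∀ j k f → concatMap (labelAt (j + k)) (depths k f) ≡ roots (generation j f)
labelAt-depths j k [] = cong roots (sym (generation-[] j))
labelAt-depths zero k (node a ch ∷ f) rewrite ≡ᵇ-true k
  | concatMap-++ (labelAt k) (depths (suc k) ch) (depths k f)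
  | labelAt-above k (suc k) ch (n<1+n k) = cong (a ∷_) (labelAt-depths 0 k f)
labelAt-depths (suc j) k (node a ch ∷ f) rewrite ≡ᵇ-false k (suc (j + k)) (<⇒≢ (s≤s (m≤n+m k j)))
  | concatMap-++ (labelAt (suc (j + k))) (depths (suc k) ch) (depths k f)
  = begin
    concatMap (labelAt (suc (j + k))) (depths (suc k) ch) ++ concatMap (labelAt (suc j + k)) (depths k f)
      ≡⟨ cong₂ _++_ (trans (cong (λ i → concatMap (labelAt i) (depths (suc k) ch)) (sym (+-suc j k)))
           (labelAt-depths j (suc k) ch)) (labelAt-depths (suc j) k f) ⟩
    roots (generation j ch) ++ roots (generation j (kids f))
      ≡⟨ sym (trans (cong roots (generation-++ j ch (kids f))) (map-++ label (generation j ch) _)) ⟩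
    roots (generation j (ch ++ kids f)) ∎
  where open ≡-Reasoning

stepAt-above : ∀ j k f → suc j < k → concatMap (stepAt j) (depths k f) ≡ []
stepAt-above j k [] _ = refl
stepAt-above j k (node a ch ∷ f) j<k rewrite ≡ᵇ-false k j (>⇒≢ (<⇒≤ j<k)) | ≡ᵇ-false k (suc j) (>⇒≢ j<k)
  | concatMap-++ (stepAt j) (depths (suc k) ch) (depths k f)
  | stepAt-above j (suc k) ch (m<n⇒m<1+n j<k) = stepAt-above j k f j<k

stepAt-children : ∀ j f → concatMap (stepAt j) (depths (suc j) f) ≡ replicate (length f) E
stepAt-children j [] = refl
stepAt-children j (node a ch ∷ f) rewrite ≡ᵇ-false (suc j) j (>⇒≢ (n<1+n j)) | ≡ᵇ-true j
  | concatMap-++ (stepAt j) (depths (suc (suc j)) ch) (depths (suc j) f)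
  | stepAt-above j (suc (suc j)) ch (n<1+n (suc j)) = cong (E ∷_) (stepAt-children j f)

-- In preorder the children of a node come after it and before the next node of the same depth, and
-- everything else in that stretch lies deeper. Keeping only two consecutive depths therefore leaves
-- N followed by one E per child.
stepAt-depths : ∀ j k f → concatMap (stepAt (j + k)) (depths k f) ≡ sprout (generation j f)
stepAt-depths j k [] = cong sprout (sym (generation-[] j))
stepAt-depths zero k (node a ch ∷ f) rewrite ≡ᵇ-true k
  | concatMap-++ (stepAt k) (depths (suc k) ch) (depths k f)
  | stepAt-children k ch = cong (λ γ → N ∷ replicate (length ch) E ++ γ) (stepAt-depths 0 k f)
stepAt-depths (suc j) k (node a ch ∷ f)
  rewrite ≡ᵇ-false k (suc (j + k)) (<⇒≢ (s≤s (m≤n+m k j)))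
  | ≡ᵇ-false k (suc (suc (j + k))) (<⇒≢ (s≤s (m≤n⇒m≤1+n (m≤n+m k j))))
  | concatMap-++ (stepAt (suc (j + k))) (depths (suc k) ch) (depths k f)
  = begin
    concatMap (stepAt (suc (j + k))) (depths (suc k) ch) ++ concatMap (stepAt (suc j + k)) (depths k f)
      ≡⟨ cong₂ _++_ (trans (cong (λ i → concatMap (stepAt i) (depths (suc k) ch)) (sym (+-suc j k)))
           (stepAt-depths j (suc k) ch)) (stepAt-depths (suc j) k f) ⟩
    sprout (generation j ch) ++ sprout (generation j (kids f))
      ≡⟨ sym (trans (cong sprout (generation-++ j ch (kids f))) (sprout-++ (generation j ch) _)) ⟩
    sprout (generation j (ch ++ kids f)) ∎
  where open ≡-Reasoning

-- Labelled paths as drawings of forests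

data LStep : Set where
  north : ℤ → LStep
  east  : LStep

unlabel : LStep → Step
unlabel (north _) = N
unlabel east = E

steps : List LStep → List Step
steps = map unlabel

labels : List LStep → List ℤ
labels [] = []
labels (north a ∷ L) = a ∷ labels L
labels (east ∷ L) = labels L

attach : List Step → List ℤ → List LStep
attach [] _ = []
attach (E ∷ π) v = east ∷ attach π v
attach (N ∷ π) [] = []
attach (N ∷ π) (a ∷ v) = north a ∷ attach π v

steps-attach : ∀ π v → length v ≡ countN π → steps (attach π v) ≡ π
steps-attach [] v eq = refl
steps-attach (E ∷ π) v eq = cong (E ∷_) (steps-attach π v eq)
steps-attach (N ∷ π) (a ∷ v) eq = cong (N ∷_) (steps-attach π v (suc-injective eq))

labels-attach : ∀ π v → length v ≡ countN π → labels (attach π v) ≡ v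
labels-attach [] [] eq = refl
labels-attach (E ∷ π) v eq = labels-attach π v eq
labels-attach (N ∷ π) (a ∷ v) eq = cong (a ∷_) (labels-attach π v (suc-injective eq))

labels-++ : ∀ K L → labels (K ++ L) ≡ labels K ++ labels L
labels-++ [] L = refl
labels-++ (north a ∷ K) L = cong (a ∷_) (labels-++ K L)
labels-++ (east ∷ K) L = labels-++ K L

length-labels : ∀ L → length (labels L) ≡ countN (steps L)
length-labels [] = refl
length-labels (north a ∷ L) = cong suc (length-labels L)
length-labels (east ∷ L) = length-labels L

-- A forest drawn as a sequence of excursions of a walk (E up, N down): downward
-- excursions, where a node is the N opening its excursion, or upward ones, traversed
-- backwards and with negated labels, where a node is the closing N.
below : Forest → List LStep
below [] = []
below (node a ch ∷ f) = north a ∷ below ch ++ east ∷ below f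

above : Forest → List LStep
above [] = []
above (node a ch ∷ f) = above f ++ east ∷ above ch ++ north (ℤ.- a) ∷ []

-- `(p , z , q)` stands for an excursion above 0 with forest `p`, closed by the N labelled `z`,
-- which is a row of height 0, and the excursions `q` below 0 up to the next arch.
Arch : Set
Arch = Forest × ℤ × Forest

arches : List Arch → List LStep
arches [] = []
arches ((p , z , q) ∷ s) = east ∷ above p ++ north z ∷ below q ++ arches s

Shape : Set
Shape = Forest × List Arch

walk : Shape → List LStep
walk (f , s) = below f ++ arches s

above-++ : ∀ f g → above (f ++ g) ≡ above g ++ above f
above-++ [] g = sym (++-identityʳ (above g))
above-++ (node a ch ∷ f) g = trans (cong (_++ (east ∷ above ch ++ north (ℤ.- a) ∷ [])) (above-++ f g))
  (++-assoc (above g) (above f) _)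

-- The suffix of a walk from height length stk, resp. - suc (length fs), on.
data State : Set where
  up   : List (Forest × ℤ) → Shape → State
  down : Forest → List Forest → Shape → State

descend : List (Forest × ℤ) → List LStep → List LStep
descend [] L = L
descend ((p , a) ∷ stk) L = above p ++ north a ∷ descend stk L

ascend : List Forest → List LStep → List LStep
ascend [] L = L
ascend (f ∷ fs) L = below f ++ east ∷ ascend fs L

suffix : State → List LStep
suffix (up stk s) = descend stk (walk s)
suffix (down f fs s) = ascend (f ∷ fs) (walk s)

AtHeight : State → List LStep → Set
AtHeight (up stk s) L = countN (steps L) ≡ length stk + countE (steps L)
AtHeight (down f fs s) L = suc (length fs) + countN (steps L) ≡ countE (steps L)

below-∷ : ∀ a f g L → below (node a f ∷ g) ++ L ≡ north a ∷ below f ++ east ∷ below g ++ L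
below-∷ a f g L = cong (north a ∷_) (++-assoc (below f) _ L)

-- The path is read from the right, so that the N closing an upward excursion, which carries the
-- label, is met before its E. A step leading away from height 0 in this reading opens a new stack
-- entry; a step leading back merges the top entry into the one beneath.
parse : ∀ L → ∃ λ st → suffix st ≡ L × AtHeight st L
parse [] = up [] ([] , []) , refl , refl
parse (north a ∷ L) with parse L
... | up stk s , refl , h = up (([] , a) ∷ stk) s , refl , cong suc h
... | down f [] (g , s) , refl , h = up [] (node a f ∷ g , s) , below-∷ a f g (arches s) , h
... | down f (g ∷ fs) s , refl , h = down (node a f ∷ g) fs s ,
  below-∷ a f g _ , trans (+-suc (suc (length fs)) _) h
parse (east ∷ L) with parse L
... | up [] s , refl , h = down [] [] s , refl , cong suc h
-- This E leaves height 0, so an arch is complete; the downward excursions collected in `g` hang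
-- from its closing row.
... | up ((p , a) ∷ []) (g , s) , refl , h = up [] ([] , (p , a , g) ∷ s) , refl , h
-- Upward forests are drawn from right to left, so the leftmost excursion becomes the last tree.
... | up ((p , a) ∷ (q , b) ∷ stk) s , refl , h =
  up ((q ++ node (ℤ.- a) p ∷ [] , b) ∷ stk) s ,
  (begin
    above (q ++ node (ℤ.- a) p ∷ []) ++ R           ≡⟨ cong (_++ R) (above-++ q _) ⟩
    (east ∷ (above p ++ north (ℤ.- ℤ.- a) ∷ []) ++ above q) ++ R
      ≡⟨ cong (λ c → (east ∷ (above p ++ north c ∷ []) ++ above q) ++ R) (neg-involutive a) ⟩
    (east ∷ (above p ++ north a ∷ []) ++ above q) ++ R
      ≡⟨ cong (λ K → east ∷ K ++ R) (++-assoc (above p) (north a ∷ []) (above q)) ⟩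
    east ∷ (above p ++ north a ∷ above q) ++ R      ≡⟨ cong (east ∷_) (++-assoc (above p) _ R) ⟩
    east ∷ above p ++ north a ∷ above q ++ R        ∎) ,
  trans h (sym (+-suc (suc (length stk)) _))
  where
  open ≡-Reasoning
  R : List LStep
  R = north b ∷ descend stk (walk s)
... | down f fs s , refl , h = down [] (f ∷ fs) s , refl , cong suc h

parse-balanced : ∀ L → countN (steps L) ≡ countE (steps L) → ∃ λ s → walk s ≡ L
parse-balanced L bal with parse L
... | up [] s , eq , _ = s , eq
... | up (_ ∷ stk) s , _ , h = ⊥-elim (m+1+n≢m (countE (steps L)) (trans (+-suc _ _)
  (trans (cong suc (+-comm (countE (steps L)) (length stk))) (trans (sym h) bal))))
... | down f fs s , _ , h = ⊥-elim (m+1+n≢m (countN (steps L)) (trans (+-suc _ _)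
  (trans (cong suc (+-comm (countN (steps L)) (length fs))) (trans h (sym bal)))))

Balanced : List LStep → Set
Balanced L = countN (steps L) ≡ countE (steps L)

balanced-++ : ∀ K L → Balanced K → Balanced L → Balanced (K ++ L)
balanced-++ K L p q rewrite map-++ unlabel K L | countN-++ (steps K) (steps L) | countE-++ (steps K) (steps L) = cong₂ _+_ p q

balanced-insert : ∀ a K L → Balanced (K ++ L) → Balanced (east ∷ K ++ north a ∷ L)
balanced-insert a K L p rewrite map-++ unlabel K (north a ∷ L) | countN-++ (steps K) (N ∷ steps L) | countE-++ (steps K) (N ∷ steps L)
  | map-++ unlabel K L | countN-++ (steps K) (steps L) | countE-++ (steps K) (steps L) = trans (+-suc _ _) (cong suc p)

below-balanced : ∀ f → Balanced (below f)
below-balanced [] = refl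
below-balanced (node a ch ∷ f) rewrite map-++ unlabel (below ch) (east ∷ below f)
  | countN-++ (steps (below ch)) (E ∷ steps (below f)) | countE-++ (steps (below ch)) (E ∷ steps (below f)) =
  trans (cong suc (cong₂ _+_ (below-balanced ch) (below-balanced f))) (sym (+-suc _ _))

above-balanced : ∀ f → Balanced (above f)
above-balanced [] = refl
above-balanced (node a ch ∷ f) = balanced-++ (above f) _ (above-balanced f)
  (balanced-insert (ℤ.- a) (above ch) [] (balanced-++ (above ch) [] (above-balanced ch) refl))

arches-balanced : ∀ s → Balanced (arches s)
arches-balanced [] = refl
arches-balanced ((p , z , q) ∷ s) = balanced-insert z (above p) (below q ++ arches s)
  (balanced-++ (above p) _ (above-balanced p) (balanced-++ (below q) _ (below-balanced q) (arches-balanced s)))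

walk-balanced : ∀ s → Balanced (walk s)
walk-balanced (f , s) = balanced-++ (below f) _ (below-balanced f) (arches-balanced s)

-- The forest of a walk; rises as first-child inequalities

leftTree rightTree : Arch → Tree
leftTree (p , z , q) = node (ℤ.- z) p
rightTree (p , z , q) = node z q

root : Arch → ℤ
root (p , z , q) = z

left right forest : Shape → Forest
left (f , s) = reverse (map leftTree s)
right (f , s) = node (+ 0) f ∷ map rightTree s
forest s = left s ++ right s

-- The first argument is the label of an N immediately before the word.
Rising : Maybe ℤ → List LStep → Set
Rising _ [] = ⊤
Rising _ (east ∷ L) = Rising nothing L
Rising nothing (north a ∷ L) = Rising (just a) L
Rising (just b) (north a ∷ L) = b ℤ.< a × Rising (just a) L

NotNorth : List LStep → Set
NotNorth [] = ⊤
NotNorth (east ∷ _) = ⊤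
NotNorth (north _ ∷ _) = ⊥

arches-NotNorth : ∀ s → NotNorth (arches s)
arches-NotNorth [] = tt
arches-NotNorth (_ ∷ s) = tt

rising-NotNorth : ∀ {p q} L → NotNorth L → Rising p L → Rising q L
rising-NotNorth [] _ _ = tt
rising-NotNorth (east ∷ L) _ r = r

below-rising⁺ : ∀ f L → Increasing f → Rising nothing L → Rising nothing (below f ++ L)
below-rising⁺′ : ∀ a f L → NotNorth L → HeadAbove a f → Increasing f → Rising nothing L → Rising (just a) (below f ++ L)
below-rising⁺ [] L _ r = r
below-rising⁺ (node a ch ∷ f) L (h , i , j) r rewrite ++-assoc (below ch) (east ∷ below f) L =
  below-rising⁺′ a ch _ tt h i (below-rising⁺ f L j r)
below-rising⁺′ a [] L nn _ _ r = rising-NotNorth L nn r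
below-rising⁺′ a f@(node _ _ ∷ _) L _ h i r = h , below-rising⁺ f L i r

below-rising⁻ : ∀ f L → Rising nothing (below f ++ L) → Increasing f × Rising nothing L
below-rising⁻′ : ∀ a f L → NotNorth L → Rising (just a) (below f ++ L) → HeadAbove a f × Increasing f × Rising nothing L
below-rising⁻ [] L r = tt , r
below-rising⁻ (node a ch ∷ f) L r rewrite ++-assoc (below ch) (east ∷ below f) L with below-rising⁻′ a ch _ tt r
... | h , i , r′ with below-rising⁻ f L r′
... | j , r″ = (h , i , j) , r″
below-rising⁻′ a [] L nn r = tt , tt , rising-NotNorth L nn r
below-rising⁻′ a f@(node _ _ ∷ _) L _ (h , r) with below-rising⁻ f L r
... | i , r′ = h , i , r′

-- An upward forest is drawn backwards, so its last N belongs to its first root.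
lastNorth : Forest → Maybe ℤ
lastNorth [] = nothing
lastNorth (node a _ ∷ _) = just (ℤ.- a)

-- Above 0 the N of the first child immediately precedes that of its parent, and both labels are
-- negated; the two reversals cancel.
rising-lastNorth⁺ : ∀ a ch L → HeadAbove a ch → Rising (just (ℤ.- a)) L → Rising (lastNorth ch) (north (ℤ.- a) ∷ L)
rising-lastNorth⁺ a [] L _ r = r
rising-lastNorth⁺ a (node _ _ ∷ _) L h r = neg-mono-< h , r

rising-lastNorth⁻ : ∀ a ch L → Rising (lastNorth ch) (north (ℤ.- a) ∷ L) → HeadAbove a ch × Rising (just (ℤ.- a)) L
rising-lastNorth⁻ a [] L r = tt , r
rising-lastNorth⁻ a (node _ _ ∷ _) L (h , r) = neg-cancel-< h , r

above-assoc : ∀ a ch f L → above (node a ch ∷ f) ++ L ≡ above f ++ east ∷ above ch ++ north (ℤ.- a) ∷ L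
above-assoc a ch f L = trans (++-assoc (above f) _ L)
  (cong (λ K → above f ++ east ∷ K) (++-assoc (above ch) (north (ℤ.- a) ∷ []) L))

above-rising⁺ : ∀ f L → Increasing f → Rising (lastNorth f) L → Rising nothing (above f ++ L)
above-rising⁺ [] L _ r = r
above-rising⁺ (node a ch ∷ f) L (h , i , j) r rewrite above-assoc a ch f L =
  above-rising⁺ f _ j (above-rising⁺ ch _ i (rising-lastNorth⁺ a ch L h r))

above-rising⁻ : ∀ f L → Rising nothing (above f ++ L) → Increasing f × Rising (lastNorth f) L
above-rising⁻ [] L r = tt , r
above-rising⁻ (node a ch ∷ f) L r rewrite above-assoc a ch f L with above-rising⁻ f _ r
... | j , r₁ with above-rising⁻ ch _ r₁
... | i , r₂ with rising-lastNorth⁻ a ch L r₂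
... | h , r₃ = (h , i , j) , r₃

rising-root⁺ : ∀ z p L → HeadAbove (ℤ.- z) p → Rising (just z) L → Rising (lastNorth p) (north z ∷ L)
rising-root⁺ z p L h r = subst (λ y → Rising (lastNorth p) (north y ∷ L)) (neg-involutive z)
  (rising-lastNorth⁺ (ℤ.- z) p L h (subst (λ y → Rising (just y) L) (sym (neg-involutive z)) r))

rising-root⁻ : ∀ z p L → Rising (lastNorth p) (north z ∷ L) → HeadAbove (ℤ.- z) p × Rising (just z) L
rising-root⁻ z p L r with rising-lastNorth⁻ (ℤ.- z) p L (subst (λ y → Rising (lastNorth p) (north y ∷ L)) (sym (neg-involutive z)) r)
... | h , r′ = h , subst (λ y → Rising (just y) L) (neg-involutive z) r′

left-∷ : ∀ f x s → left (f , x ∷ s) ≡ left (f , s) ++ leftTree x ∷ []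
left-∷ f x s = unfold-reverse (leftTree x) (map leftTree s)

arches-rising⁺ : ∀ f s → Increasing (left (f , s)) → Increasing (map rightTree s) → Rising nothing (arches s)
arches-rising⁺ f [] _ _ = tt
arches-rising⁺ f ((p , z , q) ∷ s) l (k , j , r) with increasing-++⁻ (left (f , s)) _ (subst Increasing (left-∷ f (p , z , q) s) l)
... | l′ , h , i , _ = above-rising⁺ p _ i (rising-root⁺ z p _ h
  (below-rising⁺′ z q _ (arches-NotNorth s) k j (arches-rising⁺ f s l′ r)))

arches-rising⁻ : ∀ f s → Rising nothing (arches s) → Increasing (left (f , s)) × Increasing (map rightTree s)
arches-rising⁻ f [] _ = tt , tt
arches-rising⁻ f ((p , z , q) ∷ s) r with above-rising⁻ p _ r
... | i , r₁ with rising-root⁻ z p _ r₁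
... | h , r₂ with below-rising⁻′ z q _ (arches-NotNorth s) r₂
... | k , j , r₃ with arches-rising⁻ f s r₃
... | l , m = subst Increasing (sym (left-∷ f (p , z , q) s)) (increasing-++⁺ (left (f , s)) _ l (h , i , tt)) , k , j , m

walk-rising⁺ : ∀ s → Increasing (forest s) → Rising (just (+ 0)) (walk s)
walk-rising⁺ (f , s) i with increasing-++⁻ (left (f , s)) _ i
... | l , h , j , r = below-rising⁺′ (+ 0) f _ (arches-NotNorth s) h j (arches-rising⁺ f s l r)

walk-rising⁻ : ∀ s → Rising (just (+ 0)) (walk s) → Increasing (forest s)
walk-rising⁻ (f , s) r with below-rising⁻′ (+ 0) f _ (arches-NotNorth s) r
... | h , j , r′ with arches-rising⁻ f s r′
... | l , m = increasing-++⁺ (left (f , s)) _ l (h , j , m)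

-- Labels up to sign

abs : List ℤ → List ℕ
abs = map ∣_∣

abs-++ : ∀ xs ys → abs (xs ++ ys) ≡ abs xs ++ abs ys
abs-++ = map-++ ∣_∣

below-labels : ∀ f → labels (below f) ≡ preorder f
below-labels [] = refl
below-labels (node a ch ∷ f) = cong (a ∷_) (trans (labels-++ (below ch) _) (cong₂ _++_ (below-labels ch) (below-labels f)))

above-labels : ∀ f → abs (labels (above f)) ↭ abs (preorder f)
above-labels [] = ↭-refl
above-labels (node a ch ∷ f)
  rewrite labels-++ (above f) (east ∷ above ch ++ north (ℤ.- a) ∷ []) | labels-++ (above ch) (north (ℤ.- a) ∷ [])
  | abs-++ (labels (above f)) (labels (above ch) ++ ℤ.- a ∷ []) | abs-++ (labels (above ch)) (ℤ.- a ∷ []) | ∣-i∣≡∣i∣ a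
  | abs-++ (preorder ch) (preorder f)
  = ↭-trans (++-comm (abs (labels (above f))) _)
      (↭-trans (++⁺ (++-comm (abs (labels (above ch))) (∣ a ∣ ∷ [])) (above-labels f))
        (prep ∣ a ∣ (++⁺ʳ (abs (preorder f)) (above-labels ch))))

arches-labels : ∀ f s → abs (labels (arches s)) ↭
  abs (map root s) ++ abs (preorder (kids (left (f , s)))) ++ abs (preorder (kids (map rightTree s)))
arches-labels f [] = ↭-refl
arches-labels f (x@(p , z , q) ∷ s)
  rewrite left-∷ f x s | kids-++ (left (f , s)) (leftTree x ∷ []) | ++-identityʳ p
  | preorder-++ (kids (left (f , s))) p | preorder-++ q (kids (map rightTree s))
  | abs-++ (preorder (kids (left (f , s)))) (preorder p) | abs-++ (preorder q) (preorder (kids (map rightTree s)))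
  | labels-++ (above p) (north z ∷ below q ++ arches s) | labels-++ (below q) (arches s)
  | abs-++ (labels (above p)) (z ∷ labels (below q) ++ labels (arches s)) | abs-++ (labels (below q)) (labels (arches s))
  | below-labels q
  = ↭-trans (++⁺ (above-labels p) (prep ∣ z ∣ (++⁺ˡ (abs (preorder q)) (arches-labels f s))))
      (prove 6 (P ⊕ (Z ⊕ (Q ⊕ (S ⊕ (L ⊕ R))))) (Z ⊕ (S ⊕ ((L ⊕ P) ⊕ (Q ⊕ R))))
        (abs (preorder p) ∷ᵥ (∣ z ∣ ∷ []) ∷ᵥ abs (preorder q) ∷ᵥ abs (map root s) ∷ᵥ
          abs (preorder (kids (left (f , s)))) ∷ᵥ abs (preorder (kids (map rightTree s))) ∷ᵥ []ᵥ))
  where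
  P = var (# 0)
  Z = var (# 1)
  Q = var (# 2)
  S = var (# 3)
  L = var (# 4)
  R = var (# 5)

-- A row of height 0 occurs once in the walk but is the root of two trees, and the root 0 is no row
-- of the walk. Hence the roots are counted separately from their descendants.
walk-labels : ∀ s → abs (labels (walk s)) ↭ abs (map root (proj₂ s) ++ preorder (kids (forest s)))
walk-labels (f , s)
  rewrite kids-++ (left (f , s)) (right (f , s)) | preorder-++ (kids (left (f , s))) (kids (right (f , s)))
  | preorder-++ f (kids (map rightTree s))
  | abs-++ (map root s) (preorder (kids (left (f , s))) ++ preorder f ++ preorder (kids (map rightTree s)))
  | abs-++ (preorder (kids (left (f , s)))) (preorder f ++ preorder (kids (map rightTree s)))
  | abs-++ (preorder f) (preorder (kids (map rightTree s)))
  | labels-++ (below f) (arches s) | abs-++ (labels (below f)) (labels (arches s)) | below-labels f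
  = ↭-trans (++⁺ˡ (abs (preorder f)) (arches-labels f s))
      (prove 4 (var (# 0) ⊕ (var (# 1) ⊕ (var (# 2) ⊕ var (# 3)))) (var (# 1) ⊕ (var (# 2) ⊕ (var (# 0) ⊕ var (# 3))))
        (abs (preorder f) ∷ᵥ abs (map root s) ∷ᵥ abs (preorder (kids (left (f , s)))) ∷ᵥ abs (preorder (kids (map rightTree s))) ∷ᵥ []ᵥ))

-- Heights of rows as depths in the forest

-- Started at height 0, the i-th N of π ends at height π_i - i.
rows : ℤ → List LStep → List (ℤ × ℤ)
rows h [] = []
rows h (north a ∷ L) = (ℤ.pred h , a) ∷ rows (ℤ.pred h) L
rows h (east ∷ L) = rows (ℤ.suc h) L

negDepth posDepth : ℕ × ℤ → ℤ × ℤ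
negDepth (d , a) = ℤ.- (+ d) , a
posDepth (d , a) = + d , ℤ.- a

pred-neg : ∀ d → ℤ.pred (ℤ.- (+ d)) ≡ -[1+ d ]
pred-neg zero = refl
pred-neg (suc d) = refl

suc-neg : ∀ d → ℤ.suc -[1+ d ] ≡ ℤ.- (+ d)
suc-neg zero = refl
suc-neg (suc d) = refl

rows-below : ∀ d f L → rows (ℤ.- (+ d)) (below f ++ L) ≡ map negDepth (depths (suc d) f) ++ rows (ℤ.- (+ d)) L
rows-below d [] L = refl
rows-below d (node a ch ∷ f) L
  rewrite ++-assoc (below ch) (east ∷ below f) L | pred-neg d
  | rows-below (suc d) ch (east ∷ below f ++ L) | suc-neg d | rows-below d f L
  = cong ((-[1+ d ] , a) ∷_) (trans (sym (++-assoc (map negDepth (depths (suc (suc d)) ch)) _ _))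
      (cong (_++ rows (ℤ.- (+ d)) L) (sym (map-++ negDepth (depths (suc (suc d)) ch) (depths (suc d) f)))))

reverse-insert : {A : Set} (xs ys zs : List A) (y : A) →
  reverse xs ++ reverse ys ++ y ∷ zs ≡ reverse (y ∷ ys ++ xs) ++ zs
reverse-insert xs ys zs y = begin
  reverse xs ++ reverse ys ++ y ∷ zs           ≡⟨ cong (reverse xs ++_) (sym (++-assoc (reverse ys) (y ∷ []) zs)) ⟩
  reverse xs ++ (reverse ys ++ y ∷ []) ++ zs   ≡⟨ cong (λ ws → reverse xs ++ ws ++ zs) (sym (unfold-reverse y ys)) ⟩
  reverse xs ++ reverse (y ∷ ys) ++ zs         ≡⟨ sym (++-assoc (reverse xs) _ zs) ⟩
  (reverse xs ++ reverse (y ∷ ys)) ++ zs       ≡⟨ cong (_++ zs) (sym (reverse-++ (y ∷ ys) xs)) ⟩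
  reverse (y ∷ ys ++ xs) ++ zs                 ∎
  where open ≡-Reasoning

-- An upward excursion ends with the N of its root, back at the height where it began; so depths
-- start at `d` here, against `suc d` in `rows-below`.
rows-above : ∀ d f L → rows (+ d) (above f ++ L) ≡ reverse (map posDepth (depths d f)) ++ rows (+ d) L
rows-above d [] L = refl
rows-above d (node a ch ∷ f) L
  rewrite above-assoc a ch f L | rows-above d f (east ∷ above ch ++ north (ℤ.- a) ∷ L)
  | rows-above (suc d) ch (north (ℤ.- a) ∷ L)
  | map-++ posDepth (depths (suc d) ch) (depths d f)
  = reverse-insert (map posDepth (depths d f)) (map posDepth (depths (suc d) ch)) (rows (+ d) L) (+ d , ℤ.- a)

module _ {A : Set} (φ : ℤ × ℤ → List A) where

  rows-arch : ∀ p z q L → concatMap φ (rows (+ 0) (east ∷ above p ++ north z ∷ below q ++ L)) ≡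
    concatMap φ (reverse (map posDepth (depths 1 p))) ++ concatMap φ (map negDepth (depths 0 (node z q ∷ []))) ++
    concatMap φ (rows (+ 0) L)
  rows-arch p z q L rewrite rows-above 1 p (north z ∷ below q ++ L) | rows-below 0 q L
    | ++-identityʳ (depths 1 q)
    | concatMap-++ φ (reverse (map posDepth (depths 1 p))) ((+ 0 , z) ∷ map negDepth (depths 1 q) ++ rows (+ 0) L)
    | concatMap-++ φ (map negDepth (depths 1 q)) (rows (+ 0) L)
    = cong (concatMap φ (reverse (map posDepth (depths 1 p))) ++_)
        (sym (++-assoc (φ (+ 0 , z)) (concatMap φ (map negDepth (depths 1 q))) _))

  reverse-pos : (∀ d a → φ (+ suc d , a) ≡ []) → ∀ d f → concatMap φ (reverse (map posDepth (depths (suc d) f))) ≡ []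
  reverse-pos kill d [] = refl
  reverse-pos kill d (node a ch ∷ f)
    rewrite unfold-reverse (+ suc d , ℤ.- a) (map posDepth (depths (suc (suc d)) ch ++ depths (suc d) f))
    | map-++ posDepth (depths (suc (suc d)) ch) (depths (suc d) f)
    | reverse-++ (map posDepth (depths (suc (suc d)) ch)) (map posDepth (depths (suc d) f))
    | concatMap-++ φ (reverse (map posDepth (depths (suc d) f)) ++ reverse (map posDepth (depths (suc (suc d)) ch))) ((+ suc d , ℤ.- a) ∷ [])
    | concatMap-++ φ (reverse (map posDepth (depths (suc d) f))) (reverse (map posDepth (depths (suc (suc d)) ch)))
    | reverse-pos kill d f | reverse-pos kill (suc d) ch | kill d (ℤ.- a) = refl

  arches-right : (∀ d a → φ (+ suc d , a) ≡ []) → ∀ s →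
    concatMap φ (rows (+ 0) (arches s)) ≡ concatMap φ (map negDepth (depths 0 (map rightTree s)))
  arches-right kill [] = refl
  arches-right kill ((p , z , q) ∷ s)
    rewrite rows-arch p z q (arches s) | reverse-pos kill 0 p | arches-right kill s
    | ++-identityʳ (depths 1 q)
    | map-++ negDepth (depths 1 q) (depths 0 (map rightTree s))
    | concatMap-++ φ (map negDepth (depths 1 q)) (map negDepth (depths 0 (map rightTree s)))
    = ++-assoc (φ (+ 0 , z)) _ _

  -- A reader blind to positive heights meets the other rows in walk order, which is the preorder of
  -- the right half, with the rows of height 0 as roots.
  rows-right : (∀ d a → φ (+ suc d , a) ≡ []) → ∀ s →
    concatMap φ ((+ 0 , + 0) ∷ rows (+ 0) (walk s)) ≡ concatMap (φ ∘ negDepth) (depths 0 (right s))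
  rows-right kill (f , s)
    rewrite sym (concatMap-map φ negDepth (depths 0 (right (f , s))))
    | rows-below 0 f (arches s)
    | map-++ negDepth (depths 1 f) (depths 0 (map rightTree s))
    | concatMap-++ φ (map negDepth (depths 1 f)) (rows (+ 0) (arches s))
    | concatMap-++ φ (map negDepth (depths 1 f)) (map negDepth (depths 0 (map rightTree s)))
    | arches-right kill s = refl

  neg-depths : (∀ d a → φ (-[1+ d ] , a) ≡ []) → ∀ d f → concatMap φ (reverse (map negDepth (depths (suc d) f))) ≡ []
  neg-depths kill d [] = refl
  neg-depths kill d (node a ch ∷ f)
    rewrite unfold-reverse (-[1+ d ] , a) (map negDepth (depths (suc (suc d)) ch ++ depths (suc d) f))
    | map-++ negDepth (depths (suc (suc d)) ch) (depths (suc d) f)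
    | reverse-++ (map negDepth (depths (suc (suc d)) ch)) (map negDepth (depths (suc d) f))
    | concatMap-++ φ (reverse (map negDepth (depths (suc d) f)) ++ reverse (map negDepth (depths (suc (suc d)) ch))) ((-[1+ d ] , a) ∷ [])
    | concatMap-++ φ (reverse (map negDepth (depths (suc d) f))) (reverse (map negDepth (depths (suc (suc d)) ch)))
    | neg-depths kill d f | neg-depths kill (suc d) ch | kill d a = refl

  arches-left : (∀ d a → φ (-[1+ d ] , a) ≡ []) → ∀ f s →
    concatMap φ (reverse (rows (+ 0) (arches s))) ≡ concatMap φ (map posDepth (depths 0 (left (f , s))))
  arches-left kill f [] = refl
  arches-left kill f (x@(p , z , q) ∷ s)
    rewrite rows-above 1 p (north z ∷ below q ++ arches s) | rows-below 0 q (arches s)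
    | left-∷ f x s | depths-++ 0 (left (f , s)) (leftTree x ∷ [])
    | ++-identityʳ (depths 1 p)
    | map-++ posDepth (depths 0 (left (f , s))) ((0 , ℤ.- z) ∷ depths 1 p)
    | neg-involutive z
    | concatMap-++ φ (map posDepth (depths 0 (left (f , s)))) ((+ 0 , z) ∷ map posDepth (depths 1 p))
    | sym (arches-left kill f s)
    | reverse-++ (reverse (map posDepth (depths 1 p))) ((+ 0 , z) ∷ map negDepth (depths 1 q) ++ rows (+ 0) (arches s))
    | reverse-involutive (map posDepth (depths 1 p))
    | unfold-reverse (+ 0 , z) (map negDepth (depths 1 q) ++ rows (+ 0) (arches s))
    | reverse-++ (map negDepth (depths 1 q)) (rows (+ 0) (arches s))
    | ++-assoc (reverse (rows (+ 0) (arches s)) ++ reverse (map negDepth (depths 1 q))) ((+ 0 , z) ∷ []) (map posDepth (depths 1 p))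
    | ++-assoc (reverse (rows (+ 0) (arches s))) (reverse (map negDepth (depths 1 q))) ((+ 0 , z) ∷ map posDepth (depths 1 p))
    | concatMap-++ φ (reverse (rows (+ 0) (arches s))) (reverse (map negDepth (depths 1 q)) ++ (+ 0 , z) ∷ map posDepth (depths 1 p))
    | concatMap-++ φ (reverse (map negDepth (depths 1 q))) ((+ 0 , z) ∷ map posDepth (depths 1 p))
    | neg-depths kill 0 q = refl

  -- Reading from the right undoes the backward drawing of the upper part. The rows of height 0 are
  -- seen again, now as roots of the left half.
  rows-left : (∀ d a → φ (-[1+ d ] , a) ≡ []) → ∀ s →
    concatMap φ (reverse (rows (+ 0) (walk s))) ≡ concatMap (φ ∘ posDepth) (depths 0 (left s))
  rows-left kill (f , s)
    rewrite sym (concatMap-map φ posDepth (depths 0 (left (f , s))))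
    | rows-below 0 f (arches s)
    | reverse-++ (map negDepth (depths 1 f)) (rows (+ 0) (arches s))
    | concatMap-++ φ (reverse (rows (+ 0) (arches s))) (reverse (map negDepth (depths 1 f)))
    | neg-depths kill 0 f
    | ++-identityʳ (concatMap φ (reverse (rows (+ 0) (arches s)))) = arches-left kill f s

-- Reading rows level by level

Row : Set
Row = ℤ × ℤ

rowMinus rowPlus : ℕ → Row → List Step
rowMinus j (x , _) = readMinus j x
rowPlus j (x , _) = readPlus j x

labelMinus labelPlus : ℕ → Row → List ℤ
labelMinus i (x , a) = if ⌊ x ℤ.≟ ℤ.- (+ i) ⌋ then a ∷ [] else []
labelPlus i (x , a) = if ⌊ x ℤ.≟ + suc i ⌋ then ℤ.- a ∷ [] else []

≟-pos : ∀ d j → ⌊ + d ℤ.≟ + j ⌋ ≡ (d ≡ᵇ j)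
≟-pos d j with + d ℤ.≟ + j
... | yes refl = sym (≡ᵇ-true d)
... | no ne = sym (≡ᵇ-false d j (λ eq → ne (cong (λ k → + k) eq)))

≟-neg : ∀ d j → ⌊ ℤ.- (+ d) ℤ.≟ ℤ.- (+ j) ⌋ ≡ (d ≡ᵇ j)
≟-neg d j with ℤ.- (+ d) ℤ.≟ ℤ.- (+ j)
... | yes eq with refl ← ℤₚ.+-injective (ℤₚ.neg-injective eq) = sym (≡ᵇ-true d)
... | no ne = sym (≡ᵇ-false d j (ne ∘ cong (λ k → ℤ.- (+ k))))

rowMinus-neg : ∀ j d a → rowMinus j (ℤ.- (+ d) , a) ≡ stepAt j (d , a)
rowMinus-neg j d a rewrite ≟-neg d j | ≟-neg d (suc j) = refl

rowPlus-pos : ∀ j d a → rowPlus j (+ d , a) ≡ stepAt j (d , a)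
rowPlus-pos j d a rewrite ≟-pos d j | ≟-pos d (suc j) = refl

labelMinus-neg : ∀ i d a → labelMinus i (ℤ.- (+ d) , a) ≡ labelAt i (d , a)
labelMinus-neg i d a rewrite ≟-neg d i = refl

labelPlus-pos : ∀ i d a → labelPlus i (+ d , ℤ.- a) ≡ labelAt (suc i) (d , a)
labelPlus-pos i d a rewrite ≟-pos d (suc i) | neg-involutive a = refl

rowMinus-pos : ∀ j d a → rowMinus j (+ suc d , a) ≡ []
rowMinus-pos zero d a = refl
rowMinus-pos (suc j) d a = refl

-- The index is `suc j` because a row of height 0 is a root on both sides and is read by `rowPlus 0`
-- as well as by `rowMinus 0`.
rowPlus-neg : ∀ j d a → rowPlus (suc j) (ℤ.- (+ d) , a) ≡ []
rowPlus-neg j zero a = refl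
rowPlus-neg j (suc d) a = refl

labelMinus-pos : ∀ i d a → labelMinus i (+ suc d , a) ≡ []
labelMinus-pos zero d a = refl
labelMinus-pos (suc i) d a = refl

labelPlus-neg : ∀ i d a → labelPlus i (ℤ.- (+ d) , a) ≡ []
labelPlus-neg i zero a = refl
labelPlus-neg i (suc d) a = refl

-- ζ_B read backwards, with the deleted last letter restored, and d_B, for a list of
-- rows; the extra row (0 , 0) accounts for the letter N in front of S→⁺ 0.
wordLevel : List Row → ℕ → List Step
wordLevel R j = concatMap (rowPlus j) (reverse R) ++ concatMap (rowMinus j) ((+ 0 , + 0) ∷ R)

labelLevel : List Row → ℕ → List ℤ
labelLevel R i = concatMap (labelMinus i) R ++ concatMap (labelPlus i) (reverse R)

module _ (s : Shape) where
  private
    R : List Row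
    R = rows (+ 0) (walk s)

  wordLevel-walk : ∀ j → wordLevel R j ≡ sprout (generation j (forest s))
  wordLevel-walk j = begin
    wordLevel R j
      ≡⟨ cong₂ _++_ (rows-left (rowPlus j) (λ d a → refl) s) (rows-right (rowMinus j) (rowMinus-pos j) s) ⟩
    concatMap (rowPlus j ∘ posDepth) (depths 0 (left s)) ++ concatMap (rowMinus j ∘ negDepth) (depths 0 (right s))
      ≡⟨ cong₂ _++_ (concatMap-cong (λ { (d , a) → rowPlus-pos j d (ℤ.- a) }) (depths 0 (left s)))
           (concatMap-cong (λ { (d , a) → rowMinus-neg j d a }) (depths 0 (right s))) ⟩
    concatMap (stepAt j) (depths 0 (left s)) ++ concatMap (stepAt j) (depths 0 (right s))
      ≡⟨ cong₂ _++_ (stepAt-0 (left s)) (stepAt-0 (right s)) ⟩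
    sprout (generation j (left s)) ++ sprout (generation j (right s))
      ≡⟨ sym (trans (cong sprout (generation-++ j (left s) (right s))) (sprout-++ (generation j (left s)) _)) ⟩
    sprout (generation j (forest s)) ∎
    where
    open ≡-Reasoning
    stepAt-0 : ∀ f → concatMap (stepAt j) (depths 0 f) ≡ sprout (generation j f)
    stepAt-0 f = trans (cong (λ i → concatMap (stepAt i) (depths 0 f)) (sym (+-identityʳ j))) (stepAt-depths j 0 f)

  private
    labelAt-0 : ∀ j f → concatMap (labelAt j) (depths 0 f) ≡ roots (generation j f)
    labelAt-0 j f = trans (cong (λ i → concatMap (labelAt i) (depths 0 f)) (sym (+-identityʳ j))) (labelAt-depths j 0 f)

    labels-right : ∀ i → concatMap (labelMinus i) ((+ 0 , + 0) ∷ R) ≡ roots (generation i (right s))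
    labels-right i = trans (rows-right (labelMinus i) (labelMinus-pos i) s)
      (trans (concatMap-cong (λ { (d , a) → labelMinus-neg i d a }) (depths 0 (right s))) (labelAt-0 i (right s)))

    labels-left : ∀ i → concatMap (labelPlus i) (reverse R) ≡ roots (generation (suc i) (left s))
    labels-left i = trans (rows-left (labelPlus i) (λ d a → refl) s)
      (trans (concatMap-cong (λ { (d , a) → labelPlus-pos i d a }) (depths 0 (left s))) (labelAt-0 (suc i) (left s)))

  -- The 0 in front is the root standing for row 0. The shift between the halves arises because d_B
  -- pairs height `-i` with height `i + 1`.
  labelLevel-walk : ∀ k → + 0 ∷ levels (labelLevel R) (suc k) ≡
    levels (λ j → roots (generation j (right s)) ++ roots (generation (suc j) (left s))) (suc k)
  labelLevel-walk k = cong₂ _++_ (cong₂ _++_ (labels-right 0) (labels-left 0))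
    (levels-cong k (λ j _ → cong₂ _++_ (labels-right (suc j)) (labels-left (suc j))))

  labelLevel-[] : ∀ j → generation j (forest s) ≡ [] → labelLevel R j ≡ []
  labelLevel-[] zero eq with ++-conicalʳ (left s) (right s) eq
  ... | ()
  labelLevel-[] (suc j) eq = cong₂ _++_ (trans (labels-right (suc j)) (cong roots r≡[]))
    (trans (labels-left (suc j)) (cong roots (next (suc j) (left s) l≡[])))
    where
    split : generation (suc j) (left s) ++ generation (suc j) (right s) ≡ []
    split = trans (sym (generation-++ (suc j) (left s) (right s))) eq
    l≡[] = ++-conicalˡ (generation (suc j) (left s)) _ split
    r≡[] = ++-conicalʳ (generation (suc j) (left s)) _ split
    next : ∀ i f → generation i f ≡ [] → generation (suc i) f ≡ []
    next zero .[] refl = refl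
    next (suc i) f eq = next i (kids f) eq

  -- Regrouping the generations into blocks of d_B leaves generation 0 of the left half over in
  -- front, which is why `roots (left s)` precedes the window.
  bfs-walk : ∀ k → generation (suc k) (forest s) ≡ [] →
    BFS (forest s) (levels (wordLevel R) (suc k)) (roots (left s) ++ + 0 ∷ levels (labelLevel R) (suc k))
  bfs-walk k empty = subst₂ (BFS (forest s)) (levels-cong (suc k) (λ j _ → sym (wordLevel-walk j))) labels≡
    (bfs-levels (suc k) (forest s) empty)
    where
    open ≡-Reasoning
    l r : ℕ → List ℤ
    l j = roots (generation j (left s))
    r j = roots (generation j (right s))
    l≡[] : l (suc k) ≡ []
    l≡[] = cong roots (++-conicalˡ (generation (suc k) (left s)) _
      (trans (sym (generation-++ (suc k) (left s) (right s))) empty))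
    labels≡ : levels (λ j → roots (generation j (forest s))) (suc k) ≡ roots (left s) ++ + 0 ∷ levels (labelLevel R) (suc k)
    labels≡ = begin
      levels (λ j → roots (generation j (forest s))) (suc k)
        ≡⟨ levels-cong (suc k) (λ j _ → trans (cong roots (generation-++ j (left s) (right s)))
             (map-++ label (generation j (left s)) _)) ⟩
      levels (λ j → l j ++ r j) (suc k)
        ≡⟨ sym (trans (cong (levels (λ j → l j ++ r j) (suc k) ++_) l≡[]) (++-identityʳ _)) ⟩
      levels (λ j → l j ++ r j) (suc k) ++ l (suc k)
        ≡⟨ levels-regroup l r (suc k) ⟩
      l 0 ++ levels (λ j → r j ++ l (suc j)) (suc k)
        ≡⟨ cong (l 0 ++_) (sym (labelLevel-walk k)) ⟩
      roots (left s) ++ + 0 ∷ levels (labelLevel R) (suc k) ∎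

-- Two equivalent positions of the last row

-- The two positions -d and d+1 of the last row are read at the same place, with opposite signs.
data Folds (d : ℕ) (b : ℤ) : Row → Set where
  stay : Folds d b (ℤ.- (+ d) , b)
  flip : Folds d b (+ suc d , ℤ.- b)

module _ (R : List Row) (d : ℕ) (b : ℤ) where

  labelLevel-snoc : ∀ r i → labelLevel (R ++ r ∷ []) i ≡
    concatMap (labelMinus i) R ++ (labelMinus i r ++ labelPlus i r) ++ concatMap (labelPlus i) (reverse R)
  labelLevel-snoc r i rewrite concatMap-++ (labelMinus i) R (r ∷ []) | reverse-++ R (r ∷ [])
    | ++-identityʳ (labelMinus i r) =
    trans (++-assoc (concatMap (labelMinus i) R) _ _)
      (cong (concatMap (labelMinus i) R ++_) (sym (++-assoc (labelMinus i r) (labelPlus i r) _)))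

  -- The last row comes last in the forward half of a block and first in the backward half, so
  -- nothing stands between the two places.
  labelLevel-fold : ∀ {r} → Folds d b r → ∀ i → labelLevel (R ++ r ∷ []) i ≡ labelLevel (R ++ (ℤ.- (+ d) , b) ∷ []) i
  labelLevel-fold stay i = refl
  labelLevel-fold flip i = trans (labelLevel-snoc (+ suc d , ℤ.- b) i)
    (trans (cong (λ ls → concatMap (labelMinus i) R ++ ls ++ concatMap (labelPlus i) (reverse R)) same)
      (sym (labelLevel-snoc (ℤ.- (+ d) , b) i)))
    where
    same : labelMinus i (+ suc d , ℤ.- b) ++ labelPlus i (+ suc d , ℤ.- b) ≡
           labelMinus i (ℤ.- (+ d) , b) ++ labelPlus i (ℤ.- (+ d) , b)
    same rewrite labelMinus-pos i d (ℤ.- b) | labelPlus-pos i (suc d) b | labelMinus-neg i d b | labelPlus-neg i d b =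
      sym (++-identityʳ _)

  private
    middle : ℕ → List Step
    middle j = concatMap (rowPlus j) (reverse R) ++ concatMap (rowMinus j) ((+ 0 , + 0) ∷ R)

  wordLevel-snoc : ∀ r j → wordLevel (R ++ r ∷ []) j ≡ rowPlus j r ++ middle j ++ rowMinus j r
  wordLevel-snoc r j = begin
    wordLevel (R ++ r ∷ []) j
      ≡⟨ cong₂ _++_ (cong (concatMap (rowPlus j)) (reverse-++ R (r ∷ [])))
           (trans (concatMap-++ (rowMinus j) R₀ (r ∷ [])) (cong (concatMap (rowMinus j) R₀ ++_) (++-identityʳ (rowMinus j r)))) ⟩
    (rowPlus j r ++ concatMap (rowPlus j) (reverse R)) ++ concatMap (rowMinus j) R₀ ++ rowMinus j r
      ≡⟨ ++-assoc (rowPlus j r) _ _ ⟩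
    rowPlus j r ++ concatMap (rowPlus j) (reverse R) ++ concatMap (rowMinus j) R₀ ++ rowMinus j r
      ≡⟨ cong (rowPlus j r ++_) (sym (++-assoc (concatMap (rowPlus j) (reverse R)) _ _)) ⟩
    rowPlus j r ++ middle j ++ rowMinus j r ∎
    where
    open ≡-Reasoning
    R₀ : List Row
    R₀ = (+ 0 , + 0) ∷ R

  -- The last row can be read at both ends of a level. After regrouping, the end of level `j` meets
  -- the start of level `j + 1`, which is where heights `-d` and `d + 1` write the same letters.
  levels-word-snoc : ∀ r k → rowPlus k r ≡ [] → levels (wordLevel (R ++ r ∷ [])) k ≡
    rowPlus 0 r ++ levels (λ j → middle j ++ rowMinus j r ++ rowPlus (suc j) r) k
  levels-word-snoc r k none = begin
    levels (wordLevel (R ++ r ∷ [])) k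
      ≡⟨ levels-cong k (λ j _ → wordLevel-snoc r j) ⟩
    levels (λ j → rowPlus j r ++ middle j ++ rowMinus j r) k
      ≡⟨ sym (trans (cong (levels (λ j → rowPlus j r ++ middle j ++ rowMinus j r) k ++_) none) (++-identityʳ _)) ⟩
    levels (λ j → rowPlus j r ++ middle j ++ rowMinus j r) k ++ rowPlus k r
      ≡⟨ levels-regroup (λ j → rowPlus j r) (λ j → middle j ++ rowMinus j r) k ⟩
    rowPlus 0 r ++ levels (λ j → (middle j ++ rowMinus j r) ++ rowPlus (suc j) r) k
      ≡⟨ cong (rowPlus 0 r ++_) (levels-cong k (λ j _ → ++-assoc (middle j) _ _)) ⟩
    rowPlus 0 r ++ levels (λ j → middle j ++ rowMinus j r ++ rowPlus (suc j) r) k ∎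
    where open ≡-Reasoning

  private
    far : ∀ k → d < k → stepAt (suc k) (suc d , b) ≡ []
    far k d<k rewrite ≡ᵇ-false d k (<⇒≢ d<k) | ≡ᵇ-false d (suc k) (<⇒≢ (m<n⇒m<1+n d<k)) = refl

    same : ∀ j → rowMinus j (+ suc d , ℤ.- b) ++ rowPlus (suc j) (+ suc d , ℤ.- b) ≡
                 rowMinus j (ℤ.- (+ d) , b) ++ rowPlus (suc j) (ℤ.- (+ d) , b)
    same j rewrite rowMinus-pos j d (ℤ.- b) | rowPlus-pos (suc j) (suc d) (ℤ.- b) | rowMinus-neg j d b | rowPlus-neg j d b =
      sym (++-identityʳ _)

    first : ∀ d {γ} → drop 1 (rowPlus 0 (+ suc d , ℤ.- b) ++ γ) ≡ drop 1 (rowPlus 0 (ℤ.- (+ d) , b) ++ γ)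
    -- Here heights 1 and 0 write E and N respectively; for larger `d` neither row writes anything.
    first zero = refl
    first (suc d) = refl

  -- Only the first letter, which ζ_B deletes, can tell the two positions apart.
  levels-word-fold : ∀ {r} k → d < k → Folds d b r →
    drop 1 (levels (wordLevel (R ++ r ∷ [])) (suc k)) ≡ drop 1 (levels (wordLevel (R ++ (ℤ.- (+ d) , b) ∷ [])) (suc k))
  levels-word-fold k d<k stay = refl
  levels-word-fold k d<k flip = begin
    drop 1 (levels (wordLevel (R ++ r ∷ [])) (suc k))
      ≡⟨ cong (drop 1) (levels-word-snoc r (suc k) (trans (rowPlus-pos (suc k) (suc d) b) (far k d<k))) ⟩
    drop 1 (rowPlus 0 r ++ levels (λ j → middle j ++ rowMinus j r ++ rowPlus (suc j) r) (suc k))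
      ≡⟨ cong (λ γ → drop 1 (rowPlus 0 r ++ γ)) (levels-cong (suc k) (λ j _ → cong (middle j ++_) (same j))) ⟩
    drop 1 (rowPlus 0 r ++ levels (λ j → middle j ++ rowMinus j r₀ ++ rowPlus (suc j) r₀) (suc k))
      ≡⟨ first d ⟩
    drop 1 (rowPlus 0 r₀ ++ levels (λ j → middle j ++ rowMinus j r₀ ++ rowPlus (suc j) r₀) (suc k))
      ≡⟨ cong (drop 1) (sym (levels-word-snoc r₀ (suc k) (rowPlus-neg k d b))) ⟩
    drop 1 (levels (wordLevel (R ++ r₀ ∷ [])) (suc k)) ∎
    where
    open ≡-Reasoning
    r r₀ : Row
    r = + suc d , ℤ.- b
    r₀ = ℤ.- (+ d) , b

-- ζ_B and d_B by levels

reverse-concatMap : {A B : Set} (φ : A → List B) → (∀ x → reverse (φ x) ≡ φ x) → ∀ xs →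
                    reverse (concatMap φ xs) ≡ concatMap φ (reverse xs)
reverse-concatMap φ eq [] = refl
reverse-concatMap φ eq (x ∷ xs) = begin
  reverse (φ x ++ concatMap φ xs)                ≡⟨ reverse-++ (φ x) _ ⟩
  reverse (concatMap φ xs) ++ reverse (φ x)      ≡⟨ cong₂ _++_ (reverse-concatMap φ eq xs) (trans (eq x) (sym (++-identityʳ (φ x)))) ⟩
  concatMap φ (reverse xs) ++ concatMap φ (x ∷ []) ≡⟨ sym (concatMap-++ φ (reverse xs) (x ∷ [])) ⟩
  concatMap φ (reverse xs ++ x ∷ [])             ≡⟨ cong (concatMap φ) (sym (unfold-reverse x xs)) ⟩
  concatMap φ (reverse (x ∷ xs))                 ∎
  where open ≡-Reasoning

reverse-concatMap-reverse : {A B : Set} (φ : A → List B) → ∀ xs →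
                            reverse (concatMap φ (reverse xs)) ≡ concatMap (reverse ∘ φ) xs
reverse-concatMap-reverse φ [] = refl
reverse-concatMap-reverse φ (x ∷ xs)
  rewrite unfold-reverse x xs | concatMap-++ φ (reverse xs) (x ∷ [])
  | reverse-++ (concatMap φ (reverse xs)) (φ x ++ []) | ++-identityʳ (φ x) =
  cong (reverse (φ x) ++_) (reverse-concatMap-reverse φ xs)

readPlus-reverse : ∀ j x → reverse (readPlus j x) ≡ readPlus j x
readPlus-reverse j x with ⌊ x ℤ.≟ + j ⌋ | ⌊ x ℤ.≟ + suc j ⌋
... | true | _ = refl
... | false | true = refl
... | false | false = refl

readMinus-reverse : ∀ j x → reverse (readMinus j x) ≡ readMinus j x
readMinus-reverse j x with ⌊ x ℤ.≟ ℤ.- (+ j) ⌋ | ⌊ x ℤ.≟ ℤ.- (+ suc j) ⌋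
... | true | _ = refl
... | false | true = refl
... | false | false = refl

labelPlus-reverse : ∀ i r → reverse (labelPlus i r) ≡ labelPlus i r
labelPlus-reverse i (x , a) with ⌊ x ℤ.≟ + suc i ⌋
... | true = refl
... | false = refl

dropLast-++ : ∀ xs y ys → dropLast (xs ++ y ∷ ys) ≡ xs ++ dropLast (y ∷ ys)
dropLast-++ [] y ys = refl
dropLast-++ (x ∷ []) y ys = refl
dropLast-++ (x ∷ x′ ∷ xs) y ys = cong (x ∷_) (dropLast-++ (x′ ∷ xs) y ys)

dropLast-reverse : ∀ xs → dropLast (reverse xs) ≡ reverse (drop 1 xs)
dropLast-reverse [] = refl
dropLast-reverse (x ∷ xs) = trans (cong dropLast (unfold-reverse x xs))
  (trans (dropLast-++ (reverse xs) x []) (++-identityʳ (reverse xs)))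

-- Deleting the last letter of the final factor deletes the last letter of the whole word, hence the
-- first one when it is read backwards. Each row writes at most one letter per level, so reversing a
-- factor just reverses the order of its rows.
zeta-levels : ∀ n π R → map proj₁ R ≡ muList n π →
              zetaB n π ≡ reverse (drop 1 (levels (wordLevel R) (suc (2 ℕ.* n))))
zeta-levels n π R eq rewrite sym eq = begin
  Z₁ ++ S←⁻ 0 μ ++ dropLast (N ∷ S→⁺ 0 μ)
    ≡⟨ cong (Z₁ ++_) (sym (dropLast-++ (S←⁻ 0 μ) N _)) ⟩
  Z₁ ++ dropLast (S←⁻ 0 μ ++ N ∷ S→⁺ 0 μ)
    ≡⟨ append Z₁ (S←⁻ 0 μ) ⟩
  dropLast (Z₁ ++ S←⁻ 0 μ ++ N ∷ S→⁺ 0 μ)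
    ≡⟨ cong dropLast (sym (trans (cong reverse (sym backwards)) (reverse-involutive _))) ⟩
  dropLast (reverse (levels (wordLevel R) (suc (2 ℕ.* n))))
    ≡⟨ dropLast-reverse (levels (wordLevel R) (suc (2 ℕ.* n))) ⟩
  reverse (drop 1 (levels (wordLevel R) (suc (2 ℕ.* n)))) ∎
  where
  open ≡-Reasoning
  μ : List ℤ
  μ = map proj₁ R
  φ : ℕ → List Step
  φ j = S←⁻ j μ ++ S→⁺ j μ
  Z₁ : List Step
  Z₁ = concatMap φ (reverse (map suc (upTo (2 ℕ.* n))))
  append : ∀ xs ys {y zs} → xs ++ dropLast (ys ++ y ∷ zs) ≡ dropLast (xs ++ ys ++ y ∷ zs)
  append xs [] {y} {zs} = sym (dropLast-++ xs y zs)
  append xs (x ∷ ys) {y} {zs} = sym (dropLast-++ xs x (ys ++ y ∷ zs))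
  plus : ∀ j → reverse (S→⁺ j μ) ≡ concatMap (rowPlus j) (reverse R)
  plus j = trans (reverse-concatMap (readPlus j) (readPlus-reverse j) μ)
    (trans (cong (concatMap (readPlus j)) (sym (reverse-map proj₁ R))) (concatMap-map (readPlus j) proj₁ (reverse R)))
  minus : ∀ j → reverse (S←⁻ j μ) ≡ concatMap (rowMinus j) R
  minus j = trans (reverse-concatMap-reverse (readMinus j) μ)
    (trans (concatMap-cong (readMinus-reverse j) μ) (concatMap-map (readMinus j) proj₁ R))
  backwards : reverse (Z₁ ++ S←⁻ 0 μ ++ N ∷ S→⁺ 0 μ) ≡ levels (wordLevel R) (suc (2 ℕ.* n))
  backwards = begin
    reverse (Z₁ ++ S←⁻ 0 μ ++ N ∷ S→⁺ 0 μ)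
      ≡⟨ reverse-++ Z₁ _ ⟩
    reverse (S←⁻ 0 μ ++ N ∷ S→⁺ 0 μ) ++ reverse Z₁
      ≡⟨ cong₂ _++_ first rest ⟩
    wordLevel R 0 ++ levels (wordLevel R ∘ suc) (2 ℕ.* n) ∎
    where
    first : reverse (S←⁻ 0 μ ++ N ∷ S→⁺ 0 μ) ≡ wordLevel R 0
    first rewrite reverse-++ (S←⁻ 0 μ) (N ∷ S→⁺ 0 μ) | unfold-reverse N (S→⁺ 0 μ) | plus 0 | minus 0 =
      ++-assoc (concatMap (rowPlus 0) (reverse R)) (N ∷ []) _
    level : ∀ j → reverse (φ (suc j)) ≡ wordLevel R (suc j)
    level j rewrite reverse-++ (S←⁻ (suc j) μ) (S→⁺ (suc j) μ) | plus (suc j) | minus (suc j) = refl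
    rest : reverse Z₁ ≡ levels (wordLevel R ∘ suc) (2 ℕ.* n)
    rest = begin
      reverse Z₁ ≡⟨ reverse-concatMap-reverse φ (map suc (upTo (2 ℕ.* n))) ⟩
      concatMap (reverse ∘ φ) (map suc (upTo (2 ℕ.* n))) ≡⟨ concatMap-map (reverse ∘ φ) suc (upTo (2 ℕ.* n)) ⟩
      concatMap (reverse ∘ φ ∘ suc) (upTo (2 ℕ.* n)) ≡⟨ cong concat (map-upTo (reverse ∘ φ ∘ suc) (2 ℕ.* n)) ⟩
      levels (reverse ∘ φ ∘ suc) (2 ℕ.* n) ≡⟨ levels-cong (2 ℕ.* n) (λ j _ → level j) ⟩
      levels (wordLevel R ∘ suc) (2 ℕ.* n) ∎

signAt : Bool → ℕ → ℕ → ℤ → ℤ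
signAt b n j x = if b ∧ (j ≡ᵇ n) then ℤ.- x else x

signAt-neg : ∀ b n j x → signAt b n j (ℤ.- x) ≡ ℤ.- signAt b n j x
signAt-neg b n j x with b ∧ (j ≡ᵇ n)
... | true = refl
... | false = refl

signAt-other : ∀ b n j x → j ≢ n → signAt b n j x ≡ x
signAt-other b n j x ne rewrite ≡ᵇ-false j n ne | ∧-zeroʳ b = refl

signAt-same : ∀ b n x → signAt b n n x ≡ (if b then ℤ.- x else x)
signAt-same b n x rewrite ≡ᵇ-true n | ∧-identityʳ b = refl

flipsLast : ℕ → List Step → Bool
flipsLast n π = evenᵇ ∣ nthℤ (muList n π) (n ∸ 2) ℤ.+ nthℤ (muList n π) (n ∸ 1) ∣

-- φ, ψ and fix are to be instantiated with the local functions of dB, which have no names.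
labels-levels : (n : ℕ) (v : List ℤ) (b : Bool) (fix : ℕ × ℤ → ℤ) (φ ψ : ℕ → ℕ × ℤ → List (ℕ × ℤ)) (rs : List (ℕ × ℤ)) (k : ℕ) →
  (∀ j x → fix (j , x) ≡ signAt b n j x) →
  (∀ i j m → φ i (j , m) ≡ (if ⌊ m ℤ.≟ ℤ.- (+ i) ⌋ then (j , ev v (+ j)) ∷ [] else [])) →
  (∀ i j m → ψ i (j , m) ≡ (if ⌊ m ℤ.≟ + suc i ⌋ then (j , ℤ.- ev v (+ j)) ∷ [] else [])) →
  map fix (concatMap (λ i → concatMap (φ i) rs ++ concatMap (ψ i) (reverse rs)) (upTo k)) ≡
  levels (labelLevel (map (λ { (j , m) → m , signAt b n j (ev v (+ j)) }) rs)) k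
labels-levels n v b fix φ ψ rs k fix≡ φ≡ ψ≡ = begin
  map fix (concatMap block (upTo k))       ≡⟨ map-concatMap fix block (upTo k) ⟩
  concatMap (map fix ∘ block) (upTo k)     ≡⟨ cong concat (map-upTo (map fix ∘ block) k) ⟩
  levels (map fix ∘ block) k               ≡⟨ levels-cong k (λ i _ → level i) ⟩
  levels (labelLevel (map tr rs)) k        ∎
  where
  open ≡-Reasoning
  block : ℕ → List (ℕ × ℤ)
  block i = concatMap (φ i) rs ++ concatMap (ψ i) (reverse rs)
  tr : ℕ × ℤ → Row
  tr (j , m) = m , signAt b n j (ev v (+ j))
  minus : ∀ i r → map fix (φ i r) ≡ labelMinus i (tr r)
  minus i (j , m) rewrite φ≡ i j m with ⌊ m ℤ.≟ ℤ.- (+ i) ⌋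
  ... | true = cong (_∷ []) (fix≡ j (ev v (+ j)))
  ... | false = refl
  plus : ∀ i r → map fix (ψ i r) ≡ labelPlus i (tr r)
  plus i (j , m) rewrite ψ≡ i j m with ⌊ m ℤ.≟ + suc i ⌋
  ... | true = cong (_∷ []) (trans (fix≡ j (ℤ.- ev v (+ j))) (signAt-neg b n j (ev v (+ j))))
  ... | false = refl
  level : ∀ i → map fix (block i) ≡ labelLevel (map tr rs) i
  level i = trans (map-++ fix (concatMap (φ i) rs) _) (cong₂ _++_
    (trans (map-concatMap fix (φ i) rs) (trans (concatMap-cong (minus i) rs) (sym (concatMap-map (labelMinus i) tr rs))))
    (trans (map-concatMap fix (ψ i) (reverse rs)) (trans (concatMap-cong (plus i) (reverse rs))
      (trans (sym (concatMap-map (labelPlus i) tr (reverse rs))) (cong (concatMap (labelPlus i)) (reverse-map tr rs))))))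

signedRows : ℕ → List Step → List ℤ → List Row
signedRows n π v = map (λ { (j , m) → m , signAt (flipsLast n π) n j (ev v (+ j)) }) (zip (map suc (upTo n)) (muList n π))

maxAbs : List ℤ → ℕ
maxAbs μ = foldr _⊔_ 0 (map ∣_∣ μ)

dB-levels : ∀ n π v → dB n π v ≡ levels (labelLevel (signedRows n π v)) (suc (maxAbs (muList n π)))
dB-levels n π v = labels-levels n v (flipsLast n π) _ _ _
  (zip (map suc (upTo n)) (muList n π)) (suc (maxAbs (muList n π))) (λ j x → refl) (λ i j m → refl) (λ i j m → refl)

applyUpTo-cong : {A : Set} {f g : ℕ → A} (k : ℕ) → (∀ i → i < k → f i ≡ g i) → applyUpTo f k ≡ applyUpTo g k
applyUpTo-cong zero eq = refl
applyUpTo-cong (suc k) eq = cong₂ _∷_ (eq 0 (s≤s z≤n)) (applyUpTo-cong k (λ i i<k → eq (suc i) (s≤s i<k)))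

zip-applyUpTo : (a : ℕ → ℕ) (f : ℕ → ℤ) (x : ℤ) (k : ℕ) →
  zip (applyUpTo a (suc k)) (map f (applyUpTo a k) ++ x ∷ []) ≡ map (λ j → j , f j) (applyUpTo a k) ++ (a k , x) ∷ []
zip-applyUpTo a f x zero = refl
zip-applyUpTo a f x (suc k) = cong ((a 0 , f (a 0)) ∷_) (zip-applyUpTo (a ∘ suc) f x k)

rowAt : List Step → List ℤ → ℕ → Row
rowAt π v i = + nthℕ (piSeq π) i ℤ.- + suc i , nthℤ v i

signedRows-snoc : ∀ n π v → signedRows (suc n) π v ≡
  applyUpTo (rowAt π v) n ++ (muN (suc n) π , (if flipsLast (suc n) π then ℤ.- nthℤ v n else nthℤ v n)) ∷ []
signedRows-snoc n π v = begin
  map tr (zip (map suc (upTo (suc n))) (map f (map suc (upTo n)) ++ x ∷ []))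
    ≡⟨ cong₂ (λ ys zs → map tr (zip ys (map f zs ++ x ∷ []))) (map-upTo suc (suc n)) (map-upTo suc n) ⟩
  map tr (zip (applyUpTo suc (suc n)) (map f (applyUpTo suc n) ++ x ∷ []))
    ≡⟨ cong (map tr) (zip-applyUpTo suc f x n) ⟩
  map tr (map (λ j → j , f j) (applyUpTo suc n) ++ (suc n , x) ∷ [])
    ≡⟨ map-++ tr (map (λ j → j , f j) (applyUpTo suc n)) _ ⟩
  map tr (map (λ j → j , f j) (applyUpTo suc n)) ++ tr (suc n , x) ∷ []
    ≡⟨ cong₂ (λ ys y → ys ++ (x , y) ∷ []) (trans (sym (map-∘ (applyUpTo suc n)))
         (trans (map-applyUpTo suc _ n)
           (applyUpTo-cong n (λ i i<n → cong (f (suc i) ,_) (signAt-other b (suc n) (suc i) _ (<⇒≢ (s≤s i<n)))))))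
         (signAt-same b (suc n) (nthℤ v n)) ⟩
  applyUpTo (rowAt π v) n ++ (x , (if b then ℤ.- nthℤ v n else nthℤ v n)) ∷ [] ∎
  where
  open ≡-Reasoning
  b : Bool
  b = flipsLast (suc n) π
  tr : ℕ × ℤ → Row
  tr (j , m) = m , signAt b (suc n) j (ev v (+ j))
  f : ℕ → ℤ
  f i = + piAt π i ℤ.- + i
  x : ℤ
  x = muN (suc n) π

zip-rows : ∀ n (xs : List ℕ) (ys : List ℤ) → length xs ≡ n → length ys ≡ n → ∀ (h : ℕ → ℤ) →
  map proj₁ (map (λ { (j , m) → m , h j }) (zip xs ys)) ≡ ys
zip-rows zero [] [] _ _ h = refl
zip-rows (suc n) (x ∷ xs) (y ∷ ys) p q h = cong (y ∷_) (zip-rows n xs ys (suc-injective p) (suc-injective q) h)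

length-muList : ∀ n π → length (muList (suc n) π) ≡ suc n
length-muList n π = trans (length-++ (map _ (map suc (upTo n)))) (trans (cong (_+ 1)
  (trans (length-map _ (map suc (upTo n))) (trans (length-map suc (upTo n)) (length-upTo n)))) (+-comm n 1))

signedRows-mu : ∀ n π v → map proj₁ (signedRows (suc n) π v) ≡ muList (suc n) π
signedRows-mu n π v = zip-rows (suc n) (map suc (upTo (suc n))) (muList (suc n) π)
  (trans (length-map suc (upTo (suc n))) (length-upTo (suc n))) (length-muList n π) _

labelLevel-large : ∀ R j → maxAbs (map proj₁ R) < j → labelLevel R j ≡ []
labelLevel-large R j M<j = cong₂ _++_ (minus R M<j)
  (trans (sym (reverse-concatMap (labelPlus j) (labelPlus-reverse j) R)) (cong reverse (plus R M<j)))
  where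
  minus : ∀ R → maxAbs (map proj₁ R) < j → concatMap (labelMinus j) R ≡ []
  minus [] _ = refl
  minus ((x , a) ∷ R) M<j with x ℤ.≟ ℤ.- (+ j)
  ... | yes refl = ⊥-elim (<⇒≱ M<j (≤-trans (≤-reflexive (sym (ℤₚ.∣-i∣≡∣i∣ (+ j)))) (m≤m⊔n _ _)))
  ... | no _ = minus R (≤-<-trans (m≤n⊔m ∣ x ∣ _) M<j)
  plus : ∀ R → maxAbs (map proj₁ R) < j → concatMap (labelPlus j) R ≡ []
  plus [] _ = refl
  plus ((x , a) ∷ R) M<j with x ℤ.≟ + suc j
  ... | yes refl = ⊥-elim (<⇒≱ M<j (≤-trans (n≤1+n j) (m≤m⊔n (suc j) (maxAbs (map proj₁ R)))))
  ... | no _ = plus R (≤-<-trans (m≤n⊔m ∣ x ∣ _) M<j)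

-- Rows of a path, altitudes and the sequence π_i

-- `c` and `k` count the E's and N's already passed, so their difference is the current height.
rows-index : ∀ c k L → rows (+ c ℤ.- + k) L ≡
  applyUpTo (λ i → + nthℕ (piSeqFrom c (steps L)) i ℤ.- + suc (k + i) , nthℤ (labels L) i) (length (labels L))
rows-index c k [] = refl
rows-index c k (north a ∷ L) = cong₂ _∷_ (cong (_, a) (trans lower (cong (λ i → + c ℤ.- + suc i) (sym (+-identityʳ k)))))
  (trans (cong (λ h → rows h L) lower) (trans (rows-index c (suc k) L)
    (applyUpTo-cong (length (labels L)) (λ i _ → cong (λ m → + nthℕ (piSeqFrom c (steps L)) i ℤ.- + suc m , nthℤ (labels L) i) (sym (+-suc k i))))))
  where
  lower : ℤ.pred (+ c ℤ.- + k) ≡ + c ℤ.- + suc k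
  lower = trans (cong ℤ.pred (ℤₚ.m-n≡m⊖n c k)) (trans (ℤₚ.distribʳ-⊖-+-neg 0 c k) (sym (ℤₚ.m-n≡m⊖n c (suc k))))
rows-index c k (east ∷ L) = trans (cong (λ h → rows h L) (sym (ℤₚ.+-assoc (+ 1) (+ c) (ℤ.- (+ k))))) (rows-index (suc c) k L)

rows-rowAt : ∀ L → rows (+ 0) L ≡ applyUpTo (rowAt (steps L) (labels L)) (length (labels L))
rows-rowAt L = rows-index 0 0 L

altitude : ℤ → List LStep → ℤ
altitude h [] = h
altitude h (north _ ∷ L) = altitude (ℤ.pred h) L
altitude h (east ∷ L) = altitude (ℤ.suc h) L

rows-++ : ∀ h K L → rows h (K ++ L) ≡ rows h K ++ rows (altitude h K) L
rows-++ h [] L = refl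
rows-++ h (north a ∷ K) L = cong ((ℤ.pred h , a) ∷_) (rows-++ (ℤ.pred h) K L)
rows-++ h (east ∷ K) L = rows-++ (ℤ.suc h) K L

altitude-++ : ∀ h K L → altitude h (K ++ L) ≡ altitude (altitude h K) L
altitude-++ h [] L = refl
altitude-++ h (north a ∷ K) L = altitude-++ (ℤ.pred h) K L
altitude-++ h (east ∷ K) L = altitude-++ (ℤ.suc h) K L

altitude-count : ∀ h L → altitude h L ℤ.+ + countN (steps L) ≡ h ℤ.+ + countE (steps L)
altitude-count h [] = refl
altitude-count h (north a ∷ L) = begin
  altitude (ℤ.pred h) L ℤ.+ (+ 1 ℤ.+ + countN (steps L))  ≡⟨ swap (altitude (ℤ.pred h) L) (+ countN (steps L)) ⟩
  + 1 ℤ.+ (altitude (ℤ.pred h) L ℤ.+ + countN (steps L))  ≡⟨ cong ℤ.suc (altitude-count (ℤ.pred h) L) ⟩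
  + 1 ℤ.+ (ℤ.pred h ℤ.+ + countE (steps L))               ≡⟨ cancel h (+ countE (steps L)) ⟩
  h ℤ.+ + countE (steps L)                                ∎
  where
  open ≡-Reasoning
  open +-*-Solver
  swap : ∀ x y → x ℤ.+ (+ 1 ℤ.+ y) ≡ + 1 ℤ.+ (x ℤ.+ y)
  swap = solve 2 (λ x y → x :+ (con (+ 1) :+ y) := con (+ 1) :+ (x :+ y)) refl
  cancel : ∀ h y → + 1 ℤ.+ (ℤ.pred h ℤ.+ y) ≡ h ℤ.+ y
  cancel = solve 2 (λ h y → con (+ 1) :+ ((con (ℤ.- (+ 1)) :+ h) :+ y) := h :+ y) refl
altitude-count h (east ∷ L) = trans (altitude-count (ℤ.suc h) L) (shift h (+ countE (steps L)))
  where
  open +-*-Solver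
  shift : ∀ h y → ℤ.suc h ℤ.+ y ≡ h ℤ.+ (+ 1 ℤ.+ y)
  shift = solve 2 (λ h y → (con (+ 1) :+ h) :+ y := h :+ (con (+ 1) :+ y)) refl

-- Parity and the move of the last North step

even-double : ∀ k → evenᵇ (k + k) ≡ true
even-double zero = refl
even-double (suc k) rewrite +-suc k k = even-double k

odd-double : ∀ k → evenᵇ (suc (k + k)) ≡ false
odd-double zero = refl
odd-double (suc k) rewrite +-suc k k = odd-double k

evenℤ-double : ∀ z → evenᵇ ∣ z ℤ.+ z ∣ ≡ true
evenℤ-double (+ k) = even-double k
evenℤ-double -[1+ k ] = even-double k

oddℤ-double : ∀ z → evenᵇ ∣ + 1 ℤ.+ (z ℤ.+ z) ∣ ≡ false
oddℤ-double (+ k) = odd-double k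
oddℤ-double -[1+ k ] = odd-double k

double-injective : ∀ k j → k + k ≡ j + j → k ≡ j
double-injective zero zero _ = refl
double-injective (suc k) (suc j) eq rewrite +-suc k k | +-suc j j =
  cong suc (double-injective k j (suc-injective (suc-injective eq)))

double≢odd : ∀ k j → k + k ≢ suc (j + j)
double≢odd k j eq with trans (sym (even-double k)) (trans (cong evenᵇ eq) (odd-double j))
... | ()

-- A path …N Eᵇ N Eᶜ has μ_n ∈ {x , 1 - x} for x = b - c. Moving the last N, i.e. replacing
-- (b , c) by (b′ , c′), makes the last row -c′ the nonpositive one of these two numbers; the
-- function acts on the last label. Parity is what makes (b , c) recoverable.
data Fold : ℕ → ℕ → ℕ → ℕ → (ℤ → ℤ) → Set where
  low  : ∀ k m → Fold k (k + m) (k + k) m id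
  high : ∀ k m → Fold (suc (m + k)) k (suc (k + k)) m (λ y → ℤ.- y)

fold-total : ∀ b c → ∃ λ b′ → ∃ λ c′ → ∃ λ f → Fold b c b′ c′ f
fold-total b c with b ℕ.≤? c
... | yes b≤c = b + b , c ∸ b , id , subst (λ e → Fold b e (b + b) (c ∸ b) id) (m+[n∸m]≡n b≤c) (low b (c ∸ b))
... | no b≰c = suc (c + c) , b ∸ suc c , _ , subst (λ e → Fold e c (suc (c + c)) (b ∸ suc c) (λ y → ℤ.- y))
  (trans (sym (+-suc (b ∸ suc c) c)) (m∸n+n≡m (≰⇒> b≰c))) (high c (b ∸ suc c))

halve : ∀ b → ∃ λ k → b ≡ k + k ⊎ b ≡ suc (k + k)
halve zero = 0 , inj₁ refl
halve (suc b) with halve b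
... | k , inj₁ refl = k , inj₂ refl
... | k , inj₂ refl = suc k , inj₁ (cong suc (sym (+-suc k k)))

fold-onto : ∀ b′ c′ → ∃ λ b → ∃ λ c → ∃ λ f → Fold b c b′ c′ f
fold-onto b′ c′ with halve b′
... | k , inj₁ refl = _ , _ , _ , low k c′
... | k , inj₂ refl = _ , _ , _ , high k c′

fold-sum : ∀ {b c b′ c′ f} → Fold b c b′ c′ f → b + c ≡ b′ + c′
fold-sum (low k m) = sym (+-assoc k k m)
fold-sum (high k m) = cong suc (trans (+-assoc m k k) (+-comm m (k + k)))

fold-injective : ∀ {b c b′ c′ d e d′ e′ f g} → Fold b c b′ c′ f → Fold d e d′ e′ g →
                 b′ ≡ d′ → c′ ≡ e′ → b ≡ d × c ≡ e × f ≡ g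
fold-injective (low k m) (low j .m) eq refl with refl ← double-injective k j eq = refl , refl , refl
fold-injective (low k m) (high j .m) eq refl = ⊥-elim (double≢odd k j eq)
fold-injective (high k m) (low j .m) eq refl = ⊥-elim (double≢odd j k (sym eq))
fold-injective (high k m) (high j .m) eq refl with refl ← double-injective k j (suc-injective eq) = refl , refl , refl

fold-label-injective : ∀ {b c b′ c′ f} → Fold b c b′ c′ f → ∀ {x y} → f x ≡ f y → x ≡ y
fold-label-injective (low k m) eq = eq
fold-label-injective (high k m) eq = ℤₚ.neg-injective eq

fold-label-abs : ∀ {b c b′ c′ f} → Fold b c b′ c′ f → ∀ y → ∣ f y ∣ ≡ ∣ y ∣
fold-label-abs (low k m) y = refl
fold-label-abs (high k m) y = ℤₚ.∣-i∣≡∣i∣ y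

fold-label-onto : ∀ {b c b′ c′ f} → Fold b c b′ c′ f → ∀ z → ∃ λ y → f y ≡ z
fold-label-onto (low k m) z = z , refl
fold-label-onto (high k m) z = ℤ.- z , neg-involutive z

ending : ℕ → ℤ → ℕ → List LStep
ending b y c = replicate b east ++ north y ∷ replicate c east

splitLast : ∀ L {k} → countN (steps L) ≡ suc k →
            ∃ λ P → ∃ λ y → ∃ λ c → L ≡ P ++ north y ∷ replicate c east × countN (steps P) ≡ k
splitLast (east ∷ L) eq with splitLast L eq
... | P , y , c , refl , eq′ = east ∷ P , y , c , refl , eq′
splitLast (north a ∷ L) {zero} eq = [] , a , length L , cong (north a ∷_) (all-east L (suc-injective eq)) , refl
  where
  all-east : ∀ L → countN (steps L) ≡ 0 → L ≡ replicate (length L) east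
  all-east [] _ = refl
  all-east (east ∷ L) eq = cong (east ∷_) (all-east L eq)
splitLast (north a ∷ L) {suc k} eq with splitLast L (suc-injective eq)
... | P , y , c , refl , eq′ = north a ∷ P , y , c , refl , cong suc eq′

-- Both μ_{n-1} and μ_n enter the definition of d_B, so the last two N's are exposed; this is where
-- n is at least 2.
splitEnding : ∀ L {k} → countN (steps L) ≡ suc (suc k) →
              ∃ λ P → ∃ λ x → ∃ λ b → ∃ λ y → ∃ λ c → L ≡ P ++ north x ∷ ending b y c
splitEnding L eq with splitLast L eq
... | Q , y , c , refl , eq′ with splitLast Q eq′
... | P , x , b , refl , _ = P , x , b , y , c , ++-assoc P _ _

no-north : ∀ c → countN (steps (replicate c east)) ≡ 0
no-north zero = refl
no-north (suc c) = no-north c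

replicate-injective : ∀ {A : Set} {x : A} b c → replicate b x ≡ replicate c x → b ≡ c
replicate-injective b c eq = trans (sym (length-replicate b)) (trans (cong length eq) (length-replicate c))

some-north : ∀ {c} P {y L} → replicate c east ≢ P ++ north y ∷ L
some-north {c} P {y} {L} eq with trans (sym (no-north c)) (trans (cong (countN ∘ steps) eq) (count P))
  where
  count : ∀ P → countN (steps (P ++ north y ∷ L)) ≡ suc (countN (steps P) + countN (steps L))
  count P = trans (cong countN (map-++ unlabel P _)) (trans (countN-++ (steps P) _) (+-suc _ _))
... | ()

last-injective : ∀ P Q {y z c d} → P ++ north y ∷ replicate c east ≡ Q ++ north z ∷ replicate d east →
                 P ≡ Q × y ≡ z × c ≡ d
last-injective [] [] {c = c} {d} eq with ∷-injective eq
... | refl , eq′ = refl , refl , replicate-injective c d eq′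
last-injective [] (_ ∷ Q) eq = ⊥-elim (some-north Q (∷-injectiveʳ eq))
last-injective (_ ∷ P) [] eq = ⊥-elim (some-north P (sym (∷-injectiveʳ eq)))
last-injective (_ ∷ P) (_ ∷ Q) eq with ∷-injective eq
... | refl , eq′ with last-injective P Q eq′
... | refl , eqs = refl , eqs

ending-injective : ∀ P Q {x x′ y z b c d e} → P ++ north x ∷ ending b y c ≡ Q ++ north x′ ∷ ending d z e →
                   P ++ north x ∷ [] ≡ Q ++ north x′ ∷ [] × b ≡ d × y ≡ z × c ≡ e
ending-injective P Q {b = b} {d = d} eq
  with last-injective (P ++ _ ∷ replicate b east) (Q ++ _ ∷ replicate d east) (trans (++-assoc P _ _) (trans eq (sym (++-assoc Q _ _))))
... | eq′ , refl , refl with last-injective P Q eq′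
... | refl , refl , refl = refl , refl , refl , refl

rows-east : ∀ h b L → rows h (replicate b east ++ L) ≡ rows (h ℤ.+ + b) L
rows-east h zero L = cong (λ i → rows i L) (sym (ℤₚ.+-identityʳ h))
rows-east h (suc b) L = trans (rows-east (ℤ.suc h) b L) (cong (λ i → rows i L) (shift h (+ b)))
  where
  open +-*-Solver
  shift : ∀ h b → ℤ.suc h ℤ.+ b ≡ h ℤ.+ (+ 1 ℤ.+ b)
  shift = solve 2 (λ h b → (con (+ 1) :+ h) :+ b := h :+ (con (+ 1) :+ b)) refl

no-rows : ∀ h c → rows h (replicate c east) ≡ []
no-rows h zero = refl
no-rows h (suc c) = no-rows (ℤ.suc h) c

count-ending : ∀ b y c → countN (steps (ending b y c)) ≡ 1 × countE (steps (ending b y c)) ≡ b + c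
count-ending zero y c = cong suc (no-north c) , count c
  where
  count : ∀ c → countE (steps (replicate c east)) ≡ c
  count zero = refl
  count (suc c) = cong suc (count c)
count-ending (suc b) y c with count-ending b y c
... | p , q = p , cong suc q

rows-ending : ∀ h b y c → h ≡ + 1 ℤ.- (+ b ℤ.+ + c) → rows h (ending b y c) ≡ (ℤ.- (+ c) , y) ∷ []
rows-ending h b y c refl = trans (rows-east h b _) (cong₂ _∷_ (cong (_, y) (final-height (+ b) (+ c))) (no-rows _ c))
  where
  open +-*-Solver
  final-height : ∀ b c → ℤ.pred ((+ 1 ℤ.- (b ℤ.+ c)) ℤ.+ b) ≡ ℤ.- c
  final-height = solve 2 (λ b c → con (ℤ.- (+ 1)) :+ ((con (+ 1) :- (b :+ c)) :+ b) := :- c) refl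

-- The path returns to 0 and the ending raises it by `b + c - 1`. If `P` ends with the N of row n -
-- 1, this height is μ_{n-1}.
altitude-prefix : ∀ P b y c → Balanced (P ++ ending b y c) → altitude (+ 0) P ≡ + 1 ℤ.- (+ b ℤ.+ + c)
altitude-prefix P b y c bal = begin
  h                                                  ≡⟨ isolate h (+ p) ⟩
  (h ℤ.+ + p) ℤ.- + p                                ≡⟨ cong (ℤ._- + p) (altitude-count (+ 0) P) ⟩
  + q ℤ.- + p                                        ≡⟨ shift (+ q) (+ p) (+ b ℤ.+ + c) ⟩
  (+ 1 ℤ.- (+ b ℤ.+ + c)) ℤ.+ (+ (q + (b + c)) ℤ.- + (p + 1))  ≡⟨ cong (λ i → (+ 1 ℤ.- (+ b ℤ.+ + c)) ℤ.+ i) zero-sum ⟩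
  (+ 1 ℤ.- (+ b ℤ.+ + c)) ℤ.+ + 0                    ≡⟨ ℤₚ.+-identityʳ _ ⟩
  + 1 ℤ.- (+ b ℤ.+ + c)                              ∎
  where
  open ≡-Reasoning
  open +-*-Solver
  h : ℤ
  h = altitude (+ 0) P
  p q : ℕ
  p = countN (steps P)
  q = countE (steps P)
  totals : p + 1 ≡ q + (b + c)
  totals = subst₂ (λ m n → p + m ≡ q + n) (proj₁ (count-ending b y c)) (proj₂ (count-ending b y c))
    (trans (sym (countN-++ (steps P) _)) (trans (subst (λ π → countN π ≡ countE π) (map-++ unlabel P _) bal) (countE-++ (steps P) _)))
  zero-sum : + (q + (b + c)) ℤ.- + (p + 1) ≡ + 0
  zero-sum = trans (cong (λ i → + i ℤ.- + (p + 1)) (sym totals)) (ℤₚ.+-inverseʳ (+ (p + 1)))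
  isolate : ∀ h p → h ≡ (h ℤ.+ p) ℤ.- p
  isolate = solve 2 (λ h p → h := (h :+ p) :- p) refl
  shift : ∀ q p s → q ℤ.- p ≡ (+ 1 ℤ.- s) ℤ.+ ((q ℤ.+ s) ℤ.- (p ℤ.+ + 1))
  shift = solve 3 (λ q p s → q :- p := (con (+ 1) :- s) :+ ((q :+ s) :- (p :+ con (+ 1)))) refl

nth-applyUpTo : (g : ℕ → ℤ) (k : ℕ) (xs : List ℤ) → nthℤ (applyUpTo g (suc k) ++ xs) k ≡ g k
nth-applyUpTo g zero xs = refl
nth-applyUpTo g (suc k) xs = nth-applyUpTo (g ∘ suc) k xs

nth-snoc : (g : ℕ → ℤ) (k : ℕ) (x : ℤ) → nthℤ (applyUpTo g k ++ x ∷ []) k ≡ x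
nth-snoc g zero x = refl
nth-snoc g (suc k) x = nth-snoc (g ∘ suc) k x

λ-even : ∀ n π b c → + piAt π n ≡ + n ℤ.- + c → + piAt π (n ∸ 1) ≡ + n ℤ.- (+ b ℤ.+ + c) →
  + (2 ℕ.* piAt π n) ℤ.- + piAt π (n ∸ 1) ≡ + 2 ℤ.* (+ n ℤ.- + c) ℤ.- (+ n ℤ.- (+ b ℤ.+ + c))
λ-even n π b c p≡ q≡ = cong₂ ℤ._-_ (trans (ℤₚ.pos-* 2 (piAt π n)) (cong (λ z → + 2 ℤ.* z) p≡)) q≡

λ-odd : ∀ n π b c → + piAt π n ≡ + n ℤ.- + c → + piAt π (n ∸ 1) ≡ + n ℤ.- (+ b ℤ.+ + c) →
  (+ suc (2 ℕ.* n) ℤ.- + (2 ℕ.* piAt π n)) ℤ.+ + piAt π (n ∸ 1) ≡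
  ((+ 1 ℤ.+ + 2 ℤ.* + n) ℤ.- + 2 ℤ.* (+ n ℤ.- + c)) ℤ.+ (+ n ℤ.- (+ b ℤ.+ + c))
λ-odd n π b c p≡ q≡ = cong₂ ℤ._+_ (cong₂ ℤ._-_ (cong ℤ.suc (ℤₚ.pos-* 2 n))
  (trans (ℤₚ.pos-* 2 (piAt π n)) (cong (λ z → + 2 ℤ.* z) p≡))) q≡

-- Put x = b - c. From π_n = n - c and π_{n-1} = n - b - c it follows that λ_n is n + x in the even
-- case and n + 1 - x in the odd one; each of λ_n - n and n + 1 - λ_n is then x or 1 - x.
muN-cases : ∀ n π b c → + piAt π n ≡ + n ℤ.- + c → + piAt π (n ∸ 1) ≡ + n ℤ.- (+ b ℤ.+ + c) →
            muN n π ≡ + b ℤ.- + c ⊎ muN n π ≡ + 1 ℤ.- (+ b ℤ.- + c)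
muN-cases n π b c p≡ q≡ with ((n % 4) ≡ᵇ 0) ∨ ((n % 4) ≡ᵇ 3) | evenᵇ (sum (take (n ∸ 2) (piSeq π)))
... | true | true = inj₁ (trans (cong (ℤ._- + n) (λ-even n π b c p≡ q≡)) (eq (+ n) (+ b) (+ c)))
  where
  open +-*-Solver
  eq : ∀ n b c → (+ 2 ℤ.* (n ℤ.- c) ℤ.- (n ℤ.- (b ℤ.+ c))) ℤ.- n ≡ b ℤ.- c
  eq = solve 3 (λ n b c → (con (+ 2) :* (n :- c) :- (n :- (b :+ c))) :- n := b :- c) refl
... | true | false = inj₂ (trans (cong (ℤ._- + n) (λ-odd n π b c p≡ q≡)) (eq (+ n) (+ b) (+ c)))
  where
  open +-*-Solver
  eq : ∀ n b c → (((+ 1 ℤ.+ + 2 ℤ.* n) ℤ.- + 2 ℤ.* (n ℤ.- c)) ℤ.+ (n ℤ.- (b ℤ.+ c))) ℤ.- n ≡ + 1 ℤ.- (b ℤ.- c)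
  eq = solve 3 (λ n b c → (((con (+ 1) :+ con (+ 2) :* n) :- con (+ 2) :* (n :- c)) :+ (n :- (b :+ c))) :- n := con (+ 1) :- (b :- c)) refl
... | false | true = inj₂ (trans (cong (λ z → + suc n ℤ.- z) (λ-even n π b c p≡ q≡)) (eq (+ n) (+ b) (+ c)))
  where
  open +-*-Solver
  eq : ∀ n b c → (+ 1 ℤ.+ n) ℤ.- (+ 2 ℤ.* (n ℤ.- c) ℤ.- (n ℤ.- (b ℤ.+ c))) ≡ + 1 ℤ.- (b ℤ.- c)
  eq = solve 3 (λ n b c → (con (+ 1) :+ n) :- (con (+ 2) :* (n :- c) :- (n :- (b :+ c))) := con (+ 1) :- (b :- c)) refl
... | false | false = inj₁ (trans (cong (λ z → + suc n ℤ.- z) (λ-odd n π b c p≡ q≡)) (eq (+ n) (+ b) (+ c)))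
  where
  open +-*-Solver
  eq : ∀ n b c → (+ 1 ℤ.+ n) ℤ.- (((+ 1 ℤ.+ + 2 ℤ.* n) ℤ.- + 2 ℤ.* (n ℤ.- c)) ℤ.+ (n ℤ.- (b ℤ.+ c))) ≡ b ℤ.- c
  eq = solve 3 (λ n b c → (con (+ 1) :+ n) :- (((con (+ 1) :+ con (+ 2) :* n) :- con (+ 2) :* (n :- c)) :+ (n :- (b :+ c))) := b :- c) refl

-- As μ_{n-1} = 1 - (b + c), the sum μ_{n-1} + μ_n is 1 - 2c if μ_n = x and 2 - 2b if μ_n = 1 - x,
-- where x = b - c. So the sign changes exactly when the position is 1 - x, and the pair of position
-- and label stays within one `Folds` class.
folds-last : ∀ {b c b′ c′ f} → Fold b c b′ c′ f → ∀ y μ →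
  μ ≡ + b ℤ.- + c ⊎ μ ≡ + 1 ℤ.- (+ b ℤ.- + c) →
  Folds c′ (f y) (μ , (if evenᵇ ∣ (+ 1 ℤ.- (+ b ℤ.+ + c)) ℤ.+ μ ∣ then ℤ.- y else y))
folds-last (low k m) y _ (inj₁ refl) =
  subst (Folds m y) (cong₂ _,_ (sym (position (+ k) (+ m))) (cong (λ t → if t then ℤ.- y else y)
    (sym (trans (cong (λ z → evenᵇ ∣ z ∣) (parity (+ k) (+ m))) (oddℤ-double (ℤ.- (+ k ℤ.+ + m))))))) stay
  where
  open +-*-Solver
  position : ∀ k m → k ℤ.- (k ℤ.+ m) ≡ ℤ.- m
  position = solve 2 (λ k m → k :- (k :+ m) := :- m) refl
  parity : ∀ k m → (+ 1 ℤ.- (k ℤ.+ (k ℤ.+ m))) ℤ.+ (k ℤ.- (k ℤ.+ m)) ≡ + 1 ℤ.+ (ℤ.- (k ℤ.+ m) ℤ.+ ℤ.- (k ℤ.+ m))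
  parity = solve 2 (λ k m → (con (+ 1) :- (k :+ (k :+ m))) :+ (k :- (k :+ m)) := con (+ 1) :+ ((:- (k :+ m)) :+ (:- (k :+ m)))) refl
folds-last (low k m) y _ (inj₂ refl) =
  subst (Folds m y) (cong₂ _,_ (sym (position (+ k) (+ m))) (cong (λ t → if t then ℤ.- y else y)
    (sym (trans (cong (λ z → evenᵇ ∣ z ∣) (parity (+ k) (+ m))) (evenℤ-double (+ 1 ℤ.- + k)))))) flip
  where
  open +-*-Solver
  position : ∀ k m → + 1 ℤ.- (k ℤ.- (k ℤ.+ m)) ≡ + 1 ℤ.+ m
  position = solve 2 (λ k m → con (+ 1) :- (k :- (k :+ m)) := con (+ 1) :+ m) refl
  parity : ∀ k m → (+ 1 ℤ.- (k ℤ.+ (k ℤ.+ m))) ℤ.+ (+ 1 ℤ.- (k ℤ.- (k ℤ.+ m))) ≡ (+ 1 ℤ.- k) ℤ.+ (+ 1 ℤ.- k)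
  parity = solve 2 (λ k m → (con (+ 1) :- (k :+ (k :+ m))) :+ (con (+ 1) :- (k :- (k :+ m))) := (con (+ 1) :- k) :+ (con (+ 1) :- k)) refl
folds-last (high k m) y _ (inj₁ refl) =
  subst (Folds m (ℤ.- y)) (cong₂ _,_ (sym (position (+ k) (+ m))) (trans (neg-involutive y) (cong (λ t → if t then ℤ.- y else y)
    (sym (trans (cong (λ z → evenᵇ ∣ z ∣) (parity (+ k) (+ m))) (oddℤ-double (ℤ.- (+ k)))))))) flip
  where
  open +-*-Solver
  position : ∀ k m → (+ 1 ℤ.+ (m ℤ.+ k)) ℤ.- k ≡ + 1 ℤ.+ m
  position = solve 2 (λ k m → (con (+ 1) :+ (m :+ k)) :- k := con (+ 1) :+ m) refl
  parity : ∀ k m → (+ 1 ℤ.- ((+ 1 ℤ.+ (m ℤ.+ k)) ℤ.+ k)) ℤ.+ ((+ 1 ℤ.+ (m ℤ.+ k)) ℤ.- k) ≡ + 1 ℤ.+ (ℤ.- k ℤ.+ ℤ.- k)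
  parity = solve 2 (λ k m → (con (+ 1) :- ((con (+ 1) :+ (m :+ k)) :+ k)) :+ ((con (+ 1) :+ (m :+ k)) :- k) := con (+ 1) :+ ((:- k) :+ (:- k))) refl
folds-last (high k m) y _ (inj₂ refl) =
  subst (Folds m (ℤ.- y)) (cong₂ _,_ (sym (position (+ k) (+ m))) (cong (λ t → if t then ℤ.- y else y)
    (sym (trans (cong (λ z → evenᵇ ∣ z ∣) (parity (+ k) (+ m))) (evenℤ-double (ℤ.- (m+k))))))) stay
  where
  open +-*-Solver
  m+k : ℤ
  m+k = + m ℤ.+ + k
  position : ∀ k m → + 1 ℤ.- ((+ 1 ℤ.+ (m ℤ.+ k)) ℤ.- k) ≡ ℤ.- m
  position = solve 2 (λ k m → con (+ 1) :- ((con (+ 1) :+ (m :+ k)) :- k) := :- m) refl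
  parity : ∀ k m → (+ 1 ℤ.- ((+ 1 ℤ.+ (m ℤ.+ k)) ℤ.+ k)) ℤ.+ (+ 1 ℤ.- ((+ 1 ℤ.+ (m ℤ.+ k)) ℤ.- k)) ≡ ℤ.- (m ℤ.+ k) ℤ.+ ℤ.- (m ℤ.+ k)
  parity = solve 2 (λ k m → (con (+ 1) :- ((con (+ 1) :+ (m :+ k)) :+ k)) :+ (con (+ 1) :- ((con (+ 1) :+ (m :+ k)) :- k)) := (:- (m :+ k)) :+ (:- (m :+ k))) refl

rising-replace : ∀ p P {x T U} → (Rising (just x) T → Rising (just x) U) →
                 Rising p (P ++ north x ∷ T) → Rising p (P ++ north x ∷ U)
rising-replace nothing [] t r = t r
rising-replace (just _) [] t (h , r) = h , t r
rising-replace p (east ∷ P) t r = rising-replace nothing P t r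
rising-replace nothing (north a ∷ P) t r = rising-replace (just a) P t r
rising-replace (just _) (north a ∷ P) t (h , r) = h , rising-replace (just a) P t r

rising-ending : ∀ b y c → Rising nothing (ending b y c)
rising-ending (suc b) y c = rising-ending b y c
rising-ending zero y zero = tt
rising-ending zero y (suc c) = rising-east c
  where
  rising-east : ∀ c → Rising nothing (replicate c east)
  rising-east zero = tt
  rising-east (suc c) = rising-east c

-- Either `b` and `b′` are both 0 and nothing moves, or both are positive: then the last N follows
-- an E before and after the move, and its label takes part in no rise.
rising-fold⁺ : ∀ {b c b′ c′ f} → Fold b c b′ c′ f → ∀ x y → Rising (just x) (ending b y c) → Rising (just x) (ending b′ (f y) c′)
rising-fold⁺ (low zero m) x y r = r
rising-fold⁺ (low (suc k) m) x y _ = rising-ending (k + suc k) y m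
rising-fold⁺ (high k m) x y _ = rising-ending (k + k) (ℤ.- y) m

rising-fold⁻ : ∀ {b c b′ c′ f} → Fold b c b′ c′ f → ∀ x y → Rising (just x) (ending b′ (f y) c′) → Rising (just x) (ending b y c)
rising-fold⁻ (low zero m) x y r = r
rising-fold⁻ (low (suc k) m) x y _ = rising-ending k y (suc k + m)
rising-fold⁻ (high k m) x y _ = rising-ending (m + k) y k

-- The path with its last North step moved

module Normalise {b c b′ c′ f} (F : Fold b c b′ c′ f) (n : ℕ) (P : List LStep) (x y : ℤ)
  (countN≡ : countN (steps (P ++ north x ∷ ending b y c)) ≡ suc (suc n))
  (countE≡ : countE (steps (P ++ north x ∷ ending b y c)) ≡ suc (suc n)) where

  original normal : List LStep
  original = P ++ north x ∷ ending b y c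
  normal = P ++ north x ∷ ending b′ (f y) c′

  private
    Q : List LStep
    Q = P ++ north x ∷ []
    π : List Step
    π = steps original
    v : List ℤ
    v = labels original
    N≡ : ℕ
    N≡ = suc (suc n)
    original≡ : original ≡ Q ++ ending b y c
    original≡ = sym (++-assoc P (north x ∷ []) _)
    normal≡ : normal ≡ Q ++ ending b′ (f y) c′
    normal≡ = sym (++-assoc P (north x ∷ []) _)
    altitude-Q : altitude (+ 0) Q ≡ + 1 ℤ.- (+ b ℤ.+ + c)
    altitude-Q = altitude-prefix Q b y c (subst Balanced original≡ (trans countN≡ (sym countE≡)))
    altitude-Q′ : altitude (+ 0) Q ≡ + 1 ℤ.- (+ b′ ℤ.+ + c′)
    altitude-Q′ = trans altitude-Q (cong (λ i → + 1 ℤ.- + i) (fold-sum F))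
    length-v : length v ≡ suc (suc n)
    length-v = trans (length-labels original) countN≡
    -- The rows are listed in two ways, by π_i - i and by heights along the path; comparing the last
    -- two entries yields π_n and π_{n-1} in terms of `b` and `c`.
    table : applyUpTo (rowAt π v) (suc n) ++ rowAt π v (suc n) ∷ [] ≡ rows (+ 0) Q ++ (ℤ.- (+ c) , y) ∷ []
    table = begin
      applyUpTo (rowAt π v) (suc n) ++ rowAt π v (suc n) ∷ []  ≡⟨ applyUpTo-∷ʳ (rowAt π v) (suc n) ⟩
      applyUpTo (rowAt π v) (suc (suc n))                      ≡⟨ cong (applyUpTo (rowAt π v)) (sym length-v) ⟩
      applyUpTo (rowAt π v) (length v)                         ≡⟨ sym (rows-rowAt original) ⟩
      rows (+ 0) original                                      ≡⟨ cong (rows (+ 0)) original≡ ⟩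
      rows (+ 0) (Q ++ ending b y c)                           ≡⟨ rows-++ (+ 0) Q _ ⟩
      rows (+ 0) Q ++ rows (altitude (+ 0) Q) (ending b y c)   ≡⟨ cong (rows (+ 0) Q ++_) (rows-ending _ b y c altitude-Q) ⟩
      rows (+ 0) Q ++ (ℤ.- (+ c) , y) ∷ []                     ∎
      where open ≡-Reasoning
    table-Q : applyUpTo (rowAt π v) (suc n) ≡ rows (+ 0) Q
    table-Q = ∷ʳ-injectiveˡ (applyUpTo (rowAt π v) (suc n)) (rows (+ 0) Q) table
    row-last : rowAt π v (suc n) ≡ (ℤ.- (+ c) , y)
    row-last = ∷ʳ-injectiveʳ (applyUpTo (rowAt π v) (suc n)) (rows (+ 0) Q) table
    row-previous : proj₁ (rowAt π v n) ≡ + 1 ℤ.- (+ b ℤ.+ + c)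
    row-previous = trans (cong proj₁ (∷ʳ-injectiveʳ (applyUpTo (rowAt π v) n) (rows (+ 0) P)
      (trans (applyUpTo-∷ʳ (rowAt π v) n) (trans table-Q (rows-++ (+ 0) P _)))))
      (trans (sym (altitude-++ (+ 0) P (north x ∷ []))) altitude-Q)
    p≡ : + piAt π N≡ ≡ + N≡ ℤ.- + c
    p≡ = trans (isolate (+ piAt π N≡) (+ N≡)) (cong (λ i → + N≡ ℤ.+ i) (cong proj₁ row-last))
      where
      open +-*-Solver
      isolate : ∀ p n → p ≡ n ℤ.+ (p ℤ.- n)
      isolate = solve 2 (λ p n → p := n :+ (p :- n)) refl
    q≡ : + piAt π (suc n) ≡ + N≡ ℤ.- (+ b ℤ.+ + c)
    q≡ = trans (isolate (+ piAt π (suc n)) (+ suc n)) (trans (cong (λ i → + suc n ℤ.+ i) row-previous) (shift (+ suc n) (+ b ℤ.+ + c)))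
      where
      open +-*-Solver
      isolate : ∀ p n → p ≡ n ℤ.+ (p ℤ.- n)
      isolate = solve 2 (λ p n → p := n :+ (p :- n)) refl
      shift : ∀ n s → n ℤ.+ (+ 1 ℤ.- s) ≡ (+ 1 ℤ.+ n) ℤ.- s
      shift = solve 2 (λ n s → n :+ (con (+ 1) :- s) := (con (+ 1) :+ n) :- s) refl
    muList≡ : muList N≡ π ≡ applyUpTo (proj₁ ∘ rowAt π v) (suc n) ++ muN N≡ π ∷ []
    muList≡ = cong (_++ muN N≡ π ∷ []) (trans (cong (map _) (map-upTo suc (suc n))) (map-applyUpTo suc _ (suc n)))
    flips≡ : flipsLast N≡ π ≡ evenᵇ ∣ (+ 1 ℤ.- (+ b ℤ.+ + c)) ℤ.+ muN N≡ π ∣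
    flips≡ = cong (λ z → evenᵇ ∣ z ∣) (cong₂ ℤ._+_
      (trans (cong (λ μ → nthℤ μ n) muList≡) (trans (nth-applyUpTo (proj₁ ∘ rowAt π v) n _) row-previous))
      (trans (cong (λ μ → nthℤ μ (suc n)) muList≡) (nth-snoc (proj₁ ∘ rowAt π v) (suc n) _)))

  rows-normal : rows (+ 0) normal ≡ rows (+ 0) Q ++ (ℤ.- (+ c′) , f y) ∷ []
  rows-normal = trans (cong (rows (+ 0)) normal≡) (trans (rows-++ (+ 0) Q _)
    (cong (rows (+ 0) Q ++_) (rows-ending _ b′ (f y) c′ altitude-Q′)))

  rows-original : ∃ λ r → signedRows N≡ π v ≡ rows (+ 0) Q ++ r ∷ [] × Folds c′ (f y) r
  rows-original = _ , trans (signedRows-snoc (suc n) π v) (cong (_++ (muN N≡ π , (if flipsLast N≡ π then ℤ.- nthℤ v (suc n) else nthℤ v (suc n))) ∷ []) table-Q) ,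
    subst (λ a → Folds c′ (f y) (muN N≡ π , a))
      (cong₂ (λ t a → if t then ℤ.- a else a) (sym flips≡) (sym (cong proj₂ row-last)))
      (folds-last F y (muN N≡ π) (muN-cases N≡ π b c p≡ q≡))

  private
    c′-small : c′ < 2 ℕ.* N≡
    c′-small = ≤-<-trans (≤-trans (m≤n+m c′ b′) (≤-trans (≤-reflexive (sym (fold-sum F)))
      (≤-trans (m≤n+m (b + c) (countE (steps Q))) (≤-reflexive (trans (sym count) countE≡)))))
      (m<m+n N≡ (s≤s z≤n))
      where
      count : countE π ≡ countE (steps Q) + (b + c)
      count = trans (cong (countE ∘ steps) original≡) (trans (cong countE (map-++ unlabel Q _))
        (trans (countE-++ (steps Q) _) (cong (λ m → countE (steps Q) + m) (proj₂ (count-ending b y c)))))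

  zeta-normal : zetaB N≡ π ≡ reverse (drop 1 (levels (wordLevel (rows (+ 0) normal)) (suc (2 ℕ.* N≡))))
  zeta-normal with rows-original
  ... | r , eq , folds = trans (zeta-levels N≡ π (signedRows N≡ π v) (signedRows-mu (suc n) π v))
    (cong reverse (trans (cong (λ R → drop 1 (levels (wordLevel R) (suc (2 ℕ.* N≡)))) eq)
      (trans (levels-word-fold (rows (+ 0) Q) c′ (f y) (2 ℕ.* N≡) c′-small folds)
        (cong (λ R → drop 1 (levels (wordLevel R) (suc (2 ℕ.* N≡)))) (sym rows-normal)))))

  -- d_B stops at the largest entry of |μ| for the original path, while `k` comes from the normal
  -- walk. Both have the same levels, and those beyond either bound are empty, so the two cutoffs
  -- agree.
  d-normal : ∀ k → (∀ j → k ≤ j → labelLevel (rows (+ 0) normal) j ≡ []) →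
             dB N≡ π v ≡ levels (labelLevel (rows (+ 0) normal)) k
  d-normal k empty with rows-original
  ... | r , eq , folds = trans (dB-levels N≡ π v) (trans (levels-cong (suc M) (λ j _ → same j))
      (levels-agree (suc M) k (λ j M<j → trans (sym (same j)) (labelLevel-large (signedRows N≡ π v) j
        (subst (λ μ → maxAbs μ < j) (sym (signedRows-mu (suc n) π v)) M<j))) empty))
    where
    M : ℕ
    M = maxAbs (muList N≡ π)
    same : ∀ j → labelLevel (signedRows N≡ π v) j ≡ labelLevel (rows (+ 0) normal) j
    same j = trans (cong (λ R → labelLevel R j) eq) (trans (labelLevel-fold (rows (+ 0) Q) c′ (f y) folds j)
      (cong (λ R → labelLevel R j) (sym rows-normal)))

  normal-balanced : Balanced normal
  normal-balanced = trans (trans (count countN countN-++ (proj₁ (count-ending b′ (f y) c′)) (proj₁ (count-ending b y c)) refl) countN≡)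
    (sym (trans (count countE countE-++ (proj₂ (count-ending b′ (f y) c′)) (proj₂ (count-ending b y c)) (sym (fold-sum F))) countE≡))
    where
    count : (♯ : List Step → ℕ) → (∀ xs ys → ♯ (xs ++ ys) ≡ ♯ xs + ♯ ys) → ∀ {k l} →
            ♯ (steps (ending b′ (f y) c′)) ≡ k → ♯ (steps (ending b y c)) ≡ l → k ≡ l → ♯ (steps normal) ≡ ♯ (steps original)
    count ♯ ♯-++ refl refl eq = begin
      ♯ (steps normal)                                     ≡⟨ cong (♯ ∘ steps) normal≡ ⟩
      ♯ (steps (Q ++ ending b′ (f y) c′))                  ≡⟨ cong ♯ (map-++ unlabel Q _) ⟩
      ♯ (steps Q ++ steps (ending b′ (f y) c′))            ≡⟨ ♯-++ (steps Q) _ ⟩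
      ♯ (steps Q) + ♯ (steps (ending b′ (f y) c′))         ≡⟨ cong (λ m → ♯ (steps Q) + m) eq ⟩
      ♯ (steps Q) + ♯ (steps (ending b y c))               ≡⟨ sym (♯-++ (steps Q) _) ⟩
      ♯ (steps Q ++ steps (ending b y c))                  ≡⟨ cong ♯ (sym (map-++ unlabel Q _)) ⟩
      ♯ (steps (Q ++ ending b y c))                        ≡⟨ cong (♯ ∘ steps) (sym original≡) ⟩
      ♯ (steps original)                                   ∎
      where open ≡-Reasoning

  normal-labels : abs (labels normal) ≡ abs (labels original)
  normal-labels = begin
    abs (labels normal)                                    ≡⟨ cong (abs ∘ labels) normal≡ ⟩
    abs (labels (Q ++ ending b′ (f y) c′))                 ≡⟨ cong abs (trans (labels-++ Q _) (cong (labels Q ++_) (label-ending b′ (f y) c′))) ⟩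
    abs (labels Q ++ f y ∷ [])                             ≡⟨ abs-++ (labels Q) _ ⟩
    abs (labels Q) ++ ∣ f y ∣ ∷ []                         ≡⟨ cong (λ a → abs (labels Q) ++ a ∷ []) (fold-label-abs F y) ⟩
    abs (labels Q) ++ ∣ y ∣ ∷ []                           ≡⟨ sym (abs-++ (labels Q) _) ⟩
    abs (labels Q ++ y ∷ [])                               ≡⟨ cong abs (sym (trans (labels-++ Q _) (cong (labels Q ++_) (label-ending b y c)))) ⟩
    abs (labels (Q ++ ending b y c))                       ≡⟨ cong (abs ∘ labels) (sym original≡) ⟩
    abs (labels original)                                  ∎
    where
    open ≡-Reasoning
    label-ending : ∀ b y c → labels (ending b y c) ≡ y ∷ []
    label-ending (suc b) y c = label-ending b y c
    label-ending zero y c = cong (y ∷_) (none c)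
      where
      none : ∀ c → labels (replicate c east) ≡ []
      none zero = refl
      none (suc c) = none c

  normal-rising⁺ : Rising (just (+ 0)) original → Rising (just (+ 0)) normal
  normal-rising⁺ = rising-replace (just (+ 0)) P (rising-fold⁺ F x y)

  normal-rising⁻ : Rising (just (+ 0)) normal → Rising (just (+ 0)) original
  normal-rising⁻ = rising-replace (just (+ 0)) P (rising-fold⁻ F x y)

-- Splitting, reversing and counting words

map-split : {A B : Set} (g : A → B) (xs : List A) (ys : List B) {zs : List B} → map g xs ≡ ys ++ zs →
            ∃ λ us → ∃ λ vs → xs ≡ us ++ vs × map g us ≡ ys × map g vs ≡ zs
map-split g xs [] eq = [] , xs , refl , refl , eq
map-split g (x ∷ xs) (y ∷ ys) eq with ∷-injective eq
... | refl , eq′ with map-split g xs ys eq′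
... | us , vs , refl , eq₁ , eq₂ = x ∷ us , vs , refl , cong (g x ∷_) eq₁ , eq₂

reverse-two : {A : Set} (u : List A) (a b : A) (w : List A) → reverse (u ++ a ∷ b ∷ w) ≡ reverse w ++ b ∷ a ∷ reverse u
reverse-two u a b w rewrite reverse-++ u (a ∷ b ∷ w) | unfold-reverse a (b ∷ w) | unfold-reverse b w
  | ++-assoc (reverse w ++ b ∷ []) (a ∷ []) (reverse u) = ++-assoc (reverse w) _ _

count-reverse : (♯ : List Step → ℕ) → (∀ xs ys → ♯ (xs ++ ys) ≡ ♯ xs + ♯ ys) → ∀ xs → ♯ (reverse xs) ≡ ♯ xs
count-reverse ♯ ♯-++ [] = refl
count-reverse ♯ ♯-++ (x ∷ xs) = begin
  ♯ (reverse (x ∷ xs))           ≡⟨ cong ♯ (unfold-reverse x xs) ⟩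
  ♯ (reverse xs ++ x ∷ [])       ≡⟨ ♯-++ (reverse xs) _ ⟩
  ♯ (reverse xs) + ♯ (x ∷ [])    ≡⟨ +-comm (♯ (reverse xs)) _ ⟩
  ♯ (x ∷ []) + ♯ (reverse xs)    ≡⟨ cong (λ m → ♯ (x ∷ []) + m) (count-reverse ♯ ♯-++ xs) ⟩
  ♯ (x ∷ []) + ♯ xs              ≡⟨ sym (♯-++ (x ∷ []) xs) ⟩
  ♯ (x ∷ xs)                     ∎
  where open ≡-Reasoning

countN-reverse : ∀ xs → countN (reverse xs) ≡ countN xs
countN-reverse = count-reverse countN countN-++

countE-reverse : ∀ xs → countE (reverse xs) ≡ countE xs
countE-reverse = count-reverse countE countE-++

length-count : ∀ xs → length xs ≡ countN xs + countE xs
length-count [] = refl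
length-count (N ∷ xs) = cong suc (length-count xs)
length-count (E ∷ xs) = trans (cong suc (length-count xs)) (sym (+-suc (countN xs) _))

-- Rises

AllRises : List LStep → Set
AllRises L = ∀ U x y W → L ≡ U ++ north x ∷ north y ∷ W → x ℤ.< y

all-rises⁺ : ∀ L → AllRises L → Rising nothing L
all-rises⁺ [] h = tt
all-rises⁺ (east ∷ L) h = all-rises⁺ L (λ U x y W eq → h (east ∷ U) x y W (cong (east ∷_) eq))
all-rises⁺ (north a ∷ []) h = tt
all-rises⁺ (north a ∷ east ∷ L) h = all-rises⁺ L (λ U x y W eq → h (north a ∷ east ∷ U) x y W (cong (λ K → north a ∷ east ∷ K) eq))
all-rises⁺ (north a ∷ L@(north b ∷ L′)) h = h [] a b L′ refl ,
  all-rises⁺ L (λ U x y W eq → h (north a ∷ U) x y W (cong (north a ∷_) eq))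

rising-weaken : ∀ p L → Rising p L → Rising nothing L
rising-weaken _ [] _ = tt
rising-weaken _ (east ∷ L) r = r
rising-weaken nothing (north _ ∷ L) r = r
rising-weaken (just _) (north _ ∷ L) (_ , r) = r

all-rises⁻ : ∀ L → Rising nothing L → AllRises L
all-rises⁻ _ r [] x y W refl = proj₁ r
all-rises⁻ _ r (east ∷ U) x y W refl = all-rises⁻ _ r U x y W refl
all-rises⁻ _ r (north a ∷ U) x y W refl = all-rises⁻ _ (rising-weaken (just a) (U ++ north x ∷ north y ∷ W) r) U x y W refl

nth-label : ∀ U x W → nthℤ (labels (U ++ north x ∷ W)) (countN (steps U)) ≡ x
nth-label [] x W = refl
nth-label (north _ ∷ U) x W = nth-label U x W
nth-label (east ∷ U) x W = nth-label U x W

nth-label-next : ∀ U x y W → nthℤ (labels (U ++ north x ∷ north y ∷ W)) (suc (countN (steps U))) ≡ y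
nth-label-next [] x y W = refl
nth-label-next (north _ ∷ U) x y W = nth-label-next U x y W
nth-label-next (east ∷ U) x y W = nth-label-next U x y W

VertCondition : List Step → List ℤ → Set
VertCondition π v = (∀ i → Rise π i → ev v (+ i) ℤ.< ev v (+ suc i)) × (∀ rest → π ≡ N ∷ rest → + 0 ℤ.< ev v (+ 1))

-- An N labelled 0 in front of the path turns the condition v(1) > 0 into a rise like any other.
vert⇒rising : ∀ L → VertCondition (steps L) (labels L) → Rising (just (+ 0)) L
vert⇒rising L (h , h₀) = all-rises⁺ (north (+ 0) ∷ L) every
  where
  every : AllRises (north (+ 0) ∷ L)
  every [] x y W refl = h₀ (steps W) refl
  every (_ ∷ U) x y W refl = subst₂ ℤ._<_ (nth-label U x (north y ∷ W)) (nth-label-next U x y W)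
    (h (suc (countN (steps U))) (rise (steps U) (steps W) (map-++ unlabel U _) refl))

rising⇒vert : ∀ L → Rising (just (+ 0)) L → VertCondition (steps L) (labels L)
rising⇒vert L r = rises , start L r
  where
  start : ∀ L → Rising (just (+ 0)) L → ∀ rest → steps L ≡ N ∷ rest → + 0 ℤ.< ev (labels L) (+ 1)
  start (north a ∷ L) (p , _) _ _ = p
  rises : ∀ i → Rise (steps L) i → ev (labels L) (+ i) ℤ.< ev (labels L) (+ suc i)
  rises _ (rise u w eq refl) with map-split unlabel L u eq
  ... | U , north x ∷ north y ∷ W , refl , refl , refl =
    subst₂ ℤ._<_ (sym (nth-label U x (north y ∷ W))) (sym (nth-label-next U x y W))
      (all-rises⁻ (north (+ 0) ∷ L) r (north (+ 0) ∷ U) x y W refl)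

-- Valleys

AllNE : (ℕ → ℤ) → List Step → Set
AllNE ρ γ = ∀ X Y → γ ≡ X ++ N ∷ E ∷ Y → ρ (countN Y) ℤ.< ρ (countE Y)

all-NE⁺ : ∀ ρ γ → AllNE ρ γ → NEIncreasing ρ γ
all-NE⁺ ρ [] h = tt
all-NE⁺ ρ (E ∷ γ) h = all-NE⁺ ρ γ (λ X Y eq → h (E ∷ X) Y (cong (E ∷_) eq))
all-NE⁺ ρ (N ∷ []) h = tt
all-NE⁺ ρ (N ∷ N ∷ γ) h = all-NE⁺ ρ (N ∷ γ) (λ X Y eq → h (N ∷ X) Y (cong (N ∷_) eq))
all-NE⁺ ρ (N ∷ E ∷ γ) h = h [] γ refl , all-NE⁺ ρ γ (λ X Y eq → h (N ∷ E ∷ X) Y (cong (λ δ → N ∷ E ∷ δ) eq))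

NE-tail : ∀ ρ x γ → NEIncreasing ρ (x ∷ γ) → NEIncreasing ρ γ
NE-tail ρ E γ h = h
NE-tail ρ N [] h = tt
NE-tail ρ N (N ∷ γ) h = h
NE-tail ρ N (E ∷ γ) (_ , h) = h

all-NE⁻ : ∀ ρ γ → NEIncreasing ρ γ → AllNE ρ γ
all-NE⁻ ρ _ h [] Y refl = proj₁ h
all-NE⁻ ρ _ h (x ∷ X) Y refl = all-NE⁻ ρ _ (NE-tail ρ x _ h) X Y refl

-- This is w(n - k): entry `k`, counted from 0 at the right end, of -w(n), ..., -w(1), 0, w(1), ...,
-- w(n). The unsimplified difference makes the condition at a valley (i , j) literally an inequality
-- between the ranks i - 1 and j - 1, which are numbers of preceding E's and N's.
rank : ℕ → List ℤ → ℕ → ℤ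
rank n w k = ev w (+ suc n ℤ.- + suc k)

DiagCondition : ℕ → List Step → List ℤ → Set
DiagCondition n β w = ∀ i j → Valley β i j → ev w (+ suc n ℤ.- + i) ℤ.> ev w (+ suc n ℤ.- + j)

-- The N in front of `reverse β` acts as a North step after the end of β, so that a final E also
-- becomes part of an adjacent pair.
valleys⁺ : ∀ n β w → NEIncreasing (rank n w) (N ∷ reverse β) → DiagCondition n β w
valleys⁺ n β w h _ _ (inner u z refl refl refl) = subst₂ ℤ._<_ (cong (rank n w) (countN-reverse u)) (cong (rank n w) (countE-reverse u))
  (all-NE⁻ (rank n w) _ h (N ∷ reverse z) (reverse u) (cong (N ∷_) (reverse-two u E N z)))
valleys⁺ n β w h _ _ (final u refl refl refl) = subst₂ ℤ._<_
  (cong (rank n w) (trans (countN-reverse u) (sym (trans (countN-++ u _) (+-identityʳ _)))))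
  (cong (λ k → ev w (+ suc n ℤ.- + k)) (trans (cong suc (countE-reverse u)) (sym (trans (countE-++ u _) (+-comm (countE u) 1)))))
  (all-NE⁻ (rank n w) _ h [] (reverse u) (cong (N ∷_) (reverse-++ u (E ∷ []))))

valleys⁻ : ∀ n β w → DiagCondition n β w → NEIncreasing (rank n w) (N ∷ reverse β)
valleys⁻ n β w h = all-NE⁺ (rank n w) _ every
  where
  every : AllNE (rank n w) (N ∷ reverse β)
  every [] Y eq = h (suc (countE Y)) (suc (countN Y)) (final (reverse Y) β≡
      (trans (cong countE β≡) (trans (countE-++ (reverse Y) _) (trans (+-comm _ 1) (cong suc (countE-reverse Y)))))
      (cong suc (trans (cong countN β≡) (trans (countN-++ (reverse Y) _) (trans (+-identityʳ _) (countN-reverse Y))))))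
    where
    β≡ : β ≡ reverse Y ++ E ∷ []
    β≡ = trans (sym (reverse-involutive β)) (trans (cong reverse (∷-injectiveʳ eq)) (unfold-reverse E Y))
  every (_ ∷ X) Y eq = h (suc (countE Y)) (suc (countN Y)) (inner (reverse Y) (reverse X)
    (trans (sym (reverse-involutive β)) (trans (cong reverse (∷-injectiveʳ eq)) (reverse-two X N E Y)))
    (cong suc (countE-reverse Y)) (cong suc (countN-reverse Y)))

-- Ballot words

take-length : {A : Set} (xs ys : List A) → take (length xs) (xs ++ ys) ≡ xs
take-length [] ys = refl
take-length (x ∷ xs) ys = cong (x ∷_) (take-length xs ys)

ballot-suffix : ∀ X Y → SuffixBallot (X ++ Y) → SuffixBallot Y
ballot-suffix [] Y s = s
ballot-suffix (x ∷ X) Y (_ , s) = ballot-suffix X Y s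

ballot-all : ∀ γ → (∀ X Y → γ ≡ X ++ Y → countE Y ≤ countN Y) → SuffixBallot γ
ballot-all [] h = tt
ballot-all (x ∷ γ) h = h [] (x ∷ γ) refl , ballot-all γ (λ X Y eq → h (x ∷ X) Y (cong (x ∷_) eq))

ballot⁺ : ∀ β → (∀ k → countE (take k β) ≤ countN (take k β)) → SuffixBallot (reverse β)
ballot⁺ β h = ballot-all (reverse β) λ X Y eq →
  subst₂ _≤_ (trans (cong countE (prefix X Y eq)) (countE-reverse Y)) (trans (cong countN (prefix X Y eq)) (countN-reverse Y))
    (h (length (reverse Y)))
  where
  prefix : ∀ X Y → reverse β ≡ X ++ Y → take (length (reverse Y)) β ≡ reverse Y
  prefix X Y eq = trans (cong (take (length (reverse Y))) (trans (sym (reverse-involutive β))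
    (trans (cong reverse eq) (reverse-++ X Y)))) (take-length (reverse Y) (reverse X))

ballot⁻ : ∀ β → SuffixBallot (reverse β) → ∀ k → countE (take k β) ≤ countN (take k β)
ballot⁻ β s k = subst₂ _≤_ (countE-reverse (take k β)) (countN-reverse (take k β))
  (ballot-head _ (ballot-suffix (reverse (drop k β)) (reverse (take k β))
    (subst SuffixBallot (trans (cong reverse (sym (take++drop≡id k β))) (reverse-++ (take k β) (drop k β))) s)))

-- Labels of the breadth-first traversal

negatives : List ℤ → List ℤ
negatives zs = reverse (map ℤ.-_ zs)

roots-left : ∀ s → roots (left s) ≡ negatives (map root (proj₂ s))
roots-left (f , s) = trans (reverse-map label (map leftTree s))
  (cong reverse (trans (sym (map-∘ s)) (map-∘ s)))

roots-right : ∀ s → roots (right s) ≡ + 0 ∷ map root (proj₂ s)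
roots-right (f , s) = cong (+ 0 ∷_) (sym (map-∘ s))

nth-middle : ∀ xs (x : ℤ) ys → nthℤ (xs ++ x ∷ ys) (length xs) ≡ x
nth-middle [] x ys = refl
nth-middle (_ ∷ xs) x ys = nth-middle xs x ys

module _ (n : ℕ) (w : List ℤ) (length-w : length w ≡ n) where
  private
    indexes-suffix : ∀ w₁ w₂ → w ≡ w₁ ++ w₂ → Indexes (rank n w) w₂
    indexes-suffix w₁ [] eq = tt
    indexes-suffix w₁ (x ∷ w₂) eq = trans (cong (ev w) position) (trans (cong (λ u → nthℤ u (length w₁)) eq) (nth-middle w₁ x w₂)) ,
      indexes-suffix (w₁ ++ x ∷ []) w₂ (trans eq (sym (++-assoc w₁ _ _)))
      where
      open +-*-Solver
      cancel : ∀ a l → (+ 1 ℤ.+ (a ℤ.+ (+ 1 ℤ.+ l))) ℤ.- (+ 1 ℤ.+ l) ≡ + 1 ℤ.+ a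
      cancel = solve 2 (λ a l → (con (+ 1) :+ (a :+ (con (+ 1) :+ l))) :- (con (+ 1) :+ l) := con (+ 1) :+ a) refl
      position : + suc n ℤ.- + suc (length w₂) ≡ + suc (length w₁)
      position = trans (cong (λ m → + suc m ℤ.- + suc (length w₂)) (trans (sym length-w) (trans (cong length eq) (length-++ w₁))))
        (cancel (+ length w₁) (+ length w₂))

    indexes-negatives : ∀ zs w₁ w₂ ls → w ≡ w₁ ++ zs ++ w₂ → length ls ≡ n + suc (length w₁) →
      Indexes (rank n w) ls → Indexes (rank n w) (negatives zs ++ ls)
    indexes-negatives [] w₁ w₂ ls eq len i = i
    indexes-negatives (z ∷ zs) w₁ w₂ ls eq len i =
      subst (Indexes (rank n w)) (sym (trans (cong (_++ ls) (unfold-reverse (ℤ.- z) (map ℤ.-_ zs))) (++-assoc (negatives zs) _ ls)))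
        (indexes-negatives zs (w₁ ++ z ∷ []) w₂ (ℤ.- z ∷ ls) (trans eq (sym (++-assoc w₁ _ _)))
          (trans (cong suc len) (trans (sym (+-suc n _)) (cong (λ k → n + suc k) (sym (trans (length-++ w₁) (+-comm _ 1))))))
          (trans (cong (ev w) position) (cong ℤ.-_ (trans (cong (λ u → nthℤ u (length w₁)) eq) (nth-middle w₁ z (zs ++ w₂)))) , i))
      where
      open +-*-Solver
      cancel : ∀ n l → (+ 1 ℤ.+ n) ℤ.- (+ 1 ℤ.+ (n ℤ.+ (+ 1 ℤ.+ l))) ≡ ℤ.- (+ 1 ℤ.+ l)
      cancel = solve 2 (λ n l → (con (+ 1) :+ n) :- (con (+ 1) :+ (n :+ (con (+ 1) :+ l))) := :- (con (+ 1) :+ l)) refl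
      position : + suc n ℤ.- + suc (length ls) ≡ -[1+ length w₁ ]
      position = trans (cong (λ m → + suc n ℤ.- + suc m) len) (cancel (+ n) (+ length w₁))

  indexes-labels : ∀ zs rest → w ≡ zs ++ rest → Indexes (rank n w) (negatives zs ++ + 0 ∷ w)
  indexes-labels zs rest eq = indexes-negatives zs [] rest (+ 0 ∷ w) eq (trans (cong suc length-w) (+-comm 1 n))
    (trans (cong (λ m → ev w (+ suc n ℤ.- + suc m)) length-w) (cong (ev w) (ℤₚ.+-inverseʳ (+ suc n))) , indexes-suffix [] w refl)

-- The window and the size of a shape

drop-++ : {A : Set} (xs : List A) {ys zs : List A} → xs ++ ys ↭ xs ++ zs → ys ↭ zs
drop-++ [] p = p
drop-++ (x ∷ xs) p = drop-++ xs (drop-∷ p)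

signedPerm-↭ : ∀ {n v w} → abs v ↭ abs w → IsSignedPerm n v → IsSignedPerm n w
signedPerm-↭ {v = v} {w} p (len , q) =
  trans (sym (trans (sym (length-map ∣_∣ v)) (trans (↭-length p) (length-map ∣_∣ w)))) len , ↭-trans (↭-sym p) q

module _ {s : Shape} {γ : List Step} {w : List ℤ} (B : BFS (forest s) γ (roots (left s) ++ + 0 ∷ w)) where
  private
    zs : List ℤ
    zs = map root (proj₂ s)

    roots-forest : roots (forest s) ≡ roots (left s) ++ + 0 ∷ zs
    roots-forest = trans (map-++ label (left s) (right s)) (cong (roots (left s) ++_) (roots-right s))

  -- The initial queue is visited first, so the roots to the right of 0 come directly after it.
  bfs-window : ∃ λ rest → w ≡ zs ++ rest
  bfs-window with bfs-roots B
  ... | rest , eq = rest , ∷-injectiveʳ (++-cancelˡ (roots (left s)) _ _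
    (trans eq (trans (cong (_++ rest) roots-forest) (++-assoc (roots (left s)) _ rest))))

  -- Cancelling all roots from the labels of the forest leaves the descendants; adding back the
  -- roots on the right side counts every row of the walk once.
  bfs-labels : abs w ↭ abs (labels (walk s))
  bfs-labels with bfs-window
  ... | rest , refl = ↭-trans (map⁺ ∣_∣ (++⁺ˡ zs (drop-++ (roots (forest s))
      (↭-trans (↭-reflexive regroup) (↭-trans (bfs-preorder B) (preorder-kids (forest s))))))) (↭-sym (walk-labels s))
    where
    regroup : roots (forest s) ++ rest ≡ roots (left s) ++ + 0 ∷ zs ++ rest
    regroup = trans (cong (_++ rest) roots-forest) (++-assoc (roots (left s)) _ rest)

  bfs-shape-increasing⁺ : ∀ {n} → length w ≡ n → Increasing (forest s) → NEIncreasing (rank n w) γ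
  bfs-shape-increasing⁺ {n} len with bfs-window
  ... | rest , eq = bfs-increasing⁺ (rank n w) B (subst (λ ls → Indexes (rank n w) (ls ++ + 0 ∷ w)) (sym (roots-left s))
    (indexes-labels n w len zs rest eq))

  bfs-shape-increasing⁻ : ∀ {n} → length w ≡ n → NEIncreasing (rank n w) γ → Increasing (forest s)
  bfs-shape-increasing⁻ {n} len with bfs-window
  ... | rest , eq = bfs-increasing⁻ (rank n w) B (subst (λ ls → Indexes (rank n w) (ls ++ + 0 ∷ w)) (sym (roots-left s))
    (indexes-labels n w len zs rest eq))

  bfs-shape-countN : countN γ ≡ length (proj₂ s) + suc (length w)
  bfs-shape-countN = trans (bfs-countN B) (trans (length-++ (roots (left s))) (cong (_+ suc (length w)) length-left))
    where
    length-left : length (roots (left s)) ≡ length (proj₂ s)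
    length-left = trans (length-map label (left s)) (trans (length-reverse (map leftTree (proj₂ s))) (length-map leftTree (proj₂ s)))

length-forest : ∀ s → length (forest s) ≡ length (proj₂ s) + suc (length (proj₂ s))
length-forest (f , s) = trans (length-++ (left (f , s))) (cong₂ (λ a b → a + suc b)
  (trans (length-reverse (map leftTree s)) (length-map leftTree s)) (length-map rightTree s))

-- With m arches there are 2m + 1 trees and m + 1 + `length w` nodes, hence as many N's in `N ∷ δ`,
-- and `length w` - m E's.
bfs-shape-length : ∀ {s δ w} → BFS (forest s) (N ∷ δ) (roots (left s) ++ + 0 ∷ w) → length δ ≡ 2 ℕ.* length w
bfs-shape-length {s} {δ} {w} B = +-cancelˡ-≡ m _ _ (begin
  m + length δ                    ≡⟨ cong (λ l → m + l) (length-count δ) ⟩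
  m + (countN δ + countE δ)       ≡⟨ cong (λ a → m + (a + countE δ)) N≡ ⟩
  m + ((m + length w) + countE δ) ≡⟨ rearrange m (length w) (countE δ) ⟩
  ((m + m) + countE δ) + length w ≡⟨ cong (_+ length w) (sym (trans (sym N≡) balance)) ⟩
  (m + length w) + length w       ≡⟨ double m (length w) ⟩
  m + 2 ℕ.* length w              ∎)
  where
  open ≡-Reasoning
  m : ℕ
  m = length (proj₂ s)
  N≡ : countN δ ≡ m + length w
  N≡ = suc-injective (trans (bfs-shape-countN B) (+-suc m _))
  balance : countN δ ≡ (m + m) + countE δ
  balance = suc-injective (trans (bfs-balance B) (trans (cong (_+ countE δ) (length-forest s)) (cong (_+ countE δ) (+-suc m m))))
  open ℕ-Solver
  rearrange : ∀ m l e → m + ((m + l) + e) ≡ ((m + m) + e) + l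
  rearrange = solve 3 (λ m l e → m :+ ((m :+ l) :+ e) := ((m :+ m) :+ e) :+ l) refl
  double : ∀ m l → (m + l) + l ≡ m + 2 ℕ.* l
  double = solve 2 (λ m l → (m :+ l) :+ l := m :+ con 2 :* l) refl

walk-size : ∀ s → length (preorder (forest s)) ≡ suc (length (proj₂ s)) + length (labels (walk s))
walk-size s = begin
  length (preorder (forest s))                              ≡⟨ ↭-length (preorder-kids (forest s)) ⟩
  length (roots (forest s) ++ preorder (kids (forest s)))   ≡⟨ length-++ (roots (forest s)) ⟩
  length (roots (forest s)) + k                             ≡⟨ cong (_+ k) (trans (length-map label (forest s)) (length-forest s)) ⟩
  (m + suc m) + k                                           ≡⟨ trans (cong (_+ k) (+-comm m (suc m))) (+-assoc (suc m) m k) ⟩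
  suc m + (m + k)                                           ≡⟨ cong (λ j → suc m + j) (sym total) ⟩
  suc m + length (labels (walk s))                          ∎
  where
  open ≡-Reasoning
  m k : ℕ
  m = length (proj₂ s)
  k = length (preorder (kids (forest s)))
  total : length (labels (walk s)) ≡ m + k
  total = trans (sym (length-map ∣_∣ (labels (walk s)))) (trans (↭-length (walk-labels s))
    (trans (length-map ∣_∣ (map root (proj₂ s) ++ preorder (kids (forest s)))) (trans (length-++ (map root (proj₂ s)))
      (cong (_+ k) (length-map root (proj₂ s))))))

walk-arches : ∀ s → length (proj₂ s) ≤ length (labels (walk s))
walk-arches (f , s) = ≤-trans (arches-north s) (≤-trans (m≤n+m _ (length (labels (below f))))
  (≤-reflexive (sym (trans (cong length (labels-++ (below f) (arches s))) (length-++ (labels (below f)))))))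
  where
  skip : ∀ K L → length (labels L) ≤ length (labels (K ++ L))
  skip K L = ≤-trans (m≤n+m _ (length (labels K))) (≤-reflexive (sym (trans (cong length (labels-++ K L)) (length-++ (labels K)))))
  arches-north : ∀ s → length s ≤ length (labels (arches s))
  arches-north [] = z≤n
  arches-north ((p , z , q) ∷ s) = ≤-trans (s≤s (≤-trans (arches-north s) (skip (below q) (arches s)))) (skip (above p) _)

bfs-functional : ∀ {f γ δ ls ms} → BFS f γ ls → BFS f δ ms → γ ≡ δ × ls ≡ ms
bfs-functional done done = refl , refl
bfs-functional (visit b) (visit c) with bfs-functional b c
... | refl , refl = refl , refl

-- The correspondence between (π , v) and (β , w)

fold-count : (♯ : List Step → ℕ) → (∀ xs ys → ♯ (xs ++ ys) ≡ ♯ xs + ♯ ys) → ∀ P x K L →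
             ♯ (steps K) ≡ ♯ (steps L) → ♯ (steps (P ++ north x ∷ K)) ≡ ♯ (steps (P ++ north x ∷ L))
fold-count ♯ ♯-++ P x K L eq = trans (expand K) (trans (cong (λ k → ♯ (steps P) + (♯ (N ∷ []) + k)) eq) (sym (expand L)))
  where
  expand : ∀ K → ♯ (steps (P ++ north x ∷ K)) ≡ ♯ (steps P) + (♯ (N ∷ []) + ♯ (steps K))
  expand K = trans (cong ♯ (map-++ unlabel P _)) (trans (♯-++ (steps P) _) (cong (λ k → ♯ (steps P) + k) (♯-++ (N ∷ []) (steps K))))

fold-countN : ∀ {b c b′ c′ f} → Fold b c b′ c′ f → ∀ P x y →
  countN (steps (P ++ north x ∷ ending b y c)) ≡ countN (steps (P ++ north x ∷ ending b′ (f y) c′))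
fold-countN {b} {c} {b′} {c′} {f} F P x y = fold-count countN countN-++ P x (ending b y c) (ending b′ (f y) c′)
  (trans (proj₁ (count-ending b y c)) (sym (proj₁ (count-ending b′ (f y) c′))))

fold-countE : ∀ {b c b′ c′ f} → Fold b c b′ c′ f → ∀ P x y →
  countE (steps (P ++ north x ∷ ending b y c)) ≡ countE (steps (P ++ north x ∷ ending b′ (f y) c′))
fold-countE {b} {c} {b′} {c′} {f} F P x y = fold-count countE countE-++ P x (ending b y c) (ending b′ (f y) c′)
  (trans (proj₂ (count-ending b y c)) (trans (fold-sum F) (sym (proj₂ (count-ending b′ (f y) c′)))))

bfs-word-head : ∀ {s γ ls} → BFS (forest s) γ ls → γ ≡ N ∷ drop 1 γ
bfs-word-head {s} B = starts-N (forest s) B (nonempty s)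
  where
  nonempty : ∀ s → forest s ≢ []
  nonempty s eq with ++-conicalʳ (left s) (right s) eq
  ... | ()
  starts-N : ∀ f {γ ls} → BFS f γ ls → f ≢ [] → γ ≡ N ∷ drop 1 γ
  starts-N [] done ne = ⊥-elim (ne refl)
  starts-N (_ ∷ _) (visit b) _ = refl

bfs-normal : ∀ {b c b′ c′ f} → Fold b c b′ c′ f → ∀ n P x y s →
  InL (suc (suc n)) (steps (P ++ north x ∷ ending b y c)) →
  walk s ≡ P ++ north x ∷ ending b′ (f y) c′ →
  BFS (forest s) (N ∷ reverse (zetaB (suc (suc n)) (steps (P ++ north x ∷ ending b y c))))
    (roots (left s) ++ + 0 ∷ dB (suc (suc n)) (steps (P ++ north x ∷ ending b y c)) (labels (P ++ north x ∷ ending b y c)))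
bfs-normal F n P x y s (N≡ , E≡) walk≡ =
  subst₂ (BFS (forest s)) word≡ (cong (λ w → roots (left s) ++ + 0 ∷ w) (sym window≡)) B
  where
  open Normalise F n P x y N≡ E≡
  n₂ : ℕ
  n₂ = suc (suc n)
  R : List Row
  R = rows (+ 0) (walk s)
  length-walk : length (labels (walk s)) ≡ n₂
  length-walk = trans (cong (length ∘ labels) walk≡) (trans (length-labels normal) (trans (sym (fold-countN F P x y)) N≡))
  -- There are at most n arches, so the forest has at most 2n + 1 nodes and the levels 0, ..., 2n
  -- that ζ_B reads exhaust it.
  empty : ∀ j → suc (2 ℕ.* n₂) ≤ j → generation j (forest s) ≡ []
  empty j le = generation-empty j (forest s) (≤-trans (≤-reflexive (walk-size s)) (≤-trans
    (s≤s (≤-trans (+-mono-≤ (walk-arches s) (≤-refl {length (labels (walk s))})) (≤-reflexive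
      (trans (cong (λ k → k + k) length-walk) (cong (λ k → n₂ + k) (sym (+-identityʳ n₂))))))) le))
  B : BFS (forest s) (levels (wordLevel R) (suc (2 ℕ.* n₂))) (roots (left s) ++ + 0 ∷ levels (labelLevel R) (suc (2 ℕ.* n₂)))
  B = bfs-walk s (2 ℕ.* n₂) (empty (suc (2 ℕ.* n₂)) ≤-refl)
  word≡ : levels (wordLevel R) (suc (2 ℕ.* n₂)) ≡ N ∷ reverse (zetaB n₂ (steps original))
  word≡ = trans (bfs-word-head {s} B) (cong (N ∷_) (sym (trans (cong reverse (trans zeta-normal
    (cong (λ L → reverse (drop 1 (levels (wordLevel (rows (+ 0) L)) (suc (2 ℕ.* n₂))))) (sym walk≡)))) (reverse-involutive _))))
  window≡ : dB n₂ (steps original) (labels original) ≡ levels (labelLevel R) (suc (2 ℕ.* n₂))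
  window≡ = trans (d-normal (suc (2 ℕ.* n₂)) (λ j le → subst (λ L → labelLevel (rows (+ 0) L) j ≡ []) walk≡
      (labelLevel-[] s j (empty j le))))
    (cong (λ L → levels (labelLevel (rows (+ 0) L)) (suc (2 ℕ.* n₂))) (sym walk≡))

-- Links (π , v) to (β , w) without mentioning ζ_B or d_B, so that it can be produced from either
-- side: `encode` starts from a path, `diag-encoding` from a ballot word. Well-definedness,
-- injectivity and surjectivity are all read off from it.
record Encoding (n : ℕ) (π : List Step) (v : List ℤ) (β : List Step) (w : List ℤ) : Set where
  field
    P : List LStep
    x y : ℤ
    b c b′ c′ : ℕ
    f : ℤ → ℤ
    fold : Fold b c b′ c′ f
    steps≡ : steps (P ++ north x ∷ ending b y c) ≡ π
    labels≡ : labels (P ++ north x ∷ ending b y c) ≡ v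
    inL : InL n π
    shape : Shape
    walk≡ : walk shape ≡ P ++ north x ∷ ending b′ (f y) c′
    bfs : BFS (forest shape) (N ∷ reverse β) (roots (left shape) ++ + 0 ∷ w)

encode : ∀ n π v → InL (suc (suc n)) π → length v ≡ suc (suc n) →
         Encoding (suc (suc n)) π v (zetaB (suc (suc n)) π) (dB (suc (suc n)) π v)
encode n π v inL@(N≡ , E≡) len
  with attach π v | steps-attach π v (trans len (sym N≡)) | labels-attach π v (trans len (sym N≡))
... | L | refl | refl with splitEnding L N≡
... | P , x , b , y , c , refl with fold-total b c
... | b′ , c′ , f , F with parse-balanced _ (Normalise.normal-balanced F n P x y N≡ E≡)
... | s , walk≡ = record { P = P ; x = x ; y = y ; f = f ; fold = F ; steps≡ = refl ; labels≡ = refl ; inL = inL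
  ; shape = s ; walk≡ = walk≡ ; bfs = bfs-normal F n P x y s inL walk≡ }

-- A forest has only one breadth-first word and one list of labels, and `bfs-normal` shows that ζ_B
-- and d_B give them.
encoding-image : ∀ {n π v β w} → Encoding (suc (suc n)) π v β w → zetaB (suc (suc n)) π ≡ β × dB (suc (suc n)) π v ≡ w
encoding-image record { P = P ; x = x ; y = y ; fold = F ; steps≡ = refl ; labels≡ = refl ; inL = inL ; shape = s ; walk≡ = walk≡ ; bfs = bfs } =
  image (bfs-functional (bfs-normal F _ P x y s inL walk≡) bfs)
  where
  image : ∀ {β β′ w w′} → N ∷ reverse β ≡ N ∷ reverse β′ × roots (left s) ++ + 0 ∷ w ≡ roots (left s) ++ + 0 ∷ w′ → β ≡ β′ × w ≡ w′
  image (p , q) = reverse-injective (∷-injectiveʳ p) , ∷-injectiveʳ (++-cancelˡ (roots (left s)) _ _ q)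

module _ {n : ℕ} {π β : List Step} {v w : List ℤ} (e : Encoding (suc (suc n)) π v β w) where
  open Encoding e
  private
    n₂ : ℕ
    n₂ = suc (suc n)
    module Nm = Normalise fold n P x y (trans (cong countN steps≡) (proj₁ inL)) (trans (cong countE steps≡) (proj₂ inL))

  encoding-labels : abs w ↭ abs v
  encoding-labels = ↭-trans (bfs-labels bfs) (↭-reflexive (trans (cong (abs ∘ labels) walk≡)
    (trans Nm.normal-labels (cong abs labels≡))))

  vert⇒diag : length w ≡ n₂ → VertCondition π v → DiagCondition n₂ β w
  vert⇒diag len h = valleys⁺ n₂ β w (bfs-shape-increasing⁺ bfs len (walk-rising⁻ shape
    (subst (Rising (just (+ 0))) (sym walk≡) (Nm.normal-rising⁺ (vert⇒rising _ (subst₂ VertCondition (sym steps≡) (sym labels≡) h))))))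

  diag⇒vert : length w ≡ n₂ → DiagCondition n₂ β w → VertCondition π v
  diag⇒vert len h = subst₂ VertCondition steps≡ labels≡ (rising⇒vert _ (Nm.normal-rising⁻ (subst (Rising (just (+ 0))) walk≡
    (walk-rising⁺ shape (bfs-shape-increasing⁻ bfs len (valleys⁻ n₂ β w h))))))

  encoding-inDiag : InVert n₂ π v → InDiag n₂ β w
  encoding-inDiag (_ , perm , vert) = (length≡ , ballot⁻ β (proj₂ (bfs-ballot bfs))) , perm′ , vert⇒diag (proj₁ perm′) vert
    where
    perm′ : IsSignedPerm n₂ w
    perm′ = signedPerm-↭ (↭-sym encoding-labels) perm
    length≡ : length β ≡ 2 ℕ.* n₂
    length≡ = trans (sym (length-reverse β)) (trans (bfs-shape-length {shape} bfs) (cong (λ m → 2 ℕ.* m) (proj₁ perm′)))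

  encoding-inVert : InDiag n₂ β w → InVert n₂ π v
  encoding-inVert (_ , perm , diag) = inL , signedPerm-↭ encoding-labels perm , diag⇒vert (proj₁ perm) diag

-- Injectivity

arches-injective : ∀ s t → map leftTree s ≡ map leftTree t → map rightTree s ≡ map rightTree t → s ≡ t
arches-injective [] [] _ _ = refl
arches-injective ((p , z , q) ∷ s) ((p′ , z′ , q′) ∷ t) l r with ∷-injective l | ∷-injective r
... | l₁ , l₂ | r₁ , r₂ with l₁ | r₁ | arches-injective s t l₂ r₂
... | refl | refl | refl = refl

node-injective : ∀ {a b p q} → node a p ≡ node b q → p ≡ q
node-injective refl = refl

forest-injective : ∀ s t → length (proj₂ s) ≡ length (proj₂ t) → forest s ≡ forest t → s ≡ t
forest-injective (f , s) (g , t) len eq with ++-injective (left (f , s)) (left (g , t)) lengths eq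
  where
  lengths : length (left (f , s)) ≡ length (left (g , t))
  lengths = trans (length-reverse (map leftTree s)) (trans (length-map leftTree s)
    (trans len (sym (trans (length-reverse (map leftTree t)) (length-map leftTree t)))))
... | l , r with ∷-injective r
... | r₁ , r₂ = cong₂ _,_ (node-injective r₁) (arches-injective s t (reverse-injective l) r₂)

prefix-injective : {A : Set} {w : List A} (us vs : List A) {us′ vs′ : List A} →
  w ≡ us ++ us′ → w ≡ vs ++ vs′ → length us ≡ length vs → us ≡ vs
prefix-injective us vs eq eq′ len = proj₁ (++-injective us vs len (trans (sym eq) eq′))

-- The number of N's and `length w` determine the number m of arches. The first m entries of `w`
-- then fix the root labels left of 0, so both traversals have the same full list of labels.
shape-injective : ∀ {s t γ w} → BFS (forest s) γ (roots (left s) ++ + 0 ∷ w) → BFS (forest t) γ (roots (left t) ++ + 0 ∷ w) → s ≡ t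
shape-injective {s} {t} {γ} {w} B C = forest-injective s t sizes
  (bfs-injective B C refl (cong (_++ + 0 ∷ w) (trans (roots-left s) (trans (cong negatives zeros) (sym (roots-left t))))))
  where
  sizes : length (proj₂ s) ≡ length (proj₂ t)
  sizes = +-cancelʳ-≡ (suc (length w)) _ _ (trans (sym (bfs-shape-countN B)) (bfs-shape-countN C))
  zeros : map root (proj₂ s) ≡ map root (proj₂ t)
  zeros = prefix-injective (map root (proj₂ s)) (map root (proj₂ t)) (proj₂ (bfs-window B)) (proj₂ (bfs-window C))
    (trans (length-map root (proj₂ s)) (trans sizes (sym (length-map root (proj₂ t)))))

encoding-injective : ∀ {n π π′ v v′ β w} → Encoding n π v β w → Encoding n π′ v′ β w → π ≡ π′ × v ≡ v′
encoding-injective e e′ =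
  trans (sym e.steps≡) (trans (cong steps same) e′.steps≡) , trans (sym e.labels≡) (trans (cong labels same) e′.labels≡)
  where
  module e = Encoding e
  module e′ = Encoding e′
  shapes : e.shape ≡ e′.shape
  shapes = shape-injective e.bfs e′.bfs
  same : e.P ++ north e.x ∷ ending e.b e.y e.c ≡ e′.P ++ north e′.x ∷ ending e′.b e′.y e′.c
  same with ending-injective e.P e′.P (trans (sym e.walk≡) (trans (cong walk shapes) e′.walk≡))
  ... | Px , b′≡ , fy≡ , c′≡ with fold-injective e.fold e′.fold b′≡ c′≡
  ... | b≡ , c≡ , f≡ = begin
    e.P ++ north e.x ∷ ending e.b e.y e.c            ≡⟨ sym (++-assoc e.P _ _) ⟩
    (e.P ++ north e.x ∷ []) ++ ending e.b e.y e.c    ≡⟨ cong₂ _++_ Px ends ⟩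
    (e′.P ++ north e′.x ∷ []) ++ ending e′.b e′.y e′.c ≡⟨ ++-assoc e′.P _ _ ⟩
    e′.P ++ north e′.x ∷ ending e′.b e′.y e′.c       ∎
    where
    open ≡-Reasoning
    y≡ : e.y ≡ e′.y
    y≡ = fold-label-injective e.fold (trans fy≡ (cong (λ g → g e′.y) (sym f≡)))
    ends : ending e.b e.y e.c ≡ ending e′.b e′.y e′.c
    ends = trans (cong₂ (λ b c → ending b e.y c) b≡ c≡) (cong (λ y → ending e′.b y e′.c) y≡)

-- Surjectivity

arches-onto : ∀ zs fs gs → roots fs ≡ map ℤ.-_ zs → roots gs ≡ zs → ∃ λ s → map leftTree s ≡ fs × map rightTree s ≡ gs
arches-onto [] [] [] _ _ = [] , refl , refl
arches-onto (z ∷ zs) (node a p ∷ fs) (node b q ∷ gs) l r with ∷-injective l | ∷-injective r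
... | refl , l′ | refl , r′ with arches-onto zs fs gs l′ r′
... | s , refl , refl = (p , z , q) ∷ s , refl , refl

-- The symmetry of the root labels about 0 is what lets the k-th tree to the left of the middle and
-- the k-th to the right be glued into one arch.
forest-onto : ∀ zs F → roots F ≡ negatives zs ++ + 0 ∷ zs → ∃ λ s → forest s ≡ F × map root (proj₂ s) ≡ zs
forest-onto zs F eq with map-split label F (negatives zs) eq
... | fs , node _ q ∷ gs , refl , l , r with refl ← ∷-injectiveˡ r
  with arches-onto zs (reverse fs) gs (trans (reverse-map label fs) (trans (cong reverse l) (reverse-involutive _))) (∷-injectiveʳ r)
... | s , l≡ , refl = (q , s) , cong (_++ node (+ 0) q ∷ map rightTree s) (trans (cong reverse l≡) (reverse-involutive fs)) ,
  trans (map-∘ s) (∷-injectiveʳ r)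

length-negatives : ∀ zs → length (negatives zs) ≡ length zs
length-negatives zs = trans (length-reverse (map ℤ.-_ zs)) (length-map ℤ.-_ zs)

diag-shape : ∀ n β w → IsBallot n β → length w ≡ n →
             ∃ λ s → BFS (forest s) (N ∷ reverse β) (roots (left s) ++ + 0 ∷ w)
diag-shape n β w (length-β , prefixes) length-w = decoded (bfs-decode (N ∷ reverse β) ls length-ls (head≤ , ballot⁺ β prefixes))
  where
  e m : ℕ
  e = countE β
  -- The number of arches: a shape with m arches yields a word with n - m E's.
  m = n ∸ e
  zs ls : List ℤ
  zs = take m w
  ls = negatives zs ++ + 0 ∷ w
  total : countN β + e ≡ n + n
  total = trans (sym (length-count β)) (trans length-β (cong (λ k → n + k) (+-identityʳ n)))
  e≤N : e ≤ countN β
  e≤N = subst₂ _≤_ (countE-reverse β) (countN-reverse β) (ballot-head _ (ballot⁺ β prefixes))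
  e≤n : e ≤ n
  e≤n = ≮⇒≥ λ n<e → <⇒≢ (+-mono-<-≤ n<e (<⇒≤ n<e)) (≤-antisym (<⇒≤ (+-mono-<-≤ n<e (<⇒≤ n<e))) (≤-trans (+-monoˡ-≤ e e≤N) (≤-reflexive total)))
  m+e : m + e ≡ n
  m+e = m∸n+n≡m e≤n
  N≡ : countN β ≡ m + n
  N≡ = +-cancelʳ-≡ e _ _ (trans total (trans (cong (_+ n) (sym m+e)) (swap m e n)))
    where
    open ℕ-Solver
    swap : ∀ m e n → (m + e) + n ≡ (m + n) + e
    swap = solve 3 (λ m e n → (m :+ e) :+ n := (m :+ n) :+ e) refl
  length-zs : length zs ≡ m
  length-zs = trans (length-take m w) (m≤n⇒m⊓n≡m (≤-trans (m∸n≤m n e) (≤-reflexive (sym length-w))))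
  length-ls : length ls ≡ suc (countN (reverse β))
  length-ls = trans (length-++ (negatives zs)) (trans (cong₂ (λ a b → a + suc b) (trans (length-negatives zs) length-zs) length-w)
    (trans (+-suc m n) (cong suc (trans (sym N≡) (sym (countN-reverse β))))))
  head≤ : countE (reverse β) ≤ suc (countN (reverse β))
  head≤ = m≤n⇒m≤1+n (subst₂ _≤_ (sym (countE-reverse β)) (sym (countN-reverse β)) e≤N)
  decoded : (∃ λ c → ∃ λ F → ∃ λ δ → N ∷ reverse β ≡ replicate c E ++ δ × BFS F δ ls × c ≤ length F) →
            ∃ λ s → BFS (forest s) (N ∷ reverse β) (roots (left s) ++ + 0 ∷ w)
  -- The word starts with N, so no E is left waiting for a parent.
  decoded (zero , F , _ , refl , B , _) with bfs-roots B
  ... | rest , eq with forest-onto zs F (proj₁ (++-injective (roots F) (negatives zs ++ + 0 ∷ zs) lengths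
      (trans (sym eq) (trans (cong (λ u → negatives zs ++ + 0 ∷ u) (sym (take++drop≡id m w))) (sym (++-assoc (negatives zs) _ _))))))
    where
    size : length F ≡ m + suc m
    size = +-cancelʳ-≡ (countE (reverse β)) _ _ (trans (sym (bfs-balance B)) (trans (cong suc (trans (countN-reverse β) (trans N≡ (cong (λ k → m + k) (sym m+e)))))
      (trans (cong suc (sym (+-assoc m m e))) (cong₂ _+_ (sym (+-suc m m)) (sym (countE-reverse β))))))
    lengths : length (roots F) ≡ length (negatives zs ++ + 0 ∷ zs)
    lengths = trans (length-map label F) (trans size (sym (trans (length-++ (negatives zs))
      (cong₂ (λ a b → a + suc b) (trans (length-negatives zs) length-zs) length-zs))))
  ... | s , refl , roots≡ = s , subst (λ ls → BFS (forest s) (N ∷ reverse β) (ls ++ + 0 ∷ w))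
    (sym (trans (roots-left s) (cong negatives roots≡))) B

diag-encoding : ∀ n β w → IsBallot (suc (suc n)) β → length w ≡ suc (suc n) →
                ∃ λ π → ∃ λ v → Encoding (suc (suc n)) π v β w
diag-encoding n β w ballot length-w with diag-shape (suc (suc n)) β w ballot length-w
... | s , B = encoded (splitEnding (walk s) N≡)
  where
  N≡ : countN (steps (walk s)) ≡ suc (suc n)
  N≡ = trans (sym (length-labels (walk s))) (trans (sym (length-map ∣_∣ (labels (walk s))))
    (trans (sym (↭-length (bfs-labels B))) (trans (length-map ∣_∣ w) length-w)))
  encoded : (∃ λ P → ∃ λ x → ∃ λ b → ∃ λ y → ∃ λ c → walk s ≡ P ++ north x ∷ ending b y c) →
            ∃ λ π → ∃ λ v → Encoding (suc (suc n)) π v β w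
  encoded (P , x , b′ , z , c′ , walk≡) with fold-onto b′ c′
  ... | b , c , f , F with fold-label-onto F z
  ... | y , refl = steps original , labels original , record
    { P = P ; x = x ; y = y ; f = f ; fold = F ; steps≡ = refl ; labels≡ = refl
    ; inL = trans (fold-countN F P x y) (trans (cong (countN ∘ steps) (sym walk≡)) N≡) ,
            trans (fold-countE F P x y) (trans (cong (countE ∘ steps) (sym walk≡)) (trans (sym (walk-balanced s)) N≡))
    ; shape = s ; walk≡ = walk≡ ; bfs = B }
    where
    original : List LStep
    original = P ++ north x ∷ ending b y c

theorem6p20 : (n : ℕ) → 2 ≤ n →
    ((π : List Step) (v : List ℤ) → InVert n π v → InDiag n (zetaB n π) (dB n π v))
    × ((π π′ : List Step) (v v′ : List ℤ) → InVert n π v → InVert n π′ v′ →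
    zetaB n π ≡ zetaB n π′ → dB n π v ≡ dB n π′ v′ → π ≡ π′ × v ≡ v′)
    × ((β : List Step) (w : List ℤ) → InDiag n β w →
    Σ (List Step) (λ π → Σ (List ℤ) (λ v →
    InVert n π v × zetaB n π ≡ β × dB n π v ≡ w)))
theorem6p20 (suc (suc n)) (s≤s (s≤s z≤n)) = wellDefined , injective , surjective
  where
  wellDefined : (π : List Step) (v : List ℤ) → InVert (suc (suc n)) π v →
    InDiag (suc (suc n)) (zetaB (suc (suc n)) π) (dB (suc (suc n)) π v)
  wellDefined π v h@(inL , (len , _) , _) = encoding-inDiag (encode n π v inL len) h
  injective : (π π′ : List Step) (v v′ : List ℤ) → InVert (suc (suc n)) π v → InVert (suc (suc n)) π′ v′ →
    zetaB (suc (suc n)) π ≡ zetaB (suc (suc n)) π′ → dB (suc (suc n)) π v ≡ dB (suc (suc n)) π′ v′ → π ≡ π′ × v ≡ v′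
  injective π π′ v v′ (inL , (len , _) , _) (inL′ , (len′ , _) , _) ζ≡ d≡ = encoding-injective (encode n π v inL len)
    (subst₂ (Encoding (suc (suc n)) π′ v′) (sym ζ≡) (sym d≡) (encode n π′ v′ inL′ len′))
  surjective : (β : List Step) (w : List ℤ) → InDiag (suc (suc n)) β w →
    Σ (List Step) (λ π → Σ (List ℤ) (λ v → InVert (suc (suc n)) π v × zetaB (suc (suc n)) π ≡ β × dB (suc (suc n)) π v ≡ w))
  surjective β w h@(ballot , (len , _) , _) = preimage (diag-encoding n β w ballot len)
    where
    preimage : (∃ λ π → ∃ λ v → Encoding (suc (suc n)) π v β w) →
      Σ (List Step) (λ π → Σ (List ℤ) (λ v → InVert (suc (suc n)) π v × zetaB (suc (suc n)) π ≡ β × dB (suc (suc n)) π v ≡ w))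
    preimage (π , v , e) = π , v , encoding-inVert e h , encoding-image e
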